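{- Let $U:\mathbb{Z}\to\mathbb{Q}$ be a linear recurrence sequence, let $a\in\mathbb{Z}$, and let $p$ be a regular prime for $U$. Assume that there exists a sequence of integers $(n_k)$ such that $\nu_p(U(n_k))\to+\infty$ and $\nu_p(n_k-a)\to+\infty$. Then $a$ is a twisted zero of $U$.
   Context: A $\mathbb{Q}$-valued linear recurrence sequence (LRS) is a map $U:\mathbb{Z}\to\mathbb{Q}$ with $U(n+m)=a_{m-1}U(n+m-1)+\dots+a_0U(n)$ for all $n\in\mathbb{Z}$, with $a_i\in\mathbb{Q}$, $a_0\ne0$, $m$ minimal. Let $\lambda_1,\dots,\lambda_s\in\overline{\mathbb{Q}}$ be the distinct roots of $X^m-a_{m-1}X^{m-1}-\dots-a_0$; then $U(n)=f_1(n)\lambda_1^n+\dots+f_s(n)\lambda_s^n$ for all $n\in\mathbb{Z}$ with nonzero polynomials $f_i$ over $\mathbb{Q}(\lambda_1,\dots,\lambda_s)$ (Binet expansion). An integer $a$ is a twisted zero of $U$ if there are roots of unity $\xi_1,\dots,\xi_s$ with $\xi_1f_1(a)\lambda_1^a+\dots+\xi_sf_s(a)\lambda_s^a=0$. A prime $p$ is regular for $U$ if $p$ divides neither the denominators of $a_0,\dots,a_{m-1}$ nor the numerator of $a_0$. $\nu_p$ is the $p$-adic valuation, $\nu_p(0)=+\infty$. -}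

module Defs where

open import Level using (Level; 0ℓ) renaming (suc to lsuc; _⊔_ to _⊔ˡ_)
open import Data.Nat as ℕ using (ℕ; zero; suc)
import Data.Nat.Divisibility as ℕD
open import Data.Integer as ℤ using (ℤ; +_; -[1+_])
open import Data.Rational as ℚ using (ℚ; 0ℚ; 1ℚ)
open import Data.Fin using (Fin; toℕ)
open import Data.List using (List; []; _∷_; foldr)
open import Data.List.Relation.Unary.Any using (Any)
open import Data.Product using (Σ; ∃; _×_; _,_)
open import Relation.Nullary using (¬_)
open import Relation.Binary.PropositionalEquality using (_≡_; _≢_)
open import Algebra.Bundles using (CommutativeRing)

sumℚ : ∀ n → (Fin n → ℚ) → ℚ
sumℚ zero    g = 0ℚ
sumℚ (suc n) g = g Data.Fin.zero ℚ.+ sumℚ n (λ i → g (Data.Fin.suc i))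

ℤtoℚ : ℤ → ℚ
ℤtoℚ n = n ℚ./ 1

SatisfiesRec : (U : ℤ → ℚ) (m : ℕ) (a : Fin m → ℚ) → Set
SatisfiesRec U m a =
  ∀ (n : ℤ) → U (n ℤ.+ + m) ≡ sumℚ m (λ i → a i ℚ.* U (n ℤ.+ + toℕ i))

-- a_0 ≠ 0 (vacuous when m = 0)
ConstCoeffNonzero : (m : ℕ) (a : Fin m → ℚ) → Set
ConstCoeffNonzero m a = ∀ (i : Fin m) → toℕ i ≡ 0 → a i ≢ 0ℚ

record IsLRS (U : ℤ → ℚ) (m : ℕ) (a : Fin m → ℚ) : Set where
  field
    rec     : SatisfiesRec U m a
    a₀≢0    : ConstCoeffNonzero m a
    minimal : ∀ (m' : ℕ) → m' ℕ.< m → (b : Fin m' → ℚ) →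
              ConstCoeffNonzero m' b → ¬ SatisfiesRec U m' b

Regular : (p : ℕ) (m : ℕ) (a : Fin m → ℚ) → Set
Regular p m a =
  (∀ (i : Fin m) → ¬ (p ℕD.∣ ℚ.ℚ.denominatorℕ (a i))) ×
  (∀ (i : Fin m) → toℕ i ≡ 0 → ¬ (p ℕD.∣ ℤ.∣ ℚ.ℚ.numerator (a i) ∣))

-- p-adic valuation lower bounds (ν_p(0) = +∞)

νℤ≥ : (p : ℕ) (n : ℤ) (M : ℕ) → Set
νℤ≥ p n M = (p ℕ.^ M) ℕD.∣ ℤ.∣ n ∣

νℚ≥ : (p : ℕ) (q : ℚ) (M : ℕ) → Set
νℚ≥ p q M = ((p ℕ.^ M) ℕD.∣ ℤ.∣ ℚ.ℚ.numerator q ∣) ×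
            ¬ (p ℕD.∣ ℚ.ℚ.denominatorℕ q)

TendsToInfty : {X : Set} (V : X → ℕ → Set) (s : ℕ → X) → Set
TendsToInfty V s = ∀ (M : ℕ) → ∃ λ k₀ → ∀ (k : ℕ) → k₀ ℕ.≤ k → V (s k) M

-- An algebraically closed field containing ℚ (playing the role of ℚ̄)

module RingOps {c ℓ : Level} (R : CommutativeRing c ℓ) where
  open CommutativeRing R

  pow : Carrier → ℕ → Carrier
  pow x zero    = 1#
  pow x (suc n) = x * pow x n

  sum : ∀ n → (Fin n → Carrier) → Carrier
  sum zero    g = 0#
  sum (suc n) g = g Data.Fin.zero + sum n (λ i → g (Data.Fin.suc i))

record AlgClosedFieldOverℚ (c ℓ : Level) : Set (lsuc (c ⊔ˡ ℓ)) where
  field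
    cring : CommutativeRing c ℓ
  open CommutativeRing cring
  open RingOps cring
  field
    1≉0     : ¬ (1# ≈ 0#)
    inv     : (x : Carrier) → ¬ (x ≈ 0#) → Carrier
    inv-r   : ∀ x (nz : ¬ (x ≈ 0#)) → (x * inv x nz) ≈ 1#
    ι       : ℚ → Carrier
    ι-+     : ∀ q r → ι (q ℚ.+ r) ≈ (ι q + ι r)
    ι-*     : ∀ q r → ι (q ℚ.* r) ≈ (ι q * ι r)
    ι-1     : ι 1ℚ ≈ 1#
    algClosed : ∀ (d : ℕ) (cs : Fin (suc d) → Carrier) →
                ∃ λ x → (pow x (suc d) + sum (suc d) (λ i → cs i * pow x (toℕ i))) ≈ 0#

module ACF {c ℓ : Level} (K : AlgClosedFieldOverℚ c ℓ) where
  open AlgClosedFieldOverℚ K public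
  open CommutativeRing cring public
  open RingOps cring public

  zpow : (x : Carrier) → ¬ (x ≈ 0#) → ℤ → Carrier
  zpow x nz (+ n)     = pow x n
  zpow x nz -[1+ n ] = pow (inv x nz) (suc n)

  -- polynomials over K as coefficient lists (constant term first)
  eval : List Carrier → Carrier → Carrier
  eval cs t = foldr (λ c acc → c + t * acc) 0# cs

  NonzeroPoly : List Carrier → Set (c ⊔ˡ ℓ)
  NonzeroPoly cs = Any (λ c → ¬ (c ≈ 0#)) cs

  RootOfUnity : Carrier → Set ℓ
  RootOfUnity ξ = ∃ λ k → (1 ℕ.≤ k) × (pow ξ k ≈ 1#)

  CharRoot : (m : ℕ) (a : Fin m → ℚ) → Carrier → Set ℓ
  CharRoot m a x = pow x m ≈ sum m (λ i → ι (a i) * pow x (toℕ i))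

  record BinetExpansion (U : ℤ → ℚ) (m : ℕ) (a : Fin m → ℚ) : Set (c ⊔ˡ ℓ) where
    field
      s        : ℕ
      lam      : Fin s → Carrier
      lam≉0    : ∀ i → ¬ (lam i ≈ 0#)
      distinct : ∀ i j → lam i ≈ lam j → i ≡ j
      roots    : ∀ i → CharRoot m a (lam i)
      allRoots : ∀ x → CharRoot m a x → ∃ λ i → x ≈ lam i
      f        : Fin s → List Carrier
      f≠0      : ∀ i → NonzeroPoly (f i)
      expand   : ∀ (n : ℤ) →
                 ι (U n) ≈ sum s (λ i → eval (f i) (ι (ℤtoℚ n)) * zpow (lam i) (lam≉0 i) n)

    TwistedZero : ℤ → Set (c ⊔ˡ ℓ)
    TwistedZero a' = ∃ λ (ξ : Fin s → Carrier) → (∀ i → RootOfUnity (ξ i)) ×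
      (sum s (λ i → ξ i * eval (f i) (ι (ℤtoℚ a')) * zpow (lam i) (lam≉0 i) a') ≈ 0#)

{-# OPTIONS --safe #-}
module Submission where

-- Write R for the ring generated over ℤ localised at p by the roots l_i and by the roots r_j of
-- X^N - 1, where N is chosen such that l_i^N ≡ 1 mod pR; it is a finitely generated module, and
-- regularity of p makes every l_i a unit of R. If n is p-adically close to a, then y_i = l_i^(n - a)
-- satisfies y_i^N ≡ 1, and f_i(n) ≡ f_i(a), modulo a high power of p; hence U(n) ≡ Σ y_i x_i with
-- x_i = f_i(a) l_i^a. As ∏_j (A + r_j B) = A^N - (-B)^N depends on B only through B^N, the product
-- W of all twisted sums Σ ξ_i x_i, ξ_i ∈ {r_j}, does not change modulo p^M when x_i is replaced by
-- y_i x_i, and then one of its factors is ≡ U(n) ≡ 0. So W is divisible by every power of p in R (up to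
-- a fixed denominator), and Nakayama's lemma gives W = 0: one of the factors vanishes.
--
-- Equality in K is not assumed decidable, so selecting that factor takes an argument. If s ≥ 2, an
-- idempotent e of K gives the characteristic root e l_0 + (1 - e) l_1, which occurs in the given list
-- of roots, and so e is decidably 0 or 1. This decides equality of roots of unity; as equality of
-- characteristic roots is decidable too, Euclid's algorithm decides equality in R. If s = 1 the
-- twisted sum is a unit times U(a).

open import Defs
open import Level using (0ℓ)
open import Algebra.Bundles using (RawRing)
import Algebra.Solver.Ring
import Algebra.Solver.Ring.AlmostCommutativeRing as ACR
open import Data.Empty using (⊥-elim)
open import Data.Fin as F using (Fin; zero; suc; toℕ; punchIn)
import Data.Fin.Properties as FP
open import Data.Integer as ℤ using (ℤ; +_; -[1+_])
import Data.Integer.Divisibility.Signed as ℤD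
import Data.Integer.DivMod as ℤDM
import Data.Integer.Properties as ℤP
open import Data.Integer.Tactic.RingSolver using (solve-∀)
open import Data.List as L using (List; []; _∷_; length; _++_)
import Data.List.Properties as LP
open import Data.List.Relation.Unary.All as All using (All; []; _∷_)
import Data.List.Relation.Unary.All.Properties as AllP
open import Data.Maybe using (Maybe; just; nothing)
open import Data.Nat as ℕ using (ℕ; zero; suc)
import Data.Nat.Coprimality as Coprimality
import Data.Nat.Divisibility as ℕD
import Data.Nat.GCD as ℕGCD
open import Data.Nat.Induction using (<-wellFounded)
open import Data.Nat.Primality as Primality using (Prime; euclidsLemma)
import Data.Nat.Properties as ℕP
open import Data.Product using (∃; _×_; _,_; proj₁; proj₂)
open import Data.Rational as ℚ using (ℚ; 0ℚ)
import Data.Rational.Properties as ℚP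
import Data.Rational.Unnormalised as ℚᵘ
import Data.Rational.Unnormalised.Properties as ℚᵘP
open import Data.Sum as Sum using (_⊎_; inj₁; inj₂)
import Data.Vec.Functional as VF
import Data.Vec.Functional.Properties as VFP
open import Induction.WellFounded using (Acc; acc)
open import Relation.Binary.PropositionalEquality as ≡ using (_≡_; _≢_)
open import Relation.Nullary using (¬_; Dec; yes; no)

-- The statement suggests a passage to the limit: by compactness the powers l_i^(n_k - a) would
-- accumulate p-adically at roots of unity, and these would serve as the ξ_i. But K is an abstract
-- field without a p-adic topology. Multiplying over all candidate tuples ξ replaces the choice of a
-- limit point, and every congruence takes place in R at one finite level p^M.
--
-- A second obstacle is that the coefficients of the f_i are only given as elements of K. Since the
-- values of U are rational, difference operators and interpolation force these coefficients into R
-- ⊗ ℚ; this is where the fixed denominator comes from.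
--
-- Finally, separation only shows that W ≉ 0 is absurd, and even W ≈ 0 would not exhibit a vanishing
-- factor. Hence the zero tests: once each factor is known to be zero or nonzero, the absurdity of W
-- ≉ 0 leaves a factor that is zero.

module FieldOverℚ (K : AlgClosedFieldOverℚ 0ℓ 0ℓ) where

  open ACF K public hiding (zero)
  open import Algebra.Properties.Ring ring public
    using (-‿distribˡ-*; -‿distribʳ-*; -‿involutive; -0#≈0#; x+x≈x⇒x≈0; -1*x≈-x)
  open import Relation.Binary.Reasoning.Setoid setoid public
  open import Algebra.Properties.AbelianGroup +-abelianGroup
    using () renaming (inverseˡ-unique to -‿unique)

  -- Integers and rationals inside K

  ℤtoℚ-+ : ∀ m n → ℤtoℚ (m ℤ.+ n) ≡ ℤtoℚ m ℚ.+ ℤtoℚ n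
  ℤtoℚ-+ m n = ℚP.toℚᵘ-injective (ℚᵘP.≃-trans (ℚP.toℚᵘ-fromℚᵘ (ℚᵘ.mkℚᵘ (m ℤ.+ n) 0))
    (ℚᵘP.≃-trans (ℚᵘ.*≡* (≡.cong (ℤ._* + 1) (≡.sym (≡.cong₂ ℤ._+_ (ℤP.*-identityʳ m) (ℤP.*-identityʳ n)))))
    (ℚᵘP.≃-trans (ℚᵘP.+-cong (ℚᵘP.≃-sym (ℚP.toℚᵘ-fromℚᵘ (ℚᵘ.mkℚᵘ m 0))) (ℚᵘP.≃-sym (ℚP.toℚᵘ-fromℚᵘ (ℚᵘ.mkℚᵘ n 0))))
    (ℚᵘP.≃-sym (ℚP.toℚᵘ-homo-+ (ℤtoℚ m) (ℤtoℚ n))))))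

  ℤtoℚ-* : ∀ m n → ℤtoℚ (m ℤ.* n) ≡ ℤtoℚ m ℚ.* ℤtoℚ n
  ℤtoℚ-* m n = ℚP.toℚᵘ-injective (ℚᵘP.≃-trans (ℚP.toℚᵘ-fromℚᵘ (ℚᵘ.mkℚᵘ (m ℤ.* n) 0))
    (ℚᵘP.≃-trans (ℚᵘP.*-cong (ℚᵘP.≃-sym (ℚP.toℚᵘ-fromℚᵘ (ℚᵘ.mkℚᵘ m 0))) (ℚᵘP.≃-sym (ℚP.toℚᵘ-fromℚᵘ (ℚᵘ.mkℚᵘ n 0))))
    (ℚᵘP.≃-sym (ℚP.toℚᵘ-homo-* (ℤtoℚ m) (ℤtoℚ n)))))

  denominator*≡numerator : ∀ q → ℤtoℚ (+ ℚ.ℚ.denominatorℕ q) ℚ.* q ≡ ℤtoℚ (ℚ.ℚ.numerator q)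
  denominator*≡numerator q = ℚP.toℚᵘ-injective
    (ℚᵘP.≃-trans (ℚP.toℚᵘ-homo-* (ℤtoℚ (+ ℚ.ℚ.denominatorℕ q)) q)
    (ℚᵘP.≃-trans (ℚᵘP.*-cong (ℚP.toℚᵘ-fromℚᵘ (ℚᵘ.mkℚᵘ (+ ℚ.ℚ.denominatorℕ q) 0)) (ℚᵘP.≃-refl {ℚ.toℚᵘ q}))
    (ℚᵘP.≃-trans (lem q)
    (ℚᵘP.≃-sym (ℚP.toℚᵘ-fromℚᵘ (ℚᵘ.mkℚᵘ (ℚ.ℚ.numerator q) 0))))))
    where
    lem : ∀ q → ℚᵘ.mkℚᵘ (+ ℚ.ℚ.denominatorℕ q) 0 ℚᵘ.* ℚ.toℚᵘ q ℚᵘ.≃ ℚᵘ.mkℚᵘ (ℚ.ℚ.numerator q) 0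
    lem (ℚ.mkℚ n d-1 c) = ℚᵘ.*≡* (≡.trans (ℤP.*-identityʳ _) (≡.trans (ℤP.*-comm (+ suc d-1) n)
      (≡.cong (n ℤ.*_) (≡.cong +_ (≡.sym (ℕP.+-identityʳ (suc d-1)))))))

  abstract
    -- Abstract, so that type checking never normalises the rational number `ℤtoℚ z`; `ν≡ι` leads
    -- back to `ι` when needed.
    ν : ℤ → Carrier
    ν z = ι (ℤtoℚ z)

    ν≡ι : ∀ z → ν z ≡ ι (ℤtoℚ z)
    ν≡ι z = ≡.refl

  ι-≡ : ∀ {q r} → q ≡ r → ι q ≈ ι r
  ι-≡ e = reflexive (≡.cong ι e)

  ι-0 : ι 0ℚ ≈ 0#
  ι-0 = x+x≈x⇒x≈0 (ι 0ℚ) (trans (sym (ι-+ 0ℚ 0ℚ)) refl)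

  ν-0 : ν (+ 0) ≈ 0#
  ν-0 = trans (reflexive (ν≡ι (+ 0))) ι-0

  ν-1 : ν (+ 1) ≈ 1#
  ν-1 = trans (reflexive (ν≡ι (+ 1))) ι-1

  ν-+ : ∀ m n → ν (m ℤ.+ n) ≈ ν m + ν n
  ν-+ m n rewrite ν≡ι (m ℤ.+ n) | ν≡ι m | ν≡ι n = trans (ι-≡ (ℤtoℚ-+ m n)) (ι-+ _ _)

  ν-* : ∀ m n → ν (m ℤ.* n) ≈ ν m * ν n
  ν-* m n rewrite ν≡ι (m ℤ.* n) | ν≡ι m | ν≡ι n = trans (ι-≡ (ℤtoℚ-* m n)) (ι-* _ _)

  ν-neg : ∀ m → ν (ℤ.- m) ≈ - ν m
  ν-neg m = -‿unique (ν (ℤ.- m)) (ν m) (trans (sym (ν-+ (ℤ.- m) m)) (trans (reflexive (≡.cong ν (ℤP.+-inverseˡ m))) ν-0))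

  -- The integers in K, arranged so that the literals 0 and 1 compute to 0# and 1#: the ring
  -- solver below can then treat these constants definitionally.
  private
    κ : ℤ → Carrier
    κ (+ 0)  = 0#
    κ (+ 1)  = 1#
    κ z      = ν z

    κ≈ν : ∀ z → κ z ≈ ν z
    κ≈ν (+ 0) = sym ν-0
    κ≈ν (+ 1) = sym ν-1
    κ≈ν (+ suc (suc n)) = refl
    κ≈ν -[1+ n ] = refl

    ℤ-rawRing : RawRing 0ℓ 0ℓ
    ℤ-rawRing = record { Carrier = ℤ ; _≈_ = _≡_ ; _+_ = ℤ._+_ ; _*_ = ℤ._*_ ; -_ = ℤ.-_ ; 0# = + 0 ; 1# = + 1 }

    morphism : ℤ-rawRing ACR.-Raw-AlmostCommutative⟶ ACR.fromCommutativeRing cring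
    morphism = record
      { ⟦_⟧ = κ
      ; +-homo = λ m n → trans (κ≈ν (m ℤ.+ n)) (trans (ν-+ m n) (+-cong (sym (κ≈ν m)) (sym (κ≈ν n))))
      ; *-homo = λ m n → trans (κ≈ν (m ℤ.* n)) (trans (ν-* m n) (*-cong (sym (κ≈ν m)) (sym (κ≈ν n))))
      ; -‿homo = λ m → trans (κ≈ν (ℤ.- m)) (trans (ν-neg m) (-‿cong (sym (κ≈ν m))))
      ; 0-homo = refl
      ; 1-homo = refl
      }

    dec-κ : ∀ m n → Maybe (κ m ≈ κ n)
    dec-κ m n with m ℤ.≟ n
    ... | yes e = just (reflexive (≡.cong κ e))
    ... | no _  = nothing

  open Algebra.Solver.Ring ℤ-rawRing (ACR.fromCommutativeRing cring) morphism dec-κ public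
    using (solve; _:+_; _:*_; _:-_; :-_; con; _:=_)

  ≉0-resp : ∀ {x y} → x ≈ y → ¬ x ≈ 0# → ¬ y ≈ 0#
  ≉0-resp e nz z = nz (trans e z)

  unit≉0 : ∀ {x y} → x * y ≈ 1# → ¬ x ≈ 0#
  unit≉0 {x} {y} e z = 1≉0 (trans (sym e) (trans (*-congʳ z) (zeroˡ y)))

  cancel-≉0 : ∀ {x y} → ¬ x ≈ 0# → x * y ≈ 0# → y ≈ 0#
  cancel-≉0 {x} {y} nz e = begin
    y                    ≈⟨ *-identityˡ y ⟨
    1# * y               ≈⟨ *-congʳ (inv-r x nz) ⟨
    (x * inv x nz) * y   ≈⟨ solve 3 (λ x i y → (x :* i) :* y := i :* (x :* y)) refl x (inv x nz) y ⟩
    inv x nz * (x * y)   ≈⟨ *-congˡ e ⟩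
    inv x nz * 0#        ≈⟨ zeroʳ _ ⟩
    0#                   ∎

  *-≉0 : ∀ {x y} → ¬ x ≈ 0# → ¬ y ≈ 0# → ¬ x * y ≈ 0#
  *-≉0 nx ny e = ny (cancel-≉0 nx e)

  x-y≈0⇒x≈y : ∀ {x y} → x - y ≈ 0# → x ≈ y
  x-y≈0⇒x≈y {x} {y} e = trans (solve 2 (λ x y → x := (x :- y) :+ y) refl x y) (trans (+-congʳ e) (+-identityˡ y))

  x≈y⇒x-y≈0 : ∀ {x y} → x ≈ y → x - y ≈ 0#
  x≈y⇒x-y≈0 {x} {y} e = trans (+-congʳ e) (-‿inverseʳ y)

  -- Equality in ℚ is decidable, and a nonzero rational has an inverse, whose image makes `ι q` a
  -- unit of K.
  ι≈0⇒≡0 : ∀ q → ι q ≈ 0# → q ≡ 0ℚ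
  ι≈0⇒≡0 q e with q ℚP.≟ 0ℚ
  ... | yes z = z
  ... | no nz = ⊥-elim (unit≉0 (trans (sym (ι-* q (ℚ.1/ q))) (trans (ι-≡ (ℚP.*-inverseʳ q)) ι-1)) e)
    where instance _ = ℚ.≢-nonZero nz

  ν≈0⇒≡0 : ∀ z → ν z ≈ 0# → z ≡ + 0
  ν≈0⇒≡0 z e = ≡.trans (≡.sym (ℤP.*-identityʳ z)) (ℤtoℚ≡0 (ι≈0⇒≡0 (ℤtoℚ z) (trans (reflexive (≡.sym (ν≡ι z))) e)))
    where
    ℤtoℚ≡0 : ℤtoℚ z ≡ 0ℚ → z ℤ.* + 1 ≡ + 0
    ℤtoℚ≡0 q with ℚᵘP.≃-trans (ℚᵘP.≃-sym (ℚP.toℚᵘ-fromℚᵘ (ℚᵘ.mkℚᵘ z 0))) (ℚᵘP.≃-reflexive (≡.cong ℚ.toℚᵘ q))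
    ... | ℚᵘ.*≡* r = r

  ν≉0 : ∀ {z} → z ≢ + 0 → ¬ ν z ≈ 0#
  ν≉0 {z} nz e = nz (ν≈0⇒≡0 z e)

  ν-suc : ∀ n → ν (+ suc n) ≈ 1# + ν (+ n)
  ν-suc n = trans (ν-+ (+ 1) (+ n)) (+-congʳ ν-1)

  ℤ-*-≢0 : ∀ {a b} → a ≢ + 0 → b ≢ + 0 → a ℤ.* b ≢ + 0
  ℤ-*-≢0 {a} na nb e with ℤP.i*j≡0⇒i≡0∨j≡0 a e
  ... | inj₁ z = na z
  ... | inj₂ z = nb z

  -- Powers and finite sums

  pow-cong : ∀ {x y} n → x ≈ y → pow x n ≈ pow y n
  pow-cong zero e = refl
  pow-cong (suc n) e = *-cong e (pow-cong n e)

  pow-+ : ∀ x m n → pow x (m ℕ.+ n) ≈ pow x m * pow x n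
  pow-+ x zero n = sym (*-identityˡ _)
  pow-+ x (suc m) n = trans (*-congˡ (pow-+ x m n)) (sym (*-assoc _ _ _))

  pow-distrib-* : ∀ x y n → pow (x * y) n ≈ pow x n * pow y n
  pow-distrib-* x y zero = sym (*-identityˡ _)
  pow-distrib-* x y (suc n) = trans (*-congˡ (pow-distrib-* x y n))
    (solve 4 (λ x y a b → x :* y :* (a :* b) := x :* a :* (y :* b)) refl x y _ _)

  pow-1# : ∀ n → pow 1# n ≈ 1#
  pow-1# zero = refl
  pow-1# (suc n) = trans (*-identityˡ _) (pow-1# n)

  pow-* : ∀ x m n → pow x (m ℕ.* n) ≈ pow (pow x n) m
  pow-* x zero n = refl
  pow-* x (suc m) n = trans (pow-+ x n (m ℕ.* n)) (*-congˡ (pow-* x m n))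

  pow-≉0 : ∀ {x} n → ¬ x ≈ 0# → ¬ pow x n ≈ 0#
  pow-≉0 zero nz = 1≉0
  pow-≉0 (suc n) nz = *-≉0 nz (pow-≉0 n nz)

  -- Adding integers of opposite sign computes to `⊖`; this is the mixed case of `zpow-+`, proved by
  -- cancelling one factor `x * inv x nz` at a time.
  zpow-⊖ : ∀ x nz m n → zpow x nz (m ℤ.⊖ n) ≈ pow x m * pow (inv x nz) n
  zpow-⊖ x nz zero zero = sym (*-identityˡ _)
  zpow-⊖ x nz zero (suc n) = sym (*-identityˡ _)
  zpow-⊖ x nz (suc m) zero = sym (*-identityʳ _)
  zpow-⊖ x nz (suc m) (suc n) = trans (reflexive (≡.cong (zpow x nz) (ℤP.[1+m]⊖[1+n]≡m⊖n m n)))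
    (trans (zpow-⊖ x nz m n)
    (trans (trans (sym (*-identityˡ _)) (*-congʳ (sym (inv-r x nz))))
     (solve 4 (λ x i a b → x :* i :* (a :* b) := x :* a :* (i :* b)) refl x _ _ _)))

  zpow-+ : ∀ x nz m n → zpow x nz (m ℤ.+ n) ≈ zpow x nz m * zpow x nz n
  zpow-+ x nz (+ m) (+ n) = pow-+ x m n
  zpow-+ x nz (+ m) -[1+ n ] = zpow-⊖ x nz m (suc n)
  zpow-+ x nz -[1+ m ] (+ n) = trans (zpow-⊖ x nz n (suc m)) (*-comm _ _)
  zpow-+ x nz -[1+ m ] -[1+ n ] = trans (*-congˡ (*-congˡ (pow-+ (inv x nz) m n)))
    (solve 3 (λ i a b → i :* (i :* (a :* b)) := i :* a :* (i :* b)) refl _ _ _)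

  sum-cong : ∀ n {f g : Fin n → Carrier} → (∀ i → f i ≈ g i) → sum n f ≈ sum n g
  sum-cong zero e = refl
  sum-cong (suc n) e = +-cong (e zero) (sum-cong n (λ i → e (suc i)))

  sum-+ : ∀ n (f g : Fin n → Carrier) → sum n (λ i → f i + g i) ≈ sum n f + sum n g
  sum-+ zero f g = sym (+-identityˡ _)
  sum-+ (suc n) f g = trans (+-congˡ (sum-+ n _ _))
    (solve 4 (λ a b c d → a :+ b :+ (c :+ d) := a :+ c :+ (b :+ d)) refl _ _ _ _)

  sum-*ˡ : ∀ n c (f : Fin n → Carrier) → sum n (λ i → c * f i) ≈ c * sum n f
  sum-*ˡ zero c f = sym (zeroʳ c)
  sum-*ˡ (suc n) c f = trans (+-congˡ (sum-*ˡ n c _)) (sym (distribˡ _ _ _))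

  sum-neg : ∀ n (f : Fin n → Carrier) → sum n (λ i → - f i) ≈ - sum n f
  sum-neg n f = trans (sum-cong n (λ i → sym (-1*x≈-x (f i)))) (trans (sum-*ˡ n (- 1#) f) (-1*x≈-x _))

  sum-punchIn : ∀ n (f : Fin (suc n) → Carrier) i → sum (suc n) f ≈ f i + sum n (λ j → f (punchIn i j))
  sum-punchIn n f zero = refl
  sum-punchIn (suc n) f (suc i) = trans (+-congˡ (sum-punchIn n (λ j → f (suc j)) i))
    (solve 3 (λ a b c → a :+ (b :+ c) := b :+ (a :+ c)) refl _ _ _)

  -- Subrings and subfields of K as predicates

  record IsSubring (P : Carrier → Set) : Set where
    field
      resp : ∀ {x y} → x ≈ y → P x → P y
      P1   : P 1#
      P+   : ∀ {x y} → P x → P y → P (x + y)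
      P*   : ∀ {x y} → P x → P y → P (x * y)
      P-   : ∀ {x} → P x → P (- x)

    P0 : P 0#
    P0 = resp (-‿inverseʳ 1#) (P+ P1 (P- P1))

    P-sub : ∀ {x y} → P x → P y → P (x - y)
    P-sub px py = P+ px (P- py)

    P-pow : ∀ {x} n → P x → P (pow x n)
    P-pow zero px = P1
    P-pow (suc n) px = P* px (P-pow n px)

    P-sum : ∀ n {f} → (∀ i → P (f i)) → P (sum n f)
    P-sum zero h = P0
    P-sum (suc n) h = P+ (h zero) (P-sum n (λ i → h (suc i)))

    P-νℕ : ∀ n → P (ν (+ n))
    P-νℕ zero = resp (sym ν-0) P0
    P-νℕ (suc n) = resp (sym (ν-suc n)) (P+ P1 (P-νℕ n))

    P-ν : ∀ z → P (ν z)
    P-ν (+ n) = P-νℕ n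
    P-ν -[1+ n ] = resp (sym (ν-neg (+ suc n))) (P- (P-νℕ (suc n)))

  -- A discrete subfield: `zero∨unit` supplies the case distinction on `x ≈ 0#` that K itself does
  -- not offer, together with an inverse inside `P`.
  record IsSubfield (P : Carrier → Set) : Set where
    field
      isSubring : IsSubring P
      zero∨unit : ∀ {x} → P x → (x ≈ 0#) ⊎ (∃ λ y → P y × x * y ≈ 1#)
    open IsSubring isSubring public

  -- The copy of ℚ in K, described by integer fractions.
  Frac : Carrier → Set
  Frac x = ∃ λ c → ∃ λ z → c ≢ + 0 × ν c * x ≈ ν z

  Frac-* : ∀ {x y c c' z z'} → ν c * x ≈ ν z → ν c' * y ≈ ν z' → ν (c ℤ.* c') * (x * y) ≈ ν (z ℤ.* z')
  Frac-* {x} {y} {c} {c'} {z} {z'} e e' = trans (*-congʳ (ν-* c c'))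
    (trans (solve 4 (λ a b x y → a :* b :* (x :* y) := a :* x :* (b :* y)) refl _ _ _ _)
    (trans (*-cong e e') (sym (ν-* z z'))))

  Frac-+ : ∀ {x y c c' z z'} → ν c * x ≈ ν z → ν c' * y ≈ ν z' → ν (c ℤ.* c') * (x + y) ≈ ν (c' ℤ.* z ℤ.+ c ℤ.* z')
  Frac-+ {x} {y} {c} {c'} {z} {z'} e e' = trans (*-congʳ (ν-* c c'))
    (trans (solve 4 (λ a b x y → a :* b :* (x :+ y) := b :* (a :* x) :+ a :* (b :* y)) refl _ _ _ _)
    (trans (+-cong (*-congˡ e) (*-congˡ e'))
    (trans (+-cong (sym (ν-* c' z)) (sym (ν-* c z'))) (sym (ν-+ _ _)))))

  Frac-neg : ∀ {x c z} → ν c * x ≈ ν z → ν c * (- x) ≈ ν (ℤ.- z)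
  Frac-neg {x} {c} {z} e = trans (sym (-‿distribʳ-* _ _)) (trans (-‿cong e) (sym (ν-neg z)))

  Frac-subfield : IsSubfield Frac
  Frac-subfield = record
    { isSubring = record
      { resp = λ e (c , z , n , h) → c , z , n , trans (*-congˡ (sym e)) h
      ; P1 = + 1 , + 1 , (λ ()) , *-identityʳ _
      ; P+ = λ (c , z , n , h) (c' , z' , n' , h') → _ , _ , ℤ-*-≢0 n n' , Frac-+ h h'
      ; P* = λ (c , z , n , h) (c' , z' , n' , h') → _ , _ , ℤ-*-≢0 n n' , Frac-* h h'
      ; P- = λ (c , z , n , h) → c , ℤ.- z , n , Frac-neg h
      }
    ; zero∨unit = dec
    }
    where
    dec : ∀ {x} → Frac x → (x ≈ 0#) ⊎ (∃ λ y → Frac y × x * y ≈ 1#)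
    dec {x} (c , z , n , h) with z ℤ.≟ + 0
    ... | yes ≡.refl = inj₁ (cancel-≉0 (ν≉0 n) (trans h ν-0))
    ... | no nz = inj₂ (ν c * i , (z , c , nz , trans (solve 3 (λ z c i → z :* (c :* i) := (z :* i) :* c) refl _ _ _) (trans (*-congʳ (inv-r _ _)) (*-identityˡ _)))
                   , trans (solve 3 (λ x c i → x :* (c :* i) := c :* x :* i) refl _ _ _) (trans (*-congʳ h) (inv-r _ _)))
      where i = inv (ν z) (ν≉0 nz)

  Frac-ι : ∀ q → Frac (ι q)
  Frac-ι q = + ℚ.ℚ.denominatorℕ q , ℚ.ℚ.numerator q , (λ ()) , trans (*-congʳ (reflexive (ν≡ι _))) (trans (sym (ι-* _ _)) (trans (ι-≡ (denominator*≡numerator q)) (reflexive (≡.sym (ν≡ι _)))))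

  -- Linear dependency

  -- The `Q`-span of a list. The coefficients are kept as data, and one element may have several
  -- representations.
  Lin : (Carrier → Set) → List Carrier → Carrier → Set
  Lin Q []      x = x ≈ 0#
  Lin Q (g ∷ G) x = ∃ λ k → ∃ λ y → Q k × Lin Q G y × x ≈ k * g + y

  Lin-resp : ∀ {Q} G {x y} → x ≈ y → Lin Q G x → Lin Q G y
  Lin-resp []      e h = trans (sym e) h
  Lin-resp (g ∷ G) e (k , y , q , l , h) = k , y , q , l , trans (sym e) h

  Lin-weaken : ∀ {Q Q′ : Carrier → Set} → (∀ {x} → Q x → Q′ x) → ∀ G {x} → Lin Q G x → Lin Q′ G x
  Lin-weaken w []      h = h
  Lin-weaken w (g ∷ G) (k , y , q , l , h) = k , y , w q , Lin-weaken w G l , h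

  Lin-of-zeros : ∀ {Q G x} → All (_≈ 0#) G → Lin Q G x → x ≈ 0#
  Lin-of-zeros []       h = h
  Lin-of-zeros (z ∷ zs) (k , y , _ , l , h) =
    trans h (trans (+-cong (trans (*-congˡ z) (zeroʳ k)) (Lin-of-zeros zs l)) (+-identityʳ 0#))

  module _ {Q : Carrier → Set} (Q-subring : IsSubring Q) where
    open IsSubring Q-subring

    Lin-+ : ∀ G {x y} → Lin Q G x → Lin Q G y → Lin Q G (x + y)
    Lin-+ []      h h′ = trans (+-cong h h′) (+-identityˡ 0#)
    Lin-+ (g ∷ G) (k , y , q , l , h) (k′ , y′ , q′ , l′ , h′) = k + k′ , y + y′ , P+ q q′ , Lin-+ G l l′ ,
      trans (+-cong h h′) (solve 5 (λ g k k′ y y′ → k :* g :+ y :+ (k′ :* g :+ y′) := (k :+ k′) :* g :+ (y :+ y′)) refl g k k′ y y′)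

    Lin-* : ∀ G {c x} → Q c → Lin Q G x → Lin Q G (c * x)
    Lin-* []      qc h = trans (*-congˡ h) (zeroʳ _)
    Lin-* (g ∷ G) {c} qc (k , y , q , l , h) = c * k , c * y , P* qc q , Lin-* G qc l ,
      trans (*-congˡ h) (solve 4 (λ c k g y → c :* (k :* g :+ y) := c :* k :* g :+ c :* y) refl c k g y)

    Lin-++ : ∀ G H {x y} → Lin Q G x → Lin Q H y → Lin Q (G ++ H) (x + y)
    Lin-++ []      H h l = Lin-resp H (sym (trans (+-congʳ h) (+-identityˡ _))) l
    Lin-++ (g ∷ G) H (k , y , q , l , h) l′ = k , _ , q , Lin-++ G H l l′ , trans (+-congʳ h) (+-assoc _ _ _)

    Lin-map : ∀ t G {x} → Lin Q G x → Lin Q (L.map (t *_) G) (t * x)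
    Lin-map t []      h = trans (*-congˡ h) (zeroʳ t)
    Lin-map t (g ∷ G) (k , y , q , l , h) = k , t * y , q , Lin-map t G l ,
      trans (*-congˡ h) (solve 4 (λ t k g y → t :* (k :* g :+ y) := k :* (t :* g) :+ t :* y) refl t k g y)

  module _ {Q : Carrier → Set} (Q-subfield : IsSubfield Q) where
    open IsSubfield Q-subfield

    -- The search for a pivot in the elimination below.
    all≈0∨unit : ∀ n (k : Fin n → Carrier) → (∀ i → Q (k i)) →
                 (∀ i → k i ≈ 0#) ⊎ (∃ λ i → ∃ λ y → Q y × k i * y ≈ 1#)
    all≈0∨unit zero    k q = inj₁ (λ ())
    all≈0∨unit (suc n) k q with zero∨unit (q zero) | all≈0∨unit n (λ i → k (suc i)) (λ i → q (suc i))
    ... | inj₂ u | _ = inj₂ (zero , u)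
    ... | inj₁ z | inj₁ h = inj₁ λ { zero → z ; (suc i) → h i }
    ... | inj₁ z | inj₂ (i , u) = inj₂ (suc i , u)

    private
      pivot-identity : ∀ a g y b d u → (a * g + y) + - (a * u) * (b * g + d) ≈ (y + - (a * u) * d) + a * g * (1# - b * u)
      pivot-identity = solve 6 (λ a g y b d u → (a :* g :+ y) :+ (:- (a :* u)) :* (b :* g :+ d) :=
                                  (y :+ (:- (a :* u)) :* d) :+ a :* g :* (con (+ 1) :- b :* u)) refl

      regroup : ∀ a n c b → a * (n * c) + n * b ≈ n * (b + c * a)
      regroup = solve 4 (λ a n c b → a :* (n :* c) :+ n :* b := n :* (b :+ c :* a)) refl

      -- Row operation: `u` is the inverse of the pivot `b`, so subtracting a u times the pivot row
      -- removes the generator `g`.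
      eliminate : ∀ {a g y x b d w u} → x ≈ a * g + y → w ≈ b * g + d → b * u ≈ 1# →
                  y + - (a * u) * d ≈ x + - (a * u) * w
      eliminate {a} {g} {y} {x} {b} {d} {w} {u} ex ew e = sym (begin
        x + - (a * u) * w                                   ≈⟨ +-cong ex (*-congˡ ew) ⟩
        (a * g + y) + - (a * u) * (b * g + d)               ≈⟨ pivot-identity a g y b d u ⟩
        (y + - (a * u) * d) + a * g * (1# - b * u)          ≈⟨ +-congˡ (trans (*-congˡ (x≈y⇒x-y≈0 (sym e))) (zeroʳ _)) ⟩
        (y + - (a * u) * d) + 0#                            ≈⟨ +-identityʳ _ ⟩
        y + - (a * u) * d                                   ∎)

      -- Undoes the row operations: the pivot vector gets the coefficient Σ n_j c_j, and the other
      -- coefficients, among them a nonzero one, stay as they are.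
      extend-relation : ∀ N (v : Fin (suc N) → Carrier) i (n c : Fin N → Carrier) → (∀ j → Q (n j)) → (∀ j → Q (c j)) →
        (∃ λ j → ¬ n j ≈ 0#) → sum N (λ j → n j * (v (punchIn i j) + c j * v i)) ≈ 0# →
        ∃ λ (n : Fin (suc N) → Carrier) → (∀ j → Q (n j)) × (∃ λ j → ¬ n j ≈ 0#) × sum (suc N) (λ j → n j * v j) ≈ 0#
      extend-relation N v i n c qn qc (j , nz) e = n′ , qn′ , (punchIn i j , ≉0-resp (sym (n′-punchIn j)) nz) , e′
        where
        s : Carrier
        s = sum N (λ j → n j * c j)
        n′ : Fin (suc N) → Carrier
        n′ = VF.insertAt n i s
        n′-i : n′ i ≈ s
        n′-i = reflexive (VFP.insertAt-lookup n i s)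
        n′-punchIn : ∀ j → n′ (punchIn i j) ≈ n j
        n′-punchIn j = reflexive (VFP.insertAt-punchIn n i s j)
        qn′ : ∀ j → Q (n′ j)
        qn′ j with i F.≟ j
        ... | yes ≡.refl = resp (sym n′-i) (P-sum N (λ j → P* (qn j) (qc j)))
        ... | no ne = ≡.subst (λ t → Q (n′ t)) (FP.punchIn-punchOut ne) (resp (sym (n′-punchIn _)) (qn _))
        e′ : sum (suc N) (λ j → n′ j * v j) ≈ 0#
        e′ = begin
          sum (suc N) (λ j → n′ j * v j)
            ≈⟨ sum-punchIn N (λ j → n′ j * v j) i ⟩
          n′ i * v i + sum N (λ j → n′ (punchIn i j) * v (punchIn i j))
            ≈⟨ +-cong (*-congʳ n′-i) (sum-cong N (λ j → *-congʳ (n′-punchIn j))) ⟩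
          s * v i + sum N (λ j → n j * v (punchIn i j))
            ≈⟨ +-congʳ (trans (*-comm _ _) (sym (sum-*ˡ N (v i) _))) ⟩
          sum N (λ j → v i * (n j * c j)) + sum N (λ j → n j * v (punchIn i j))
            ≈⟨ sum-+ N _ _ ⟨
          sum N (λ j → v i * (n j * c j) + n j * v (punchIn i j))
            ≈⟨ sum-cong N (λ j → regroup (v i) (n j) (c j) (v (punchIn i j))) ⟩
          sum N (λ j → n j * (v (punchIn i j) + c j * v i))
            ≈⟨ e ⟩
          0# ∎

    -- Gaussian elimination. If no vector involves `g`, one vector is dropped; otherwise a vector
    -- with invertible `g`-coefficient clears the others. Either way one generator and one vector
    -- disappear.
    linear-dependency : ∀ G (v : Fin (suc (length G)) → Carrier) → (∀ j → Lin Q G (v j)) →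
      ∃ λ (n : Fin (suc (length G)) → Carrier) →
        (∀ j → Q (n j)) × (∃ λ j → ¬ n j ≈ 0#) × sum (suc (length G)) (λ j → n j * v j) ≈ 0#
    linear-dependency [] v l = (λ _ → 1#) , (λ _ → P1) , (zero , 1≉0) ,
      trans (+-identityʳ _) (trans (*-identityˡ _) (l zero))
    linear-dependency (g ∷ G) v l = go (all≈0∨unit N k qk)
      where
      N : ℕ
      N = suc (suc (length G))
      k y : Fin N → Carrier
      k j = proj₁ (l j)
      y j = proj₁ (proj₂ (l j))
      qk : ∀ j → Q (k j)
      qk j = proj₁ (proj₂ (proj₂ (l j)))
      ly : ∀ j → Lin Q G (y j)
      ly j = proj₁ (proj₂ (proj₂ (proj₂ (l j))))
      v≈ : ∀ j → v j ≈ k j * g + y j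
      v≈ j = proj₂ (proj₂ (proj₂ (proj₂ (l j))))
      Goal : Set
      Goal = ∃ λ (n : Fin N → Carrier) → (∀ j → Q (n j)) × (∃ λ j → ¬ n j ≈ 0#) × sum N (λ j → n j * v j) ≈ 0#
      go : (∀ i → k i ≈ 0#) ⊎ (∃ λ i → ∃ λ u → Q u × k i * u ≈ 1#) → Goal
      go (inj₁ z) =
        let (n , qn , (j , nz) , e) = linear-dependency G (λ j → v (suc j)) (λ j →
              Lin-resp G (sym (trans (v≈ (suc j)) (trans (+-congʳ (trans (*-congʳ (z (suc j))) (zeroˡ g))) (+-identityˡ _)))) (ly (suc j)))
        in VF._∷_ 0# n , (λ { zero → P0 ; (suc i) → qn i }) , (suc j , nz) , trans (+-cong (zeroˡ _) e) (+-identityˡ _)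
      go (inj₂ (i , u , qu , e)) =
        let c j = - (k (punchIn i j) * u)
            qc j = P- (P* (qk (punchIn i j)) qu)
            (n , qn , nz , e′) = linear-dependency G (λ j → v (punchIn i j) + c j * v i) (λ j →
              Lin-resp G (eliminate (v≈ (punchIn i j)) (v≈ i) e) (Lin-+ isSubring G (ly _) (Lin-* isSubring G (qc j) (ly i))))
        in extend-relation (suc (length G)) v i n c qn qc nz e′

  -- A polynomial relation for y can be divided by its lowest nonzero term.
  inverse-of-algebraic : ∀ {Q P : Carrier → Set} → IsSubfield Q → IsSubring P → (∀ {x} → Q x → P x) →
    ∀ n (c : Fin n → Carrier) → (∀ j → Q (c j)) → (∃ λ j → ¬ c j ≈ 0#) →
    ∀ {y} → P y → ¬ y ≈ 0# → sum n (λ j → c j * pow y (toℕ j)) ≈ 0# → ∃ λ z → P z × y * z ≈ 1#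
  inverse-of-algebraic Qf Ps Q⊂P zero c qc (() , _) py nz e
  inverse-of-algebraic {Q} {P} Qf Ps Q⊂P (suc n) c qc (j , nzj) {y} py nz e = go (zero∨unit (qc zero))
    where
    open IsSubfield Qf using (zero∨unit)
    open IsSubring Ps
    s = sum n (λ j → c (suc j) * pow y (toℕ j))
    e′ : c zero + y * s ≈ 0#
    e′ = trans (+-cong (sym (*-identityʳ _)) (trans (sym (sum-*ˡ n y _)) (sum-cong n (λ j →
           solve 3 (λ y c p → y :* (c :* p) := c :* (y :* p)) refl y (c (suc j)) (pow y (toℕ j)))))) e
    nonzero-tail : c zero ≈ 0# → ∀ j → ¬ c j ≈ 0# → ∃ λ j → ¬ c (suc j) ≈ 0#
    nonzero-tail z zero    nz = ⊥-elim (nz z)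
    nonzero-tail z (suc j) nz = j , nz
    go : (c zero ≈ 0#) ⊎ (∃ λ u → Q u × c zero * u ≈ 1#) → ∃ λ z → P z × y * z ≈ 1#
    go (inj₁ z) = inverse-of-algebraic Qf Ps Q⊂P n (λ j → c (suc j)) (λ j → qc (suc j)) (nonzero-tail z j nzj) py nz
      (cancel-≉0 nz (trans (sym (+-identityˡ _)) (trans (+-congʳ (sym z)) e′)))
    go (inj₂ (u , qu , h)) = - (u * s) , P- (P* (Q⊂P qu) (P-sum n (λ j → P* (Q⊂P (qc (suc j))) (P-pow (toℕ j) py)))) ,
      (begin
        y * - (u * s)                    ≈⟨ solve 4 (λ y u s c → y :* (:- (u :* s)) := c :* u :- u :* (c :+ y :* s)) refl y u s (c zero) ⟩
        c zero * u - u * (c zero + y * s) ≈⟨ +-cong h (-‿cong (trans (*-congˡ e′) (zeroʳ u))) ⟩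
        1# - 0#                          ≈⟨ solve 0 (con (+ 1) :- con (+ 0) := con (+ 1)) refl ⟩
        1#                               ∎)

  -- Polynomials as coefficient lists

  eval-cong : ∀ cs {x y} → x ≈ y → eval cs x ≈ eval cs y
  eval-cong []       e = refl
  eval-cong (c ∷ cs) e = +-congˡ (*-cong e (eval-cong cs e))

  -- The monic polynomial with list cs of lower coefficients, and its homogenisation.
  meval : List Carrier → Carrier → Carrier
  meval cs t = L.foldr (λ c acc → c + t * acc) 1# cs

  hmeval : List Carrier → Carrier → Carrier → Carrier
  hmeval []       A B = 1#
  hmeval (c ∷ cs) A B = c * pow B (suc (length cs)) + A * hmeval cs A B

  hmeval-1 : ∀ cs t → hmeval cs t 1# ≈ meval cs t
  hmeval-1 []       t = refl
  hmeval-1 (c ∷ cs) t = +-cong (trans (*-congˡ (pow-1# (suc (length cs)))) (*-identityʳ c)) (*-congˡ (hmeval-1 cs t))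

  meval-as-eval : ∀ cs t → eval (cs ++ 1# ∷ []) t ≈ meval cs t
  meval-as-eval []       t = trans (+-congˡ (zeroʳ t)) (+-identityʳ 1#)
  meval-as-eval (c ∷ cs) t = +-congˡ (*-congˡ (meval-as-eval cs t))

  meval-tabulate : ∀ n (f : Fin n → Carrier) t → meval (L.tabulate f) t ≈ pow t n + sum n (λ i → f i * pow t (toℕ i))
  meval-tabulate zero    f t = sym (+-identityʳ 1#)
  meval-tabulate (suc n) f t = begin
    f zero + t * meval (L.tabulate (λ i → f (suc i))) t         ≈⟨ +-congˡ (*-congˡ (meval-tabulate n (λ i → f (suc i)) t)) ⟩
    f zero + t * (pow t n + s)                                  ≈⟨ rearrange (f zero) t (pow t n) s ⟩
    t * pow t n + (f zero * 1# + t * s)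
      ≈⟨ +-congˡ (+-congˡ (trans (sym (sum-*ˡ n t _)) (sum-cong n (λ i → swap t (f (suc i)) (pow t (toℕ i)))))) ⟩
    t * pow t n + (f zero * 1# + sum n (λ i → f (suc i) * (t * pow t (toℕ i)))) ∎
    where
    s = sum n (λ i → f (suc i) * pow t (toℕ i))
    rearrange : ∀ c t p s → c + t * (p + s) ≈ t * p + (c * 1# + t * s)
    rearrange = solve 4 (λ c t p s → c :+ t :* (p :+ s) := t :* p :+ (c :* con (+ 1) :+ t :* s)) refl
    swap : ∀ t f p → t * (f * p) ≈ f * (t * p)
    swap = solve 3 (λ t f p → t :* (f :* p) := f :* (t :* p)) refl

  meval-has-root : ∀ c cs → ∃ λ x → meval (c ∷ cs) x ≈ 0#
  meval-has-root c cs =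
    let (x , h) = algClosed (length cs) (L.lookup (c ∷ cs))
    in x , trans (reflexive (≡.cong (λ ds → meval ds x) (≡.sym (LP.tabulate-lookup (c ∷ cs)))))
             (trans (meval-tabulate (suc (length cs)) (L.lookup (c ∷ cs)) x) h)

  -- Synthetic division by t - x: the coefficients of the quotient are the values at x of the tails
  -- of the polynomial. The leading 1 remains implicit.
  quotient : Carrier → List Carrier → List Carrier
  quotient x []            = []
  quotient x (c ∷ [])      = []
  quotient x (c ∷ c′ ∷ cs) = meval (c′ ∷ cs) x ∷ quotient x (c′ ∷ cs)

  length-quotient : ∀ x c cs → length (quotient x (c ∷ cs)) ≡ length cs
  length-quotient x c []        = ≡.refl
  length-quotient x c (c′ ∷ cs) = ≡.cong suc (length-quotient x c′ cs)

  private
    quotient-step : ∀ A B x c m h q p → h ≈ (A - x * B) * q + m * p →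
                    c * (B * p) + A * h ≈ (A - x * B) * (m * p + A * q) + (c + x * m) * (B * p)
    quotient-step A B x c m h q p e = trans (+-congˡ (*-congˡ e)) (identity A B x c m q p)
      where
      identity : ∀ A B x c m q p → c * (B * p) + A * ((A - x * B) * q + m * p) ≈
                 (A - x * B) * (m * p + A * q) + (c + x * m) * (B * p)
      identity = solve 7 (λ A B x c m q p → c :* (B :* p) :+ A :* ((A :- x :* B) :* q :+ m :* p) :=
                 (A :- x :* B) :* (m :* p :+ A :* q) :+ (c :+ x :* m) :* (B :* p)) refl

  hmeval-quotient : ∀ x c cs A B → hmeval (c ∷ cs) A B ≈
    (A - x * B) * hmeval (quotient x (c ∷ cs)) A B + meval (c ∷ cs) x * pow B (suc (length cs))
  hmeval-quotient x c [] A B = base c A B x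
    where
    base : ∀ c A B x → c * (B * 1#) + A * 1# ≈ (A - x * B) * 1# + (c + x * 1#) * (B * 1#)
    base = solve 4 (λ c A B x → c :* (B :* con (+ 1)) :+ A :* con (+ 1) :=
             (A :- x :* B) :* con (+ 1) :+ (c :+ x :* con (+ 1)) :* (B :* con (+ 1))) refl
  hmeval-quotient x c (c′ ∷ cs) A B =
    trans (quotient-step A B x c (meval (c′ ∷ cs) x) _ (hmeval (quotient x (c′ ∷ cs)) A B) (pow B (suc (length cs))) (hmeval-quotient x c′ cs A B))
          (+-congʳ (*-congˡ (+-congʳ (*-congˡ (reflexive (≡.cong (λ n → pow B (suc n)) (≡.sym (length-quotient x c′ cs))))))))

  ∏ : List Carrier → (Carrier → Carrier) → Carrier
  ∏ []       φ = 1#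
  ∏ (r ∷ rs) φ = φ r * ∏ rs φ

  hmeval-root : ∀ x c cs → meval (c ∷ cs) x ≈ 0# → ∀ A B →
                hmeval (c ∷ cs) A B ≈ (A - x * B) * hmeval (quotient x (c ∷ cs)) A B
  hmeval-root x c cs e A B = trans (hmeval-quotient x c cs A B) (trans (+-congˡ (trans (*-congʳ e) (zeroˡ _))) (+-identityʳ _))

  root-of-quotient : ∀ x c cs {r} → meval (c ∷ cs) x ≈ 0# → meval (quotient x (c ∷ cs)) r ≈ 0# → meval (c ∷ cs) r ≈ 0#
  root-of-quotient x c cs {r} root z = trans (sym (hmeval-1 (c ∷ cs) r)) (trans (hmeval-root x c cs root r 1#)
    (trans (*-congˡ (trans (hmeval-1 (quotient x (c ∷ cs)) r) z)) (zeroʳ _)))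

  -- Homogeneous in `A` and `B`, because later `B` is a term of the exponential sum and need not be
  -- invertible.
  Splits : List Carrier → List Carrier → Set
  Splits cs rs = All (λ r → meval cs r ≈ 0#) rs × (∀ A B → hmeval cs A B ≈ ∏ rs (λ r → A - r * B))

  Splits-∷ : ∀ x c cs {rs} → meval (c ∷ cs) x ≈ 0# → Splits (quotient x (c ∷ cs)) rs → Splits (c ∷ cs) (x ∷ rs)
  Splits-∷ x c cs root (roots , splits) = root ∷ All.map (root-of-quotient x c cs root) roots ,
    λ A B → trans (hmeval-root x c cs root A B) (*-congˡ (splits A B))

  split-monic : ∀ cs → ∃ λ rs → Splits cs rs
  split-monic cs = go (length cs) cs ≡.refl
    where
    -- The recursion runs on the degree, since `quotient` does not return a sublist.
    go : ∀ n cs → length cs ≡ n → ∃ λ rs → Splits cs rs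
    go zero    []       _ = [] , [] , λ A B → refl
    go (suc n) (c ∷ cs) e =
      let (x , h) = meval-has-root c cs
          (rs , s) = go n (quotient x (c ∷ cs)) (≡.trans (length-quotient x c cs) (ℕP.suc-injective e))
      in x ∷ rs , Splits-∷ x c cs h s

  -- Polynomial arithmetic with coefficients in a subring

  module _ {P : Carrier → Set} (P-subring : IsSubring P) where
    open IsSubring P-subring

    P-eval : ∀ {cs x} → All P cs → P x → P (eval cs x)
    P-eval []       px = P0
    P-eval (c ∷ cs) px = P+ c (P* px (P-eval cs px))

    add-coefficients : ∀ {cs ds} → All P cs → All P ds → ∃ λ es → All P es × (∀ t → eval es t ≈ eval cs t + eval ds t)
    add-coefficients {ds = ds} [] pd = ds , pd , λ t → sym (+-identityˡ _)
    add-coefficients {cs} pc@(_ ∷ _) [] = cs , pc , λ t → sym (+-identityʳ _)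
    add-coefficients {c ∷ cs} {d ∷ ds} (pc ∷ pcs) (pd ∷ pds) =
      let (es , pes , h) = add-coefficients pcs pds in
      c + d ∷ es , P+ pc pd ∷ pes , λ t → trans (+-congˡ (*-congˡ (h t))) (rearrange c d t (eval cs t) (eval ds t))
      where
      rearrange : ∀ c d t x y → c + d + t * (x + y) ≈ c + t * x + (d + t * y)
      rearrange = solve 5 (λ c d t x y → c :+ d :+ t :* (x :+ y) := c :+ t :* x :+ (d :+ t :* y)) refl

    scale-coefficients : ∀ {a cs} → P a → All P cs → ∃ λ es → All P es × (∀ t → eval es t ≈ a * eval cs t)
    scale-coefficients {a} pa [] = [] , [] , λ t → sym (zeroʳ a)
    scale-coefficients {a} {c ∷ cs} pa (pc ∷ pcs) =
      let (es , pes , h) = scale-coefficients pa pcs in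
      a * c ∷ es , P* pa pc ∷ pes , λ t → trans (+-congˡ (*-congˡ (h t))) (rearrange a c t (eval cs t))
      where
      rearrange : ∀ a c t x → a * c + t * (a * x) ≈ a * (c + t * x)
      rearrange = solve 4 (λ a c t x → a :* c :+ t :* (a :* x) := a :* (c :+ t :* x)) refl

    multiply-coefficients : ∀ {cs ds} → All P cs → All P ds → ∃ λ es → All P es × (∀ t → eval es t ≈ eval cs t * eval ds t)
    multiply-coefficients [] pd = [] , [] , λ t → sym (zeroˡ _)
    multiply-coefficients {c ∷ cs} {ds} (pc ∷ pcs) pd =
      let (es , pes , h)  = multiply-coefficients pcs pd
          (fs , pfs , h′) = scale-coefficients pc pd
          (gs , pgs , h″) = add-coefficients pfs (P0 ∷ pes)
      in gs , pgs , λ t → trans (h″ t) (trans (+-cong (h′ t) (+-congˡ (*-congˡ (h t)))) (rearrange c t (eval cs t) (eval ds t)))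
      where
      rearrange : ∀ c t x y → c * y + (0# + t * (x * y)) ≈ (c + t * x) * y
      rearrange = solve 4 (λ c t x y → c :* y :+ (con (+ 0) :+ t :* (x :* y)) := (c :+ t :* x) :* y) refl

    -- `vs` has degree at most that of the monic divisor, so the quotient is a constant: the top
    -- coefficient of `vs`.
    reduce : ∀ ms vs → All P ms → All P vs → length vs ≡ suc (length ms) →
      ∃ λ e → ∃ λ rs → P e × All P rs × length rs ≡ length ms × (∀ t → eval vs t ≈ e * meval ms t + eval rs t)
    reduce []       (v ∷ []) _ (pv ∷ _) _ = v , [] , pv , [] , ≡.refl , base v
      where
      base : ∀ v t → v + t * 0# ≈ v * 1# + 0#
      base = solve 2 (λ v t → v :+ t :* con (+ 0) := v :* con (+ 1) :+ con (+ 0)) refl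
    reduce (m ∷ ms) (v ∷ vs) (pm ∷ pms) (pv ∷ pvs) l =
      let (e , rs , pe , prs , lr , h) = reduce ms vs pms pvs (ℕP.suc-injective l) in
      e , v - e * m ∷ rs , pe , P-sub pv (P* pe pm) ∷ prs , ≡.cong suc lr ,
      λ t → trans (+-congˡ (*-congˡ (h t))) (rearrange v t e m (meval ms t) (eval rs t))
      where
      rearrange : ∀ v t e m x r → v + t * (e * x + r) ≈ e * (m + t * x) + (v - e * m + t * r)
      rearrange = solve 6 (λ v t e m x r → v :+ t :* (e :* x :+ r) := e :* (m :+ t :* x) :+ (v :- e :* m :+ t :* r)) refl

    -- In Horner form a further coefficient g turns the remainder r into g + t r, which one call of
    -- `reduce` handles. The remainder is padded to exactly `length ms` coefficients.
    divide : ∀ {ms} gs → All P ms → All P gs →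
      ∃ λ qs → ∃ λ rs → All P qs × All P rs × length rs ≡ length ms × (∀ t → eval gs t ≈ meval ms t * eval qs t + eval rs t)
    divide {ms} [] pms [] = [] , L.map (λ _ → 0#) ms , [] , AllP.map⁺ (All.map (λ _ → P0) pms) , LP.length-map _ ms ,
      λ t → sym (trans (+-cong (zeroʳ _) (eval-0 ms t)) (+-identityʳ 0#))
      where
      eval-0 : ∀ ms t → eval (L.map (λ _ → 0#) ms) t ≈ 0#
      eval-0 []       t = refl
      eval-0 (m ∷ ms) t = trans (+-identityˡ _) (trans (*-congˡ (eval-0 ms t)) (zeroʳ t))
    divide {ms} (g ∷ gs) pms (pg ∷ pgs) =
      let (qs , rs , pqs , prs , lr , h) = divide gs pms pgs
          (e , rs′ , pe , prs′ , lr′ , h′) = reduce ms (g ∷ rs) pms (pg ∷ prs) (≡.cong suc lr)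
      in e ∷ qs , rs′ , pe ∷ pqs , prs′ , lr′ ,
         λ t → trans (+-congˡ (*-congˡ (h t))) (trans (rearrange₁ g t (meval ms t) (eval qs t) (eval rs t))
               (trans (+-congˡ (h′ t)) (rearrange₂ e t (meval ms t) (eval qs t) (eval rs′ t))))
      where
      rearrange₁ : ∀ g t m q r → g + t * (m * q + r) ≈ m * (t * q) + (g + t * r)
      rearrange₁ = solve 5 (λ g t m q r → g :+ t :* (m :* q :+ r) := m :* (t :* q) :+ (g :+ t :* r)) refl
      rearrange₂ : ∀ e t m q r → m * (t * q) + (e * m + r) ≈ m * (e + t * q) + r
      rearrange₂ = solve 5 (λ e t m q r → m :* (t :* q) :+ (e :* m :+ r) := m :* (e :+ t :* q) :+ r) refl

  -- Euclid's algorithm over a discrete subfield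

  module _ {Q : Carrier → Set} (Q-subfield : IsSubfield Q) where
    open IsSubfield Q-subfield

    -- Strips the vanishing leading coefficients, which is possible because zero is decidable in
    -- `Q`. The strict length bound makes `gcd` terminate.
    make-monic : ∀ {bs} → All Q bs → (∀ t → eval bs t ≈ 0#) ⊎
      (∃ λ a → ∃ λ a′ → ∃ λ ms → a * a′ ≈ 1# × Q a′ × All Q ms × length ms ℕ.< length bs × (∀ t → eval bs t ≈ a * meval ms t))
    make-monic [] = inj₁ λ t → refl
    make-monic {b ∷ bs} (qb ∷ qbs) with make-monic qbs
    ... | inj₂ (a , a′ , ms , e , qa′ , qms , l , h) = inj₂ (a , a′ , b * a′ ∷ ms , e , qa′ , P* qb qa′ ∷ qms , ℕ.s≤s l ,
            λ t → trans (+-congˡ (*-congˡ (h t))) (trans (+-congʳ (trans (sym (*-identityʳ b)) (*-congˡ (sym e)))) (rearrange b a a′ t (meval ms t))))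
      where
      rearrange : ∀ b a a′ t m → b * (a * a′) + t * (a * m) ≈ a * (b * a′ + t * m)
      rearrange = solve 5 (λ b a a′ t m → b :* (a :* a′) :+ t :* (a :* m) := a :* (b :* a′ :+ t :* m)) refl
    ... | inj₁ z with zero∨unit qb
    ...   | inj₁ z′ = inj₁ λ t → trans (+-cong z′ (trans (*-congˡ (z t)) (zeroʳ t))) (+-identityʳ 0#)
    ...   | inj₂ (b′ , qb′ , e) = inj₂ (b , b′ , [] , e , qb′ , [] , ℕ.s≤s ℕ.z≤n ,
            λ t → trans (+-congˡ (trans (*-congˡ (z t)) (zeroʳ t))) (trans (+-identityʳ b) (sym (*-identityʳ b))))

    -- Divisibility is stated for values, and the Bézout identity only at `θ`: this suffices to
    -- carry roots from `ds` to `gs` and zeros between `ds` and `bs` at `θ`.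
    record GCD (gs bs : List Carrier) (θ : Carrier) : Set where
      field
        ds      : List Carrier
        ds∈Q    : All Q ds
        divides-g : ∀ t → ∃ λ h → meval gs t ≈ meval ds t * h
        divides-b : ∀ t → ∃ λ h → eval bs t ≈ meval ds t * h
        bezout    : ∃ λ u → ∃ λ v → meval ds θ ≈ u * eval bs θ + v * meval gs θ

    gcd : ∀ n {gs bs} → length bs ℕ.≤ n → All Q gs → All Q bs → ∀ θ → GCD gs bs θ
    gcd n {gs} {bs} l qgs qbs θ with make-monic qbs
    ... | inj₁ z = record
      { ds = gs ; ds∈Q = qgs
      ; divides-g = λ t → 1# , sym (*-identityʳ _)
      ; divides-b = λ t → 0# , trans (z t) (sym (zeroʳ _))
      ; bezout = 0# , 1# , sym (trans (+-cong (zeroˡ _) (*-identityˡ _)) (+-identityˡ _)) }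
    gcd zero    {gs} {[]} l qgs qbs θ | inj₂ (a , a′ , ms , e , qa′ , qms , () , h)
    gcd (suc n) {gs} {bs} l qgs qbs θ | inj₂ (a , a′ , ms , e , qa′ , qms , l′ , h) =
      let (qs , rs , qqs , qrs , lr , d) = divide isSubring (gs ++ 1# ∷ []) qms (AllP.++⁺ qgs (P1 ∷ []))
          g≈ : ∀ t → meval gs t ≈ meval ms t * eval qs t + eval rs t
          g≈ t = trans (sym (meval-as-eval gs t)) (d t)
          ih = gcd n {ms} {rs} (ℕP.≤-pred (ℕP.≤-trans (ℕP.≤-trans (ℕ.s≤s (ℕP.≤-reflexive lr)) l′) l)) qms qrs θ
          open GCD ih
          (u , v , bz) = bezout
      in record
        { ds = ds ; ds∈Q = ds∈Q
        ; divides-g = λ t → let (h₁ , e₁) = divides-g t ; (h₂ , e₂) = divides-b t in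
            h₁ * eval qs t + h₂ , trans (g≈ t) (trans (+-cong (*-congʳ e₁) e₂) (combine (meval ds t) h₁ (eval qs t) h₂))
        ; divides-b = λ t → let (h₁ , e₁) = divides-g t in
            a * h₁ , trans (h t) (trans (*-congˡ e₁) (swap a (meval ds t) h₁))
        -- Obtained from u r + v m by substituting r = g - m q and m = a′ b.
        ; bezout = (v - u * eval qs θ) * a′ , u ,
            trans bz (sym (trans (+-cong (*-congˡ (h θ)) (*-congˡ (g≈ θ)))
              (trans (back v u (eval qs θ) a′ a (meval ms θ) (eval rs θ)) (cancel e)))) }
      where
      combine : ∀ d h q k → d * h * q + d * k ≈ d * (h * q + k)
      combine = solve 4 (λ d h q k → d :* h :* q :+ d :* k := d :* (h :* q :+ k)) refl
      swap : ∀ a d h → a * (d * h) ≈ d * (a * h)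
      swap = solve 3 (λ a d h → a :* (d :* h) := d :* (a :* h)) refl
      back : ∀ v u q a′ a m r → (v - u * q) * a′ * (a * m) + u * (m * q + r) ≈ u * r + v * m + (a * a′ - 1#) * ((v - u * q) * m)
      back = solve 7 (λ v u q a′ a m r → (v :- u :* q) :* a′ :* (a :* m) :+ u :* (m :* q :+ r) :=
                u :* r :+ v :* m :+ (a :* a′ :- con (+ 1)) :* ((v :- u :* q) :* m)) refl
      cancel : ∀ {x a y} → a ≈ 1# → x + (a - 1#) * y ≈ x
      cancel e = trans (+-congˡ (trans (*-congʳ (x≈y⇒x-y≈0 e)) (zeroˡ _))) (+-identityʳ _)

    -- A common divisor of gs and bs splits over K into factors t - δ with δ a root of gs, so its
    -- value at θ is decidably zero as soon as θ ≈ δ is decidable for these δ.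
    decide-value : ∀ {gs θ} → All Q gs → meval gs θ ≈ 0# → (∀ δ → meval gs δ ≈ 0# → Dec (θ ≈ δ)) →
                   ∀ {bs} → All Q bs → (eval bs θ ≈ 0#) ⊎ (¬ eval bs θ ≈ 0#)
    decide-value {gs} {θ} qgs gθ dec {bs} qbs =
      conclude (decide-∏ (All.map root rs-roots))
      where
      open GCD (gcd (length bs) ℕP.≤-refl qgs qbs θ)
      rs = proj₁ (split-monic ds)
      rs-roots = proj₁ (proj₂ (split-monic ds))
      root : ∀ {r} → meval ds r ≈ 0# → meval gs r ≈ 0#
      root {r} z = let (h , e) = divides-g r in trans e (trans (*-congʳ z) (zeroˡ h))
      decide-∏ : ∀ {rs} → All (λ r → meval gs r ≈ 0#) rs → (∏ rs (λ r → θ - r * 1#) ≈ 0#) ⊎ (¬ ∏ rs (λ r → θ - r * 1#) ≈ 0#)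
      decide-∏ [] = inj₂ 1≉0
      decide-∏ {r ∷ _} (z ∷ zs) with dec _ z | decide-∏ zs
      ... | yes e | _ = inj₁ (trans (*-congʳ (x≈y⇒x-y≈0 (trans e (sym (*-identityʳ r))))) (zeroˡ _))
      ... | no ne | inj₁ e = inj₁ (trans (*-congˡ e) (zeroʳ _))
      ... | no ne | inj₂ ne′ = inj₂ (*-≉0 (λ e → ne (trans (x-y≈0⇒x≈y e) (*-identityʳ r))) ne′)
      dθ : ∏ rs (λ r → θ - r * 1#) ≈ meval ds θ
      dθ = trans (sym (proj₂ (proj₂ (split-monic ds)) θ 1#)) (hmeval-1 ds θ)
      conclude : (∏ rs (λ r → θ - r * 1#) ≈ 0#) ⊎ (¬ ∏ rs (λ r → θ - r * 1#) ≈ 0#) → (eval bs θ ≈ 0#) ⊎ (¬ eval bs θ ≈ 0#)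
      conclude (inj₁ z) = let (h , e) = divides-b θ in inj₁ (trans e (trans (*-congʳ (trans (sym dθ) z)) (zeroˡ h)))
      -- As g(θ) = 0, the Bézout identity makes d(θ) a multiple of b(θ).
      conclude (inj₂ nz) = let (u , v , bz) = bezout in inj₂ λ z → nz (trans dθ (trans bz
        (trans (+-cong (trans (*-congˡ z) (zeroʳ u)) (trans (*-congˡ gθ) (zeroʳ v))) (+-identityˡ _))))

  -- Exponential polynomials

  Δ : (ℕ → Carrier) → ℕ → Carrier
  Δ g n = g (suc n) - g n

  -- Polynomial sequences of degree less than d, described by the vanishing of the d-th difference,
  -- so that no degree has to be read off from coefficients.
  PolySeq : ℕ → (ℕ → Carrier) → Set
  PolySeq zero    g = ∀ n → g n ≈ 0#
  PolySeq (suc d) g = PolySeq d (Δ g)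

  PolySeq-resp : ∀ d {g h} → (∀ n → g n ≈ h n) → PolySeq d g → PolySeq d h
  PolySeq-resp zero    e q n = trans (sym (e n)) (q n)
  PolySeq-resp (suc d) e q = PolySeq-resp d (λ n → +-cong (e (suc n)) (-‿cong (e n))) q

  PolySeq-0 : ∀ d {g} → (∀ n → g n ≈ 0#) → PolySeq d g
  PolySeq-0 zero    e = e
  PolySeq-0 (suc d) e = PolySeq-0 d (λ n → trans (+-cong (e (suc n)) (-‿cong (e n))) (-‿inverseʳ 0#))

  PolySeq-+ : ∀ d {g h} → PolySeq d g → PolySeq d h → PolySeq d (λ n → g n + h n)
  PolySeq-+ zero    p q n = trans (+-cong (p n) (q n)) (+-identityʳ 0#)
  PolySeq-+ (suc d) {g} {h} p q = PolySeq-resp d (λ n → regroup (g (suc n)) (g n) (h (suc n)) (h n)) (PolySeq-+ d p q)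
    where
    regroup : ∀ a b c d → (a - b) + (c - d) ≈ (a + c) - (b + d)
    regroup = solve 4 (λ a b c d → (a :- b) :+ (c :- d) := (a :+ c) :- (b :+ d)) refl

  PolySeq-* : ∀ d {g} c → PolySeq d g → PolySeq d (λ n → c * g n)
  PolySeq-* zero    c p n = trans (*-congˡ (p n)) (zeroʳ c)
  PolySeq-* (suc d) {g} c p = PolySeq-resp d (λ n → regroup c (g (suc n)) (g n)) (PolySeq-* d c p)
    where
    regroup : ∀ c a b → c * (a - b) ≈ c * a - c * b
    regroup = solve 3 (λ c a b → c :* (a :- b) := c :* a :- c :* b) refl

  PolySeq-shift : ∀ d {g} → PolySeq d g → PolySeq d (λ n → g (suc n))
  PolySeq-shift zero    p n = p (suc n)
  PolySeq-shift (suc d) p = PolySeq-shift d p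

  -- Leibniz rule: Δ(n g) = n Δg + g(n + 1), where Δg has one degree less.
  PolySeq-n* : ∀ d {g} → PolySeq d g → PolySeq (suc d) (λ n → ν (+ n) * g n)
  PolySeq-n* d {g} p = PolySeq-resp d
    (λ n → trans (regroup (ν (+ n)) (g (suc n)) (g n)) (+-congʳ (*-congʳ (sym (ν-suc n)))))
    (PolySeq-+ d (n*Δ d p) (PolySeq-shift d p))
    where
    n*Δ : ∀ d {g} → PolySeq d g → PolySeq d (λ n → ν (+ n) * Δ g n)
    n*Δ zero    p n = trans (*-congˡ (trans (+-cong (p (suc n)) (-‿cong (p n))) (-‿inverseʳ 0#))) (zeroʳ _)
    n*Δ (suc d) p = PolySeq-n* d p
    regroup : ∀ n a b → n * (a - b) + a ≈ (1# + n) * a - n * b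
    regroup = solve 3 (λ n a b → n :* (a :- b) :+ a := (con (+ 1) :+ n) :* a :- n :* b) refl

  PolySeq-eval : ∀ cs → PolySeq (length cs) (λ n → eval cs (ν (+ n)))
  PolySeq-eval []       n = refl
  PolySeq-eval (c ∷ cs) = PolySeq-+ (suc (length cs)) {λ _ → c} (PolySeq-0 (length cs) (λ n → -‿inverseʳ c)) (PolySeq-n* (length cs) (PolySeq-eval cs))

  -- The divided difference (f(t) - f(x)) / (t - x) as a polynomial in t: the variant of `quotient`
  -- without an implicit leading 1.
  eval-quotient : Carrier → List Carrier → List Carrier
  eval-quotient x []            = []
  eval-quotient x (c ∷ [])      = []
  eval-quotient x (c ∷ c′ ∷ cs) = eval (c′ ∷ cs) x ∷ eval-quotient x (c′ ∷ cs)

  length-eval-quotient : ∀ x c cs → length (eval-quotient x (c ∷ cs)) ≡ length cs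
  length-eval-quotient x c []        = ≡.refl
  length-eval-quotient x c (c′ ∷ cs) = ≡.cong suc (length-eval-quotient x c′ cs)

  eval-divided-difference : ∀ x c cs t → eval (c ∷ cs) t - eval (c ∷ cs) x ≈ (t - x) * eval (eval-quotient x (c ∷ cs)) t
  eval-divided-difference x c [] t = base c x t
    where
    base : ∀ c x t → c + t * 0# - (c + x * 0#) ≈ (t - x) * 0#
    base = solve 3 (λ c x t → c :+ t :* con (+ 0) :- (c :+ x :* con (+ 0)) := (t :- x) :* con (+ 0)) refl
  eval-divided-difference x c (c′ ∷ cs) t =
    trans (split c t x (eval (c′ ∷ cs) t) (eval (c′ ∷ cs) x))
    (trans (+-congˡ (*-congˡ (eval-divided-difference x c′ cs t))) (collect t x (eval (c′ ∷ cs) x) _))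
    where
    split : ∀ c t x a b → c + t * a - (c + x * b) ≈ (t - x) * b + t * (a - b)
    split = solve 5 (λ c t x a b → c :+ t :* a :- (c :+ x :* b) := (t :- x) :* b :+ t :* (a :- b)) refl
    collect : ∀ t x b q → (t - x) * b + t * ((t - x) * q) ≈ (t - x) * (b + t * q)
    collect = solve 4 (λ t x b q → (t :- x) :* b :+ t :* ((t :- x) :* q) := (t :- x) :* (b :+ t :* q)) refl

  -- Recovering terms and coefficients from values in a subring

  module _ {P : Carrier → Set} (P-subring : IsSubring P) where
    open IsSubring P-subring

    -- Horner's scheme backwards: `c` is the value of the list at x minus x times the value of its
    -- tail, and the tail values are the entries of `eval-quotient`.
    coefficients-from-quotient : ∀ {x} c cs → P x → P (eval (c ∷ cs) x) → All P (eval-quotient x (c ∷ cs)) → All P (c ∷ cs)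
    coefficients-from-quotient {x} c [] px pe _ = resp (trans (+-congˡ (zeroʳ x)) (+-identityʳ c)) pe ∷ []
    coefficients-from-quotient {x} c (c′ ∷ cs) px pe (pe′ ∷ pq) =
      resp (cancel c (x * eval (c′ ∷ cs) x)) (P-sub pe (P* px pe′)) ∷ coefficients-from-quotient c′ cs px pe′ pq
      where
      cancel : ∀ c y → c + y - y ≈ c
      cancel = solve 2 (λ c y → c :+ y :- y := c) refl

    -- Newton interpolation: the divided difference at k is shorter and has values in `P` at k + 1,
    -- k + 2, and so on, since the differences of the nodes are positive integers and thus
    -- invertible in `P`.
    coefficients-from-values : (∀ {x} → Frac x → P x) → ∀ k cs → (∀ m → P (eval cs (ν (+ (k ℕ.+ m))))) → All P cs
    coefficients-from-values Frac⊂P k cs = go (length cs) k cs ≡.refl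
      where
      go : ∀ n k cs → length cs ≡ n → (∀ m → P (eval cs (ν (+ (k ℕ.+ m))))) → All P cs
      go zero    k []       _ h = []
      go (suc n) k (c ∷ cs) e h = coefficients-from-quotient c cs (P-ν (+ k)) at-k
          (go n (suc k) (eval-quotient (ν (+ k)) (c ∷ cs)) (≡.trans (length-eval-quotient _ c cs) (ℕP.suc-injective e)) beyond)
        where
        at-k : P (eval (c ∷ cs) (ν (+ k)))
        at-k = ≡.subst (λ j → P (eval (c ∷ cs) (ν (+ j)))) (ℕP.+-identityʳ k) (h 0)
        beyond : ∀ m → P (eval (eval-quotient (ν (+ k)) (c ∷ cs)) (ν (+ (suc k ℕ.+ m))))
        beyond m = resp (begin
            i * (eval (c ∷ cs) t - eval (c ∷ cs) (ν (+ k)))                          ≈⟨ *-congˡ (eval-divided-difference (ν (+ k)) c cs t) ⟩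
            i * ((t - ν (+ k)) * q)                                                  ≈⟨ *-assoc i _ q ⟨
            i * (t - ν (+ k)) * q                                                    ≈⟨ *-congʳ (trans (*-congˡ t-k) (trans (*-comm _ _) (inv-r _ _))) ⟩
            1# * q                                                                   ≈⟨ *-identityˡ q ⟩
            q                                                                        ∎)
            (P* (Frac⊂P (+ suc m , + 1 , (λ ()) , trans (inv-r _ _) (sym ν-1)))
                (P-sub (≡.subst (λ j → P (eval (c ∷ cs) (ν (+ j)))) (ℕP.+-suc k m) (h (suc m))) at-k))
          where
          t = ν (+ (suc k ℕ.+ m))
          q = eval (eval-quotient (ν (+ k)) (c ∷ cs)) t
          i = inv (ν (+ suc m)) (ν≉0 (λ ()))
          t-k : t - ν (+ k) ≈ ν (+ suc m)
          t-k = trans (+-congʳ (trans (reflexive (≡.cong (λ j → ν (+ j)) (≡.sym (ℕP.+-suc k m)))) (ν-+ (+ k) (+ suc m)))) (cancel (ν (+ k)) (ν (+ suc m)))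
            where
            cancel : ∀ a b → a + b - a ≈ b
            cancel = solve 2 (λ a b → a :+ b :- a := b) refl

    Δ∈P⇒∈P : ∀ {g} → P (g 0) → (∀ n → P (Δ g n)) → ∀ n → P (g n)
    Δ∈P⇒∈P p0 d zero    = p0
    Δ∈P⇒∈P {g} p0 d (suc n) = resp (cancel (g (suc n)) (g n)) (P+ (d n) (Δ∈P⇒∈P p0 d n))
      where
      cancel : ∀ a b → a - b + b ≈ a
      cancel = solve 2 (λ a b → a :- b :+ b := a) refl

    -- a g(n+1) - b g(n) = a Δg(n) + (a - b) g(n), so it is enough to treat Δg. Its twisted
    -- difference is a difference of two given values, and its degree is smaller.
    twisted-difference-injective : ∀ d {g a b u} → PolySeq d g → P a → P u → (a - b) * u ≈ 1# →
      (∀ n → P (a * g (suc n) - b * g n)) → ∀ n → P (g n)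
    twisted-difference-injective zero pg pa pu e h n = resp (sym (pg n)) P0
    twisted-difference-injective (suc d) {g} {a} {b} {u} pg pa pu e h n =
      resp (begin
        u * ((a * g (suc n) - b * g n) - a * Δ g n)     ≈⟨ collect a b u (g (suc n)) (g n) ⟩
        (a - b) * u * g n                               ≈⟨ *-congʳ e ⟩
        1# * g n                                        ≈⟨ *-identityˡ _ ⟩
        g n                                             ∎)
        (P* pu (P-sub (h n) (P* pa (Δg n))))
      where
      collect : ∀ a b u x y → u * ((a * x - b * y) - a * (x - y)) ≈ (a - b) * u * y
      collect = solve 5 (λ a b u x y → u :* ((a :* x :- b :* y) :- a :* (x :- y)) := (a :- b) :* u :* y) refl
      regroup : ∀ a b x y z → (a * x - b * y) - (a * y - b * z) ≈ a * (x - y) - b * (y - z)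
      regroup = solve 5 (λ a b x y z → (a :* x :- b :* y) :- (a :* y :- b :* z) := a :* (x :- y) :- b :* (y :- z)) refl
      Δg : ∀ n → P (Δ g n)
      Δg = twisted-difference-injective d pg pa pu e λ n →
             resp (regroup a b (g (suc (suc n))) (g (suc n)) (g n)) (P-sub (h (suc n)) (h n))

    -- Applying E - l₀ (E the shift) lowers the degree of g₀ and is injective on the other terms,
    -- hence the terms of an exponential polynomial with values in P have values in P.
    components∈P : ∀ s (l : Fin s → Carrier) → (∀ i → P (l i)) → (∀ i → ∃ λ u → P u × l i * u ≈ 1#) →
      (∀ i j → i ≢ j → ∃ λ u → P u × (l i - l j) * u ≈ 1#) →
      ∀ (g : Fin s → ℕ → Carrier) (d : Fin s → ℕ) → (∀ i → PolySeq (d i) (g i)) →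
      (∀ n → P (sum s (λ i → g i n * pow (l i) n))) → ∀ i n → P (g i n)
    components∈P zero l pl pinv pdiff g d pg h ()
    components∈P (suc s) l pl pinv pdiff g d pg h = go (d zero) g (pg zero) (λ i → pg (suc i)) h
      where
      -- Inner induction on the degree bound of g₀; the operator does not raise the other bounds.
      -- When g₀ vanishes, the outer induction on the number of terms takes over.
      go : ∀ d₀ g → PolySeq d₀ (g zero) → (∀ i → PolySeq (d (suc i)) (g (suc i))) →
           (∀ n → P (sum (suc s) (λ i → g i n * pow (l i) n))) → ∀ i n → P (g i n)
      go zero g pg₀ pg h zero    n = resp (sym (pg₀ n)) P0
      go zero g pg₀ pg h (suc i) n = components∈P s (λ i → l (suc i)) (λ i → pl (suc i)) (λ i → pinv (suc i))
        (λ i j ne → pdiff (suc i) (suc j) (λ { ≡.refl → ne ≡.refl })) (λ i → g (suc i)) (λ i → d (suc i)) pg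
        (λ n → resp (trans (+-congʳ (trans (*-congʳ (pg₀ n)) (zeroˡ _))) (+-identityˡ _)) (h n)) i n
      go (suc d₀) g pg₀ pg h = λ { zero n → g₀∈P n ; (suc i) n → rest∈P i n }
        where
        g′ : Fin (suc s) → ℕ → Carrier
        g′ i n = l i * g i (suc n) - l zero * g i n
        regroup : ∀ l₀ l a b q → (l * a - l₀ * b) * q ≈ a * (l * q) + - l₀ * (b * q)
        regroup = solve 5 (λ l₀ l a b q → (l :* a :- l₀ :* b) :* q := a :* (l :* q) :+ (:- l₀) :* (b :* q)) refl
        h′ : ∀ n → P (sum (suc s) (λ i → g′ i n * pow (l i) n))
        h′ n = resp (sym (begin
            sum (suc s) (λ i → g′ i n * pow (l i) n)
              ≈⟨ sum-cong (suc s) (λ i → regroup (l zero) (l i) (g i (suc n)) (g i n) (pow (l i) n)) ⟩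
            sum (suc s) (λ i → g i (suc n) * pow (l i) (suc n) + - l zero * (g i n * pow (l i) n))
              ≈⟨ sum-+ (suc s) (λ i → g i (suc n) * pow (l i) (suc n)) (λ i → - l zero * (g i n * pow (l i) n)) ⟩
            sum (suc s) (λ i → g i (suc n) * pow (l i) (suc n)) + sum (suc s) (λ i → - l zero * (g i n * pow (l i) n))
              ≈⟨ +-congˡ (sum-*ˡ (suc s) (- l zero) (λ i → g i n * pow (l i) n)) ⟩
            sum (suc s) (λ i → g i (suc n) * pow (l i) (suc n)) + - l zero * sum (suc s) (λ i → g i n * pow (l i) n) ∎))
          (P+ (h (suc n)) (P* (P- (pl zero)) (h n)))
        factor : ∀ c a b → c * (a - b) ≈ c * a - c * b
        factor = solve 3 (λ c a b → c :* (a :- b) := c :* a :- c :* b) refl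
        PolySeq-g′ : ∀ d i → PolySeq d (g i) → PolySeq d (g′ i)
        PolySeq-g′ d i q = PolySeq-resp d (λ n → +-congˡ (sym (-‿distribˡ-* _ _)))
          (PolySeq-+ d (PolySeq-* d (l i) (PolySeq-shift d q)) (PolySeq-* d (- l zero) q))
        g′∈P : ∀ i n → P (g′ i n)
        g′∈P = go d₀ g′ (PolySeq-resp d₀ (λ n → factor (l zero) (g zero (suc n)) (g zero n)) (PolySeq-* d₀ (l zero) pg₀))
                  (λ i → PolySeq-g′ (d (suc i)) (suc i) (pg i)) h′
        rest∈P : ∀ i n → P (g (suc i) n)
        rest∈P i = let (u , pu , e) = pdiff (suc i) zero (λ ()) in
          twisted-difference-injective (d (suc i)) (pg i) (pl (suc i)) pu e (g′∈P (suc i))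
        Δg₀∈P : ∀ n → P (Δ (g zero) n)
        Δg₀∈P n = let (u , pu , e) = pinv zero in
          resp (trans (cancel u (l zero) (g zero (suc n)) (g zero n)) (trans (*-congʳ e) (*-identityˡ _))) (P* pu (g′∈P zero n))
          where
          cancel : ∀ u l a b → u * (l * a - l * b) ≈ l * u * (a - b)
          cancel = solve 4 (λ u l a b → u :* (l :* a :- l :* b) := l :* u :* (a :- b)) refl
        -- The differences determine g₀ up to a constant only; the constant comes from the value of
        -- the whole sum at 0.
        g₀0∈P : P (g zero 0)
        g₀0∈P = resp (cancel (g zero 0) (sum s (λ i → g (suc i) 0 * 1#)))
          (P-sub (h 0) (P-sum s (λ i → P* (rest∈P i 0) P1)))
          where
          cancel : ∀ a b → a * 1# + b - b ≈ a
          cancel = solve 2 (λ a b → a :* con (+ 1) :+ b :- b := a) refl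
        g₀∈P : ∀ n → P (g zero n)
        g₀∈P = Δ∈P⇒∈P g₀0∈P Δg₀∈P

module AtPrime (K : AlgClosedFieldOverℚ 0ℓ 0ℓ) (p : ℕ) (p-prime : Prime p) where

  open FieldOverℚ K public

  -- The local ring of p and its finite extensions in K

  instance
    p-nonTrivial : ℕ.NonTrivial p
    p-nonTrivial = Primality.prime⇒nonTrivial p-prime

    p-nonZero : ℕ.NonZero p
    p-nonZero = ℕ.nonTrivial⇒nonZero p

  infix 4 p∣_ p∤_
  p∣_ p∤_ : ℤ → Set
  p∣ c = + p ℤD.∣ c
  p∤ c = ¬ (p∣ c)

  p∤⇒≢0 : ∀ {c} → p∤ c → c ≢ + 0
  p∤⇒≢0 h ≡.refl = h (ℤD.divides (+ 0) ≡.refl)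

  p∤1 : p∤ + 1
  p∤1 h = ℕD.>⇒∤ (ℕ.nonTrivial⇒n>1 p) (ℤD.∣⇒∣ᵤ h)

  p∤* : ∀ {a b} → p∤ a → p∤ b → p∤ (a ℤ.* b)
  p∤* {a} {b} na nb h with euclidsLemma ℤ.∣ a ∣ ℤ.∣ b ∣ p-prime (≡.subst (p ℕD.∣_) (ℤP.abs-* a b) (ℤD.∣⇒∣ᵤ h))
  ... | inj₁ d = na (ℤD.∣ᵤ⇒∣ d)
  ... | inj₂ d = nb (ℤD.∣ᵤ⇒∣ d)

  ϖ : Carrier
  ϖ = ν (+ p)

  ϖ≉0 : ¬ ϖ ≈ 0#
  ϖ≉0 = ν≉0 λ e → ℕ.≢-nonZero⁻¹ p (ℤP.+-injective e)

  -- The copy of the localisation of ℤ at p in K.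
  Loc : Carrier → Set
  Loc x = ∃ λ c → ∃ λ z → p∤ c × ν c * x ≈ ν z

  Loc⊂Frac : ∀ {x} → Loc x → Frac x
  Loc⊂Frac (c , z , n , h) = c , z , p∤⇒≢0 n , h

  Loc-subring : IsSubring Loc
  Loc-subring = record
    { resp = λ e (c , z , n , h) → c , z , n , trans (*-congˡ (sym e)) h
    ; P1 = + 1 , + 1 , p∤1 , *-identityʳ _
    ; P+ = λ (c , z , n , h) (c' , z' , n' , h') → _ , _ , p∤* n n' , Frac-+ h h'
    ; P* = λ (c , z , n , h) (c' , z' , n' , h') → _ , _ , p∤* n n' , Frac-* h h'
    ; P- = λ (c , z , n , h) → c , ℤ.- z , n , Frac-neg h
    }

  module Loc = IsSubring Loc-subring

  Loc-unit : ∀ {c z x} → p∤ z → ν c * x ≈ ν z → p∤ c → ∃ λ y → Loc y × x * y ≈ 1#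
  Loc-unit {c} {z} {x} nz h nc = ν c * i ,
    (z , c , nz , trans (left (ν z) (ν c) i) (trans (*-congʳ (inv-r _ _)) (*-identityˡ _))) ,
    trans (right x (ν c) i) (trans (*-congʳ h) (inv-r _ _))
    where
    i = inv (ν z) (ν≉0 (p∤⇒≢0 nz))
    left : ∀ z c i → z * (c * i) ≈ (z * i) * c
    left = solve 3 (λ z c i → z :* (c :* i) := (z :* i) :* c) refl
    right : ∀ x c i → x * (c * i) ≈ c * x * i
    right = solve 3 (λ x c i → x :* (c :* i) := c :* x :* i) refl

  -- If k = z/c, the numerator c - p z is prime to p because c is: p lies in the Jacobson radical.
  1-ϖ*-unit : ∀ {k} → Loc k → ∃ λ u → Loc u × (1# - ϖ * k) * u ≈ 1#
  1-ϖ*-unit {k} (c , z , nc , h) = Loc-unit {c} {c ℤ.- + p ℤ.* z} {1# - ϖ * k}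
    (λ d → nc (ℤD.∣m+n∣n⇒∣m {m = c} d (ℤD.∣m⇒∣-m (ℤD.∣m⇒∣m*n z ℤD.∣-refl)))) eq nc
    where
    expand : ∀ c ϖ k → c * (1# - ϖ * k) ≈ c - ϖ * (c * k)
    expand = solve 3 (λ c ϖ k → c :* (con (+ 1) :- ϖ :* k) := c :- ϖ :* (c :* k)) refl
    eq : ν c * (1# - ϖ * k) ≈ ν (c ℤ.- + p ℤ.* z)
    eq = trans (expand (ν c) ϖ k) (trans (+-congˡ (-‿cong (trans (*-congˡ h) (sym (ν-* (+ p) z)))))
           (trans (+-congˡ (sym (ν-neg _))) (sym (ν-+ c _))))

  -- By elimination: g = p (k g + w) and the unit 1 - p k express the first generator through the
  -- remaining ones. Substituting it into the other relations leaves a shorter list of the same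
  -- kind.
  nakayama : ∀ G → All (λ g → ∃ λ y → Lin Loc G y × g ≈ ϖ * y) G → All (_≈ 0#) G
  nakayama [] [] = []
  nakayama (g ∷ G) ((y , (k , w , lk , lw , e) , h) ∷ hs) = g≈0 ∷ G≈0
    where
    u : Carrier
    u = proj₁ (1-ϖ*-unit lk)
    lu : Loc u
    lu = proj₁ (proj₂ (1-ϖ*-unit lk))
    solve-for-g : ∀ {g ϖ k w u y} → g ≈ ϖ * y → y ≈ k * g + w → (1# - ϖ * k) * u ≈ 1# → g ≈ ϖ * (u * w)
    solve-for-g {g} {ϖ} {k} {w} {u} {y} h e hu = begin
      g                                          ≈⟨ *-identityʳ g ⟨
      g * 1#                                     ≈⟨ *-congˡ hu ⟨
      g * ((1# - ϖ * k) * u)                     ≈⟨ expand g ϖ k u w ⟩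
      ϖ * (u * w) + u * (g - ϖ * (k * g + w))    ≈⟨ +-congˡ (*-congˡ (x≈y⇒x-y≈0 (trans h (*-congˡ e)))) ⟩
      ϖ * (u * w) + u * 0#                       ≈⟨ trans (+-congˡ (zeroʳ u)) (+-identityʳ _) ⟩
      ϖ * (u * w)                                ∎
      where
      expand : ∀ g ϖ k u w → g * ((1# - ϖ * k) * u) ≈ ϖ * (u * w) + u * (g - ϖ * (k * g + w))
      expand = solve 5 (λ g ϖ k u w → g :* ((con (+ 1) :- ϖ :* k) :* u) := ϖ :* (u :* w) :+ u :* (g :- ϖ :* (k :* g :+ w))) refl
    g∈ϖG : g ≈ ϖ * (u * w)
    g∈ϖG = solve-for-g h e (proj₂ (proj₂ (1-ϖ*-unit lk)))
    g∈G : Lin Loc G g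
    g∈G = Lin-resp G (sym g∈ϖG) (Lin-* Loc-subring G (Loc.P-ν (+ p)) (Lin-* Loc-subring G lu lw))
    eliminate-g : ∀ {x} → (∃ λ y → Lin Loc (g ∷ G) y × x ≈ ϖ * y) → ∃ λ y → Lin Loc G y × x ≈ ϖ * y
    eliminate-g (y , (k , w , lk , lw , e) , h) = _ , Lin-+ Loc-subring G (Lin-* Loc-subring G lk g∈G) lw , trans h (*-congˡ e)
    G≈0 : All (_≈ 0#) G
    G≈0 = nakayama G (All.map eliminate-g hs)
    g≈0 : g ≈ 0#
    g≈0 = Lin-of-zeros G≈0 g∈G

  -- A subring of K that is a finite module over ℤ localised at p. The generators may be redundant;
  -- no basis is chosen.
  record Order : Set₁ where
    field
      R         : Carrier → Set
      R-subring : IsSubring R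
      Loc⊂R     : ∀ {x} → Loc x → R x
      gens      : List Carrier
      gens∈R    : All R gens
      span      : ∀ {x} → R x → Lin Loc gens x
    open IsSubring R-subring public

    Lin⊂R : ∀ {x} → Lin Loc gens x → R x
    Lin⊂R = go gens∈R
      where
      go : ∀ {G x} → All R G → Lin Loc G x → R x
      go []       h = resp (sym h) P0
      go (g ∷ gs) (k , y , q , l , h) = resp (sym h) (P+ (P* (Loc⊂R q) g) (go gs l))

    -- If 1 = p z, each generator g equals p (z g), so Nakayama's lemma kills all generators and
    -- with them 1.
    1∉ϖR : ∀ {z} → R z → ¬ 1# ≈ ϖ * z
    1∉ϖR {z} rz h = 1≉0 (Lin-of-zeros (nakayama gens (All.map divisible gens∈R)) (span P1))
      where
      divisible : ∀ {g} → R g → ∃ λ y → Lin Loc gens y × g ≈ ϖ * y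
      divisible {g} rg = z * g , span (P* rz rg) , trans (sym (*-identityˡ g)) (trans (*-congʳ h) (*-assoc ϖ z g))

    infix 4 _∈ϖ^_
    _∈ϖ^_ : Carrier → ℕ → Set
    x ∈ϖ^ M = ∃ λ z → R z × x ≈ pow ϖ M * z

    ∈ϖ^-resp : ∀ {M x y} → x ≈ y → x ∈ϖ^ M → y ∈ϖ^ M
    ∈ϖ^-resp e (z , rz , h) = z , rz , trans (sym e) h

    ∈ϖ^-0 : ∀ {M} → 0# ∈ϖ^ M
    ∈ϖ^-0 = 0# , P0 , sym (zeroʳ _)

    ∈ϖ^-+ : ∀ {M x y} → x ∈ϖ^ M → y ∈ϖ^ M → (x + y) ∈ϖ^ M
    ∈ϖ^-+ (z , rz , h) (w , rw , h′) = z + w , P+ rz rw , trans (+-cong h h′) (sym (distribˡ _ _ _))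

    ∈ϖ^-* : ∀ {M x c} → R c → x ∈ϖ^ M → (c * x) ∈ϖ^ M
    ∈ϖ^-* {M} {x} {c} rc (z , rz , h) = c * z , P* rc rz , trans (*-congˡ h) (swap c (pow ϖ M) z)
      where
      swap : ∀ c q z → c * (q * z) ≈ q * (c * z)
      swap = solve 3 (λ c q z → c :* (q :* z) := q :* (c :* z)) refl

    ∈ϖ^-neg : ∀ {M x} → x ∈ϖ^ M → (- x) ∈ϖ^ M
    ∈ϖ^-neg (z , rz , h) = - z , P- rz , trans (-‿cong h) (-‿distribʳ-* _ _)

    pow-ϖ : ∀ j → pow ϖ j ≈ ν (+ (p ℕ.^ j))
    pow-ϖ zero    = sym ν-1
    pow-ϖ (suc j) = trans (*-congˡ (pow-ϖ j)) (trans (sym (ν-* (+ p) _)) (reflexive (≡.cong ν (≡.sym (ℤP.pos-* p (p ℕ.^ j))))))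

    private
      p-part : ∀ n → Acc ℕ._<_ n → n ≢ 0 → ∃ λ j → ∃ λ u → n ≡ p ℕ.^ j ℕ.* u × ¬ p ℕD.∣ u
      p-part n (acc rs) nz with p ℕD.∣? n
      ... | no ¬d = 0 , n , ≡.sym (ℕP.*-identityˡ n) , ¬d
      ... | yes (ℕD.divides q ≡.refl) =
        let q≢0 = λ e → nz (≡.cong (ℕ._* p) e)
            instance _ = ℕ.≢-nonZero q≢0
            (j , u , e , nd) = p-part q (rs (ℕP.m<m*n q p (ℕ.nonTrivial⇒n>1 p))) q≢0
        in suc j , u , ≡.trans (≡.cong (ℕ._* p) e) (≡.trans (ℕP.*-comm _ p) (≡.sym (ℕP.*-assoc p _ u))) , nd

    -- Write n = p^j u with u prime to p. Divisibility by p^(j+1) would make the unit u a multiple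
    -- of p.
    ℕ-separated : ∀ {n} → n ≢ 0 → ¬ (∀ M → ν (+ n) ∈ϖ^ M)
    ℕ-separated {n} nz deep =
      let (j , u , e , nd) = p-part n (<-wellFounded n) nz
          (z , rz , h) = deep (suc j)
          νn : ν (+ n) ≈ pow ϖ j * ν (+ u)
          νn = trans (reflexive (≡.cong ν (≡.trans (≡.cong +_ e) (ℤP.pos-* (p ℕ.^ j) u)))) (trans (ν-* _ _) (*-congʳ (sym (pow-ϖ j))))
          u≈ϖz : ν (+ u) ≈ ϖ * z
          u≈ϖz = x-y≈0⇒x≈y (cancel-≉0 (pow-≉0 j ϖ≉0) (trans (factor (pow ϖ j) (ν (+ u)) ϖ z) (x≈y⇒x-y≈0 (trans (sym νn) h))))
          (v , lv , uv) = Loc-unit {+ 1} {+ u} (λ d → nd (ℤD.∣⇒∣ᵤ d)) (trans (*-congʳ ν-1) (*-identityˡ _)) p∤1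
      in 1∉ϖR (P* rz (Loc⊂R lv)) (trans (sym uv) (trans (*-congʳ u≈ϖz) (*-assoc ϖ z v)))
      where
      factor : ∀ q u ϖ z → q * (u - ϖ * z) ≈ q * u - ϖ * q * z
      factor = solve 4 (λ q u ϖ z → q :* (u :- ϖ :* z) := q :* u :- ϖ :* q :* z) refl

    ℤ-separated : ∀ {c} → c ≢ + 0 → ¬ (∀ M → ν c ∈ϖ^ M)
    ℤ-separated {+ n}      nz deep = ℕ-separated (λ e → nz (≡.cong +_ e)) deep
    ℤ-separated { -[1+ n ]} nz deep = ℕ-separated {suc n} (λ ()) (λ M → ∈ϖ^-resp {M} (trans (-‿cong (ν-neg (+ suc n))) (-‿involutive _)) (∈ϖ^-neg {M} (deep M)))

    -- The ℚ-algebra generated by R.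
    T : Carrier → Set
    T x = ∃ λ c → c ≢ + 0 × R (ν c * x)

    R⊂T : ∀ {x} → R x → T x
    R⊂T rx = + 1 , (λ ()) , resp (sym (trans (*-congʳ ν-1) (*-identityˡ _))) rx

    Frac⊂T : ∀ {x} → Frac x → T x
    Frac⊂T (c , z , nz , h) = c , nz , resp (sym h) (P-ν z)

    T-subring : IsSubring T
    T-subring = record
      { resp = λ e (c , nz , h) → c , nz , resp (*-congˡ e) h
      ; P1 = R⊂T P1
      ; P+ = λ {x} {y} (c , nz , h) (d , nz′ , h′) → c ℤ.* d , ℤ-*-≢0 nz nz′ ,
          resp (sym (trans (*-congʳ (ν-* c d)) (split-+ (ν c) (ν d) x y))) (P+ (P* (P-ν d) h) (P* (P-ν c) h′))
      ; P* = λ {x} {y} (c , nz , h) (d , nz′ , h′) → c ℤ.* d , ℤ-*-≢0 nz nz′ ,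
          resp (sym (trans (*-congʳ (ν-* c d)) (split-* (ν c) (ν d) x y))) (P* h h′)
      ; P- = λ (c , nz , h) → c , nz , resp (-‿distribʳ-* _ _) (P- h)
      }
      where
      split-+ : ∀ c d x y → c * d * (x + y) ≈ d * (c * x) + c * (d * y)
      split-+ = solve 4 (λ c d x y → c :* d :* (x :+ y) := d :* (c :* x) :+ c :* (d :* y)) refl
      split-* : ∀ c d x y → c * d * (x * y) ≈ (c * x) * (d * y)
      split-* = solve 4 (λ c d x y → c :* d :* (x :* y) := (c :* x) :* (d :* y)) refl

    module T = IsSubring T-subring

    T-span : ∀ {x} → T x → Lin Frac gens x
    T-span {x} (c , nz , h) = Lin-resp gens cancel
      (Lin-* (IsSubfield.isSubring Frac-subfield) gens {i} (c , + 1 , nz , trans (inv-r _ _) (sym ν-1)) (Lin-weaken Loc⊂Frac gens (span h)))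
      where
      i = inv (ν c) (ν≉0 nz)
      cancel : i * (ν c * x) ≈ x
      cancel = trans (sym (*-assoc _ _ _)) (trans (*-congʳ (trans (*-comm _ _) (inv-r _ _))) (*-identityˡ x))

    -- T is spanned over ℚ by `gens`, so `suc (length gens)` powers of x are linearly dependent.
    T-inverse : ∀ {x} → T x → ¬ x ≈ 0# → ∃ λ y → T y × x * y ≈ 1#
    T-inverse {x} tx nz =
      let (n , qn , nzn , e) = linear-dependency Frac-subfield gens (λ j → pow x (toℕ j)) (λ j → T-span (T.P-pow (toℕ j) tx))
      in inverse-of-algebraic Frac-subfield T-subring Frac⊂T _ n qn nzn tx nz e

    -- An inverse of x with denominator c turns divisibility of x by all powers of p into the same
    -- property of the nonzero integer c.
    T-separated : ∀ {x} → R x → ¬ x ≈ 0# → ¬ (∀ M → x ∈ϖ^ M)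
    T-separated {x} rx nz deep =
      let (y , (c , nzc , ry) , e) = T-inverse (R⊂T rx) nz
      in ℤ-separated nzc λ M → ∈ϖ^-resp {M} (trans (swap (ν c) y x) (trans (*-congˡ e) (*-identityʳ _))) (∈ϖ^-* {M} ry (deep M))
      where
      swap : ∀ c y x → c * y * x ≈ c * (x * y)
      swap = solve 3 (λ c y x → c :* y :* x := c :* (x :* y)) refl

    Decidable≈0 : Set
    Decidable≈0 = ∀ {x} → R x → (x ≈ 0#) ⊎ (¬ x ≈ 0#)

    T-subfield : Decidable≈0 → IsSubfield T
    T-subfield dec = record { isSubring = T-subring ; zero∨unit = decide }
      where
      decide : ∀ {x} → T x → (x ≈ 0#) ⊎ (∃ λ y → T y × x * y ≈ 1#)
      decide {x} tx@(c , nz , h) with dec h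
      ... | inj₁ z = inj₁ (cancel-≉0 (ν≉0 nz) z)
      ... | inj₂ nz′ = inj₂ (T-inverse tx (λ z → nz′ (trans (*-congˡ z) (zeroʳ _))))

  Loc-order : Order
  Loc-order = record
    { R = Loc ; R-subring = Loc-subring ; Loc⊂R = λ l → l
    ; gens = 1# ∷ [] ; gens∈R = Loc.P1 ∷ []
    ; span = λ {x} l → x , 0# , l , refl , sym (trans (+-identityʳ _) (*-identityʳ x)) }

  Loc-decidable : Order.Decidable≈0 Loc-order
  Loc-decidable lx with IsSubfield.zero∨unit Frac-subfield (Loc⊂Frac lx)
  ... | inj₁ z = inj₁ z
  ... | inj₂ (y , _ , e) = inj₂ (unit≉0 e)

  -- Adjoining a root of a monic polynomial to an order

  module _ (O : Order) {ms : List Carrier} {θ : Carrier} (ms∈R : All (Order.R O) ms) (θ-root : meval ms θ ≈ 0#) where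
    open Order O

    private
      S : Carrier → Set
      S x = ∃ λ cs → All R cs × x ≈ eval cs θ

      S-subring : IsSubring S
      S-subring = record
        { resp = λ e (cs , r , h) → cs , r , trans (sym e) h
        ; P1 = 1# ∷ [] , P1 ∷ [] , sym (trans (+-congˡ (zeroʳ θ)) (+-identityʳ 1#))
        ; P+ = λ (cs , r , h) (ds , r′ , h′) → let (es , r″ , e) = add-coefficients R-subring r r′ in
                 es , r″ , trans (+-cong h h′) (sym (e θ))
        ; P* = λ (cs , r , h) (ds , r′ , h′) → let (es , r″ , e) = multiply-coefficients R-subring r r′ in
                 es , r″ , trans (*-cong h h′) (sym (e θ))
        ; P- = λ (cs , r , h) → let (es , r″ , e) = scale-coefficients R-subring (P- P1) r in
                 es , r″ , trans (-‿cong h) (trans (sym (-1*x≈-x _)) (sym (e θ)))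
        }

      R⊂S : ∀ {x} → R x → S x
      R⊂S {x} rx = x ∷ [] , rx ∷ [] , sym (trans (+-congˡ (zeroʳ θ)) (+-identityʳ x))

      θ∈S : S θ
      θ∈S = 0# ∷ 1# ∷ [] , P0 ∷ P1 ∷ [] , expand θ
        where
        expand : ∀ θ → θ ≈ 0# + θ * (1# + θ * 0#)
        expand = solve 1 (λ θ → θ := con (+ 0) :+ θ :* (con (+ 1) :+ θ :* con (+ 0))) refl

      -- The products g θ^i with i < n and g a generator, arranged to match Horner evaluation.
      powers : ℕ → List Carrier
      powers zero    = []
      powers (suc n) = gens ++ L.map (θ *_) (powers n)

      powers∈S : ∀ n → All S (powers n)
      powers∈S zero    = []
      powers∈S (suc n) = AllP.++⁺ (All.map R⊂S gens∈R) (AllP.map⁺ (All.map (IsSubring.P* S-subring θ∈S) (powers∈S n)))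

      eval∈powers : ∀ {rs} → All R rs → Lin Loc (powers (length rs)) (eval rs θ)
      eval∈powers []       = refl
      eval∈powers {_ ∷ rs} (r ∷ prs) = Lin-++ Loc-subring gens (L.map (θ *_) (powers (length rs))) (span r) (Lin-map Loc-subring θ (powers (length rs)) (eval∈powers prs))

      S-span : ∀ {x} → S x → Lin Loc (powers (length ms)) x
      S-span (cs , rcs , h) =
        let (qs , rs , _ , rrs , l , e) = divide R-subring cs ms∈R rcs in
        Lin-resp (powers (length ms)) (sym (trans h (trans (e θ) (trans (+-congʳ (trans (*-congʳ θ-root) (zeroˡ _))) (+-identityˡ _)))))
          (≡.subst (λ n → Lin Loc (powers n) (eval rs θ)) l (eval∈powers rrs))

    adjoin : Order
    adjoin = record
      { R = S ; R-subring = S-subring ; Loc⊂R = λ l → R⊂S (Loc⊂R l)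
      ; gens = powers (length ms) ; gens∈R = powers∈S (length ms) ; span = S-span }

    adjoin-⊃ : ∀ {x} → R x → Order.R adjoin x
    adjoin-⊃ = R⊂S

    adjoin-∋ : Order.R adjoin θ
    adjoin-∋ = θ∈S

    adjoin-decidable : (∀ δ → meval ms δ ≈ 0# → Dec (θ ≈ δ)) → Decidable≈0 → Order.Decidable≈0 adjoin
    adjoin-decidable dec d (cs , rcs , h) =
      Sum.map (trans h) (λ nz z → nz (trans (sym h) z))
        (decide-value (T-subfield d) (All.map R⊂T ms∈R) θ-root dec (All.map R⊂T rcs))

  abstract
    -- Coefficients in `Loc` remain available at every stage of the tower. Decidability is passed on
    -- as an implication, so that the order exists before equality of the adjoined roots can be
    -- decided.
    adjoin-roots : (O : Order) → ∀ {ms} → All Loc ms → ∀ {θs} → All (λ θ → meval ms θ ≈ 0#) θs →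
      ∃ λ O′ → (∀ {x} → Order.R O x → Order.R O′ x) × All (Order.R O′) θs ×
        (All (λ θ → ∀ δ → meval ms δ ≈ 0# → Dec (θ ≈ δ)) θs → Order.Decidable≈0 O → Order.Decidable≈0 O′)
    adjoin-roots O lms [] = O , (λ r → r) , [] , λ _ d → d
    adjoin-roots O lms (z ∷ zs) =
      let O₁ = adjoin O (All.map (Order.Loc⊂R O) lms) z
          (O′ , incl , θs∈ , dec) = adjoin-roots O₁ lms zs
          incl₁ = adjoin-⊃ O (All.map (Order.Loc⊂R O) lms) z
      in O′ , (λ r → incl (incl₁ r)) , incl (adjoin-∋ O (All.map (Order.Loc⊂R O) lms) z) ∷ θs∈ ,
         λ { (d ∷ ds) D → dec ds (λ {x} → adjoin-decidable O (All.map (Order.Loc⊂R O) lms) z d D {x}) }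

  -- Units modulo p

  inverse-mod-p : ∀ {c} → p∤ c → ∃ λ d → ∃ λ t → c ℤ.* d ≡ + 1 ℤ.+ + p ℤ.* t
  inverse-mod-p {c} nc = from-sign (ℤP.+∣i∣≡i⊎+∣i∣≡-i c)
    where
    coprime : Coprimality.Coprime p ℤ.∣ c ∣
    coprime {d} (d∣p , d∣c) with Primality.prime⇒irreducible p-prime d∣p
    ... | inj₁ e = e
    ... | inj₂ ≡.refl = ⊥-elim (nc (ℤD.∣ᵤ⇒∣ d∣c))
    n = ℤ.∣ c ∣
    natural : ∃ λ d → ∃ λ t → + n ℤ.* d ≡ + 1 ℤ.+ + p ℤ.* t
    natural with Coprimality.coprime-Bézout coprime
    ... | ℕGCD.Bézout.+- x y eq = ℤ.- (+ y) , ℤ.- (+ x) , sgn (+ n) (+ y) (+ x) (+ p) (ℤ-eq x y eq)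
      where
      ℤ-eq : ∀ x y → 1 ℕ.+ y ℕ.* n ≡ x ℕ.* p → + 1 ℤ.+ + y ℤ.* + n ≡ + x ℤ.* + p
      ℤ-eq x y e = ≡.trans (≡.cong (λ t → + 1 ℤ.+ t) (≡.sym (ℤP.pos-* y n))) (≡.trans (≡.cong +_ e) (ℤP.pos-* x p))
      sgn : ∀ n y x q → + 1 ℤ.+ y ℤ.* n ≡ x ℤ.* q → n ℤ.* ℤ.- y ≡ + 1 ℤ.+ q ℤ.* ℤ.- x
      sgn n y x q e = ≡.trans (lhs n y) (≡.trans (≡.cong (λ t → + 1 ℤ.- t) e) (rhs x q))
        where
        lhs : ∀ n y → n ℤ.* ℤ.- y ≡ + 1 ℤ.- (+ 1 ℤ.+ y ℤ.* n)
        lhs = solve-∀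
        rhs : ∀ x q → + 1 ℤ.- x ℤ.* q ≡ + 1 ℤ.+ q ℤ.* ℤ.- x
        rhs = solve-∀
    ... | ℕGCD.Bézout.-+ x y eq = + y , + x ,
      ≡.trans (ℤP.*-comm (+ n) (+ y)) (≡.trans (≡.sym (ℤP.pos-* y n)) (≡.trans (≡.cong +_ (≡.sym eq))
        (≡.cong (λ t → + 1 ℤ.+ t) (≡.trans (ℤP.pos-* x p) (ℤP.*-comm (+ x) (+ p))))))
    from-sign : (+ n ≡ c) ⊎ (+ n ≡ ℤ.- c) → ∃ λ d → ∃ λ t → c ℤ.* d ≡ + 1 ℤ.+ + p ℤ.* t
    from-sign (inj₁ e) = let (d , t , h) = natural in d , t , ≡.trans (≡.cong (ℤ._* d) (≡.sym e)) h
    from-sign (inj₂ e) = let (d , t , h) = natural in ℤ.- d , t ,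
      ≡.trans (≡.trans (≡.sym (ℤP.neg-distribʳ-* c d)) (ℤP.neg-distribˡ-* c d)) (≡.trans (≡.cong (ℤ._* d) (≡.sym e)) h)

  -- For x = z/c and c d = 1 + p t one has x = d z - p t x; the integer d z is then reduced modulo
  -- p.
  residue : ∀ {x} → Loc x → ∃ λ (r : Fin p) → ∃ λ k → Loc k × x ≈ ν (+ toℕ r) + ϖ * k
  residue {x} lx@(c , z , nc , h) =
    let (d , t , e) = inverse-mod-p nc
        m = d ℤ.* z
        q = m ℤDM./ℕ p
        r = m ℤDM.%ℕ p
        r<p = ℤDM.n%ℕd<d m p
    in F.fromℕ< r<p , ν q - ν t * x , Loc.P-sub (Loc.P-ν q) (Loc.P* (Loc.P-ν t) lx) , (begin
      x
        ≈⟨ isolate x ϖ (ν t) ⟩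
      (1# + ϖ * ν t) * x - ϖ * (ν t * x)
        ≈⟨ +-congʳ (*-congʳ (trans (+-cong (sym ν-1) (sym (ν-* (+ p) t))) (trans (sym (ν-+ _ _)) (trans (reflexive (≡.cong ν (≡.sym e))) (ν-* c d))))) ⟩
      ν c * ν d * x - ϖ * (ν t * x)
        ≈⟨ +-congʳ (trans (swap (ν c) (ν d) x) (trans (*-congˡ h) (sym (ν-* d z)))) ⟩
      ν m - ϖ * (ν t * x)
        ≈⟨ +-congʳ (trans (reflexive (≡.cong ν (ℤDM.a≡a%ℕn+[a/ℕn]*n m p))) (trans (ν-+ _ _) (+-congˡ (ν-* q (+ p))))) ⟩
      ν (+ r) + ν q * ϖ - ϖ * (ν t * x)
        ≈⟨ collect (ν (+ r)) (ν q) ϖ (ν t) x ⟩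
      ν (+ r) + ϖ * (ν q - ν t * x)
        ≈⟨ +-congʳ (reflexive (≡.cong (λ n → ν (+ n)) (≡.sym (FP.toℕ-fromℕ< r<p)))) ⟩
      ν (+ toℕ (F.fromℕ< r<p)) + ϖ * (ν q - ν t * x) ∎)
    where
    isolate : ∀ x ϖ t → x ≈ (1# + ϖ * t) * x - ϖ * (t * x)
    isolate = solve 3 (λ x ϖ t → x := (con (+ 1) :+ ϖ :* t) :* x :- ϖ :* (t :* x)) refl
    swap : ∀ c d x → c * d * x ≈ d * (c * x)
    swap = solve 3 (λ c d x → c :* d :* x := d :* (c :* x)) refl
    collect : ∀ r q ϖ t x → r + q * ϖ - ϖ * (t * x) ≈ r + ϖ * (q - t * x)
    collect = solve 5 (λ r q ϖ t x → r :+ q :* ϖ :- ϖ :* (t :* x) := r :+ ϖ :* (q :- t :* x)) refl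

  -- These depend on the chosen representation and not only on x. For the pigeonhole argument it
  -- matters that equal residues force a congruence.
  residues : ∀ G {x} → Lin Loc G x → Fin (length G) → Fin p
  residues (g ∷ G) (k , y , lk , l , h) zero    = proj₁ (residue lk)
  residues (g ∷ G) (k , y , lk , l , h) (suc i) = residues G l i

  equal-residues : ∀ G {x y} (l : Lin Loc G x) (l′ : Lin Loc G y) → (∀ i → residues G l i ≡ residues G l′ i) →
                   ∃ λ w → Lin Loc G w × x - y ≈ ϖ * w
  equal-residues [] l l′ e = 0# , refl , trans (x≈y⇒x-y≈0 (trans l (sym l′))) (sym (zeroʳ ϖ))
  equal-residues (g ∷ G) (k , y , lk , l , h) (k′ , y′ , lk′ , l′ , h′) e =
    let (r , a , la , f) = residue lk
        (r′ , a′ , la′ , f′) = residue lk′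
        (w , lw , f″) = equal-residues G l l′ (λ i → e (suc i))
        k-k′ = trans (+-cong f (-‿cong (trans f′ (+-congʳ (reflexive (≡.cong (λ s → ν (+ toℕ s)) (≡.sym (e zero))))))))
                     (cancel (ν (+ toℕ r)) ϖ a a′)
    in (a - a′) * g + w , (a - a′ , w , Loc.P-sub la la′ , lw , refl) ,
       trans (+-cong h (-‿cong h′)) (trans (regroup k g y k′ y′) (trans (+-cong (*-congʳ k-k′) f″) (factor ϖ (a - a′) g w)))
    where
    cancel : ∀ r ϖ a a′ → r + ϖ * a - (r + ϖ * a′) ≈ ϖ * (a - a′)
    cancel = solve 4 (λ r ϖ a a′ → r :+ ϖ :* a :- (r :+ ϖ :* a′) := ϖ :* (a :- a′)) refl
    regroup : ∀ k g y k′ y′ → k * g + y - (k′ * g + y′) ≈ (k - k′) * g + (y - y′)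
    regroup = solve 5 (λ k g y k′ y′ → k :* g :+ y :- (k′ :* g :+ y′) := (k :- k′) :* g :+ (y :- y′)) refl
    factor : ∀ ϖ b g w → ϖ * b * g + ϖ * w ≈ ϖ * (b * g + w)
    factor = solve 4 (λ ϖ b g w → ϖ :* b :* g :+ ϖ :* w := ϖ :* (b :* g :+ w)) refl

  module _ (O : Order) where
    open Order O

    -- The powers of a unit cannot all be distinct in the finite ring R/ϖR.
    unit-order-mod-ϖ : ∀ {x y} → R x → R y → x * y ≈ 1# → ∃ λ N → (pow x (suc N) - 1#) ∈ϖ^ 1
    unit-order-mod-ϖ {x} {y} rx ry xy = N , pow y i * w , P* (P-pow i ry) (Lin⊂R lw) , (begin
        pow x (suc N) - 1#
          ≈⟨ +-cong (sym (*-identityʳ _)) refl ⟩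
        pow x (suc N) * 1# - 1#
          ≈⟨ +-cong (*-congˡ (sym xyⁱ)) (-‿cong (sym xyⁱ)) ⟩
        pow x (suc N) * (pow x i * pow y i) - pow x i * pow y i
          ≈⟨ factor (pow x (suc N)) (pow x i) (pow y i) ⟩
        pow y i * (pow x (suc N) * pow x i - pow x i)
          ≈⟨ *-congˡ (+-congʳ (trans (sym (pow-+ x (suc N) i)) (reflexive (≡.cong (pow x) j≡)))) ⟩
        pow y i * (pow x j - pow x i)
          ≈⟨ *-congˡ ϖw ⟩
        pow y i * (ϖ * w)
          ≈⟨ swap (pow y i) ϖ w ⟩
        pow ϖ 1 * (pow y i * w) ∎)
      where
      n = length gens
      code : Fin (suc (p ℕ.^ n)) → Fin (p ℕ.^ n)
      code k = F.funToFin (residues gens (span (P-pow (toℕ k) rx)))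
      collision = FP.pigeonhole (ℕP.n<1+n (p ℕ.^ n)) code
      i = toℕ (proj₁ collision)
      j = toℕ (proj₁ (proj₂ collision))
      i<j : i ℕ.< j
      i<j = proj₁ (proj₂ (proj₂ collision))
      same : ∀ l → residues gens (span (P-pow j rx)) l ≡ residues gens (span (P-pow i rx)) l
      same l = ≡.trans (≡.sym (FP.finToFun-funToFin (residues gens (span (P-pow j rx))) l))
        (≡.trans (≡.cong (λ c → F.finToFun c l) (≡.sym (proj₂ (proj₂ (proj₂ collision)))))
                 (FP.finToFun-funToFin (residues gens (span (P-pow i rx))) l))
      -- Chosen such that `suc N` is the positive difference j - i.
      N = j ℕ.∸ suc i
      j≡ : suc N ℕ.+ i ≡ j
      j≡ = ≡.trans (≡.sym (ℕP.+-suc N i)) (ℕP.m∸n+n≡m i<j)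
      difference = equal-residues gens (span (P-pow j rx)) (span (P-pow i rx)) same
      w = proj₁ difference
      lw = proj₁ (proj₂ difference)
      ϖw : pow x j - pow x i ≈ ϖ * w
      ϖw = proj₂ (proj₂ difference)
      xyⁱ : pow x i * pow y i ≈ 1#
      xyⁱ = trans (sym (pow-distrib-* x y i)) (trans (pow-cong i xy) (pow-1# i))
      factor : ∀ a b c → a * (b * c) - b * c ≈ c * (a * b - b)
      factor = solve 3 (λ a b c → a :* (b :* c) :- b :* c := c :* (a :* b :- b)) refl
      swap : ∀ a ϖ w → a * (ϖ * w) ≈ ϖ * 1# * (a * w)
      swap = solve 3 (λ a ϖ w → a :* (ϖ :* w) := ϖ :* con (+ 1) :* (a :* w)) refl

    pow-≡1 : ∀ {M z} n → R z → (z - 1#) ∈ϖ^ M → (pow z n - 1#) ∈ϖ^ M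
    pow-≡1 {M} zero rz h = ∈ϖ^-resp {M} (sym (-‿inverseʳ 1#)) (∈ϖ^-0 {M})
    pow-≡1 {M} {z} (suc n) rz h = ∈ϖ^-resp {M} (telescope z (pow z n)) (∈ϖ^-+ {M} (∈ϖ^-* {M} rz (pow-≡1 {M} n rz h)) h)
      where
      telescope : ∀ z q → z * (q - 1#) + (z - 1#) ≈ z * q - 1#
      telescope = solve 2 (λ z q → z :* (q :- con (+ 1)) :+ (z :- con (+ 1)) := z :* q :- con (+ 1)) refl

    -- The linear term of the binomial expansion at 1 is kept apart, because for n = p it
    -- contributes a factor p.
    pow-1-factor : ∀ {z} n → R z → ∃ λ w → R w × pow z n - 1# ≈ (z - 1#) * (ν (+ n) + (z - 1#) * w)
    pow-1-factor {z} zero rz = 0# , P0 , trans (-‿inverseʳ 1#) (sym (trans (*-congˡ (trans (+-cong ν-0 (zeroʳ _)) (+-identityˡ _))) (zeroʳ _)))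
    pow-1-factor {z} (suc n) rz =
      let (w , rw , h) = pow-1-factor n rz in
      (ν (+ n) + z * w) , P+ (P-ν (+ n)) (P* rz rw) ,
      (begin
        z * pow z n - 1#                                                 ≈⟨ expand z (pow z n) ⟩
        z * (pow z n - 1#) + (z - 1#)                                    ≈⟨ +-congʳ (*-congˡ h) ⟩
        z * ((z - 1#) * (ν (+ n) + (z - 1#) * w)) + (z - 1#)             ≈⟨ collect z (ν (+ n)) w ⟩
        (z - 1#) * (1# + ν (+ n) + (z - 1#) * (ν (+ n) + z * w))         ≈⟨ *-congˡ (+-congʳ (sym (ν-suc n))) ⟩
        (z - 1#) * (ν (+ suc n) + (z - 1#) * (ν (+ n) + z * w))          ∎)
      where
      expand : ∀ z q → z * q - 1# ≈ z * (q - 1#) + (z - 1#)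
      expand = solve 2 (λ z q → z :* q :- con (+ 1) := z :* (q :- con (+ 1)) :+ (z :- con (+ 1))) refl
      collect : ∀ z n w → z * ((z - 1#) * (n + (z - 1#) * w)) + (z - 1#) ≈ (z - 1#) * (1# + n + (z - 1#) * (n + z * w))
      collect = solve 3 (λ z n w → z :* ((z :- con (+ 1)) :* (n :+ (z :- con (+ 1)) :* w)) :+ (z :- con (+ 1)) :=
                  (z :- con (+ 1)) :* (con (+ 1) :+ n :+ (z :- con (+ 1)) :* (n :+ z :* w))) refl

    -- Each p-th power multiplies z - 1 by p + (z - 1) w, a multiple of p since z ≡ 1 modulo p.
    pow-p^-≡1 : ∀ {z} → R z → (z - 1#) ∈ϖ^ 1 → ∀ M → (pow z (p ℕ.^ M) - 1#) ∈ϖ^ suc M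
    pow-p^-≡1 {z} rz h zero = ∈ϖ^-resp {1} (+-congʳ (sym (*-identityʳ z))) h
    pow-p^-≡1 {z} rz h (suc M) =
      let z′ = pow z (p ℕ.^ M)
          (x , rx , e) = pow-p^-≡1 rz h M
          (w , rw , f) = pow-1-factor {z′} p (P-pow (p ℕ.^ M) rz)
      in x * (1# + pow ϖ M * x * w) , P* rx (P+ P1 (P* (P* (P-pow M (P-ν (+ p))) rx) rw)) , (begin
        pow z (p ℕ.* p ℕ.^ M) - 1#                        ≈⟨ +-congʳ (pow-* z p (p ℕ.^ M)) ⟩
        pow z′ p - 1#                                     ≈⟨ f ⟩
        (z′ - 1#) * (ϖ + (z′ - 1#) * w)                   ≈⟨ *-cong e (+-congˡ (*-congʳ e)) ⟩
        ϖ * pow ϖ M * x * (ϖ + ϖ * pow ϖ M * x * w)       ≈⟨ collect ϖ (pow ϖ M) x w ⟩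
        ϖ * (ϖ * pow ϖ M) * (x * (1# + pow ϖ M * x * w))  ∎)
      where
      collect : ∀ ϖ q x w → ϖ * q * x * (ϖ + ϖ * q * x * w) ≈ ϖ * (ϖ * q) * (x * (1# + q * x * w))
      collect = solve 4 (λ ϖ q x w → ϖ :* q :* x :* (ϖ :+ ϖ :* q :* x :* w) := ϖ :* (ϖ :* q) :* (x :* (con (+ 1) :+ q :* x :* w))) refl

    ∈ϖ^-pred : ∀ {M x} → x ∈ϖ^ suc M → x ∈ϖ^ M
    ∈ϖ^-pred {M} (z , rz , h) = ϖ * z , P* (P-ν (+ p)) rz , trans h (swap ϖ (pow ϖ M) z)
      where
      swap : ∀ ϖ q z → ϖ * q * z ≈ q * (ϖ * z)
      swap = solve 3 (λ ϖ q z → ϖ :* q :* z := q :* (ϖ :* z)) refl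

    -- The equation c + x q = 0 with c invertible exhibits the inverse of x. Through this lemma
    -- regularity of p at the constant coefficient takes effect.
    root-unit : ∀ {c c′ cs x} → All R (c ∷ cs) → R c′ → c * c′ ≈ 1# → R x → meval (c ∷ cs) x ≈ 0# → ∃ λ y → R y × x * y ≈ 1#
    root-unit {c} {c′} {cs} {x} (rc ∷ rcs) rc′ cc′ rx h =
      - (c′ * meval cs x) , P- (P* rc′ (resp (meval-as-eval cs x) (P-eval R-subring (AllP.++⁺ rcs (P1 ∷ [])) rx))) ,
      (begin
        x * - (c′ * meval cs x)                        ≈⟨ expand x c c′ (meval cs x) ⟩
        c * c′ - c′ * (c + x * meval cs x)             ≈⟨ +-cong cc′ (-‿cong (trans (*-congˡ h) (zeroʳ c′))) ⟩
        1# - 0#                                        ≈⟨ trans (+-congˡ -0#≈0#) (+-identityʳ 1#) ⟩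
        1#                                             ∎)
      where
      expand : ∀ x c c′ m → x * - (c′ * m) ≈ c * c′ - c′ * (c + x * m)
      expand = solve 4 (λ x c c′ m → x :* (:- (c′ :* m)) := c :* c′ :- c′ :* (c :+ x :* m)) refl

  -- Products over roots of unity

  ∏-cong : ∀ rs {φ ψ} → (∀ r → φ r ≈ ψ r) → ∏ rs φ ≈ ∏ rs ψ
  ∏-cong []       e = refl
  ∏-cong (r ∷ rs) e = *-cong (e r) (∏-cong rs e)

  ∏-* : ∀ rs φ ψ → ∏ rs (λ r → φ r * ψ r) ≈ ∏ rs φ * ∏ rs ψ
  ∏-* []       φ ψ = sym (*-identityˡ 1#)
  ∏-* (r ∷ rs) φ ψ = trans (*-congˡ (∏-* rs φ ψ)) (swap (φ r) (ψ r) (∏ rs φ) (∏ rs ψ))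
    where
    swap : ∀ a b c d → a * b * (c * d) ≈ a * c * (b * d)
    swap = solve 4 (λ a b c d → a :* b :* (c :* d) := a :* c :* (b :* d)) refl

  ∏-1 : ∀ rs → ∏ rs (λ _ → 1#) ≈ 1#
  ∏-1 []       = refl
  ∏-1 (r ∷ rs) = trans (*-identityˡ _) (∏-1 rs)

  ∏-swap : ∀ rs qs (φ : Carrier → Carrier → Carrier) → ∏ rs (λ r → ∏ qs (φ r)) ≈ ∏ qs (λ q → ∏ rs (λ r → φ r q))
  ∏-swap []       qs φ = sym (∏-1 qs)
  ∏-swap (r ∷ rs) qs φ = trans (*-congˡ (∏-swap rs qs φ)) (sym (∏-* qs (φ r) _))

  ∏∏ : List Carrier → ∀ s → ((Fin s → Carrier) → Carrier) → Carrier
  ∏∏ rs zero    φ = φ (λ ())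
  ∏∏ rs (suc s) φ = ∏ rs (λ r → ∏∏ rs s (λ ξ → φ (r VF.∷ ξ)))

  ∏∏-cong : ∀ rs s {φ ψ} → (∀ ξ → φ ξ ≈ ψ ξ) → ∏∏ rs s φ ≈ ∏∏ rs s ψ
  ∏∏-cong rs zero    e = e _
  ∏∏-cong rs (suc s) e = ∏-cong rs (λ r → ∏∏-cong rs s (λ ξ → e (r VF.∷ ξ)))

  ∏-∏∏-swap : ∀ rs qs s (φ : Carrier → (Fin s → Carrier) → Carrier) →
              ∏ rs (λ r → ∏∏ qs s (φ r)) ≈ ∏∏ qs s (λ ξ → ∏ rs (λ r → φ r ξ))
  ∏-∏∏-swap rs qs zero    φ = refl
  ∏-∏∏-swap rs qs (suc s) φ = trans (∏-swap rs qs (λ r q → ∏∏ qs s (λ ξ → φ r (q VF.∷ ξ))))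
    (∏-cong qs (λ q → ∏-∏∏-swap rs qs s (λ r ξ → φ r (q VF.∷ ξ))))

  module _ {Q : Carrier → Set} where

    decide-∏∏ : ∀ {rs} → All Q rs → ∀ s (φ : (Fin s → Carrier) → Carrier) →
      (∀ ξ → (∀ i → Q (ξ i)) → (φ ξ ≈ 0#) ⊎ (¬ φ ξ ≈ 0#)) →
      (∃ λ ξ → (∀ i → Q (ξ i)) × φ ξ ≈ 0#) ⊎ (¬ ∏∏ rs s φ ≈ 0#)
    decide-∏∏ {rs} qs zero φ dec with dec (λ ()) (λ ())
    ... | inj₁ z  = inj₁ ((λ ()) , (λ ()) , z)
    ... | inj₂ nz = inj₂ nz
    decide-∏∏ {rs} qs (suc s) φ dec = go qs
      where
      go : ∀ {rs′} → All Q rs′ → (∃ λ ξ → (∀ i → Q (ξ i)) × φ ξ ≈ 0#) ⊎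
             (¬ ∏ rs′ (λ r → ∏∏ rs s (λ ξ → φ (r VF.∷ ξ))) ≈ 0#)
      go [] = inj₂ 1≉0
      go {r ∷ _} (q ∷ qs′) with decide-∏∏ qs s (λ ξ → φ (r VF.∷ ξ)) (λ ξ qξ → dec (r VF.∷ ξ) (λ { zero → q ; (suc i) → qξ i })) | go qs′
      ... | inj₁ (ξ , qξ , z) | _ = inj₁ (r VF.∷ ξ , (λ { zero → q ; (suc i) → qξ i }) , z)
      ... | inj₂ nz | inj₁ x = inj₁ x
      ... | inj₂ nz | inj₂ nz′ = inj₂ (*-≉0 nz nz′)

  -- Built with `VF.∷`, so that it agrees definitionally with the tuple that `∏∏` forms when the
  -- head 1 is taken in every coordinate.
  ones : ∀ s → Fin s → Carrier
  ones zero    = λ ()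
  ones (suc s) = 1# VF.∷ ones s

  linear-form : ∀ s → (Fin s → Carrier) → (Fin s → Carrier) → Carrier
  linear-form s X ξ = sum s (λ i → ξ i * X i)

  linear-form-ones : ∀ s X → linear-form s X (ones s) ≈ sum s X
  linear-form-ones zero    X = refl
  linear-form-ones (suc s) X = +-cong (*-identityˡ _) (linear-form-ones s (λ i → X (suc i)))

  -- Congruences between products of twisted sums

  module _ (O : Order) (M : ℕ) where
    open Order O

    infix 4 _≡ₘ_
    _≡ₘ_ : Carrier → Carrier → Set
    x ≡ₘ y = (x - y) ∈ϖ^ M

    ≈⇒≡ₘ : ∀ {x y} → x ≈ y → x ≡ₘ y
    ≈⇒≡ₘ e = ∈ϖ^-resp {M} (sym (x≈y⇒x-y≈0 e)) (∈ϖ^-0 {M})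

    ≡ₘ-trans : ∀ {x y z} → x ≡ₘ y → y ≡ₘ z → x ≡ₘ z
    ≡ₘ-trans {x} {y} {z} h h′ = ∈ϖ^-resp {M} (telescope x y z) (∈ϖ^-+ {M} h h′)
      where
      telescope : ∀ x y z → x - y + (y - z) ≈ x - z
      telescope = solve 3 (λ x y z → x :- y :+ (y :- z) := x :- z) refl

    ≡ₘ-* : ∀ {x x′ y y′} → R x → R y′ → x ≡ₘ x′ → y ≡ₘ y′ → (x * y) ≡ₘ (x′ * y′)
    ≡ₘ-* {x} {x′} {y} {y′} rx ry′ h h′ = ∈ϖ^-resp {M} (expand x x′ y y′) (∈ϖ^-+ {M} (∈ϖ^-* {M} rx h′) (∈ϖ^-* {M} ry′ h))
      where
      expand : ∀ x x′ y y′ → x * (y - y′) + y′ * (x - x′) ≈ x * y - x′ * y′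
      expand = solve 4 (λ x x′ y y′ → x :* (y :- y′) :+ y′ :* (x :- x′) := x :* y :- x′ :* y′) refl

    R-∏ : ∀ {rs φ} → All R rs → (∀ r → R r → R (φ r)) → R (∏ rs φ)
    R-∏ []         h = P1
    R-∏ (rr ∷ rrs) h = P* (h _ rr) (R-∏ rrs h)

    R-∏∏ : ∀ {rs} s {φ : (Fin s → Carrier) → Carrier} → All R rs → (∀ ξ → (∀ i → R (ξ i)) → R (φ ξ)) → R (∏∏ rs s φ)
    R-∏∏ zero    rrs h = h _ (λ ())
    R-∏∏ (suc s) rrs h = R-∏ rrs (λ r rr → R-∏∏ s rrs (λ ξ rξ → h _ (λ { zero → rr ; (suc i) → rξ i })))

    ∏-≡ₘ : ∀ {rs φ ψ} → All R rs → (∀ r → R r → R (φ r)) → (∀ r → R r → R (ψ r)) → (∀ r → R r → φ r ≡ₘ ψ r) → ∏ rs φ ≡ₘ ∏ rs ψ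
    ∏-≡ₘ []         hφ hψ h = ≈⇒≡ₘ refl
    ∏-≡ₘ (rr ∷ rrs) hφ hψ h = ≡ₘ-* (hφ _ rr) (R-∏ rrs hψ) (h _ rr) (∏-≡ₘ rrs hφ hψ h)

    ∏∏-≡ₘ : ∀ {rs} s {φ ψ : (Fin s → Carrier) → Carrier} → All R rs → (∀ ξ → (∀ i → R (ξ i)) → R (φ ξ)) →
      (∀ ξ → (∀ i → R (ξ i)) → R (ψ ξ)) → (∀ ξ → (∀ i → R (ξ i)) → φ ξ ≡ₘ ψ ξ) → ∏∏ rs s φ ≡ₘ ∏∏ rs s ψ
    ∏∏-≡ₘ zero    rrs hφ hψ h = h _ (λ ())
    ∏∏-≡ₘ (suc s) rrs hφ hψ h = ∏-≡ₘ rrs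
      (λ r rr → R-∏∏ s rrs (λ ξ rξ → hφ _ (cons r rr ξ rξ)))
      (λ r rr → R-∏∏ s rrs (λ ξ rξ → hψ _ (cons r rr ξ rξ)))
      (λ r rr → ∏∏-≡ₘ s rrs (λ ξ rξ → hφ _ (cons r rr ξ rξ)) (λ ξ rξ → hψ _ (cons r rr ξ rξ)) (λ ξ rξ → h _ (cons r rr ξ rξ)))
      where
      cons : ∀ r → R r → ∀ (ξ : Fin s → Carrier) → (∀ i → R (ξ i)) → ∀ i → R ((r VF.∷ ξ) i)
      cons r rr ξ rξ zero    = rr
      cons r rr ξ rξ (suc i) = rξ i

    -- With 1 at the head of the list, the untwisted sum is literally one of the factors; the
    -- remaining ones lie in R.
    ∏∏-∈ϖ^ : ∀ {rs} s {φ : (Fin s → Carrier) → Carrier} → All R rs → (∀ ξ → (∀ i → R (ξ i)) → R (φ ξ)) →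
      φ (ones s) ∈ϖ^ M → ∏∏ (1# ∷ rs) s φ ∈ϖ^ M
    ∏∏-∈ϖ^ zero    rrs hφ h = h
    ∏∏-∈ϖ^ (suc s) {φ} rrs hφ h = ∈ϖ^-resp {M} (*-comm _ _) (∈ϖ^-* {M}
      (R-∏ rrs (λ r rr → R-∏∏ s (P1 ∷ rrs) (λ ξ rξ → hφ _ (λ { zero → rr ; (suc i) → rξ i }))))
      (∏∏-∈ϖ^ s {λ ξ → φ (1# VF.∷ ξ)} rrs (λ ξ rξ → hφ _ (λ { zero → P1 ; (suc i) → rξ i })) h))

    R-linear-form : ∀ s {X ξ} → (∀ i → R (X i)) → (∀ i → R (ξ i)) → R (linear-form s X ξ)
    R-linear-form s rX rξ = P-sum s (λ i → P* (rξ i) (rX i))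

    module _ {rs : List Carrier} {N : ℕ} (rs∈R : All R rs) (splits : ∀ A B → pow A N - pow B N ≈ ∏ rs (λ r → A - r * B)) where

      ∏-twist : ∀ {A B y} → R B → (pow y N - 1#) ∈ϖ^ M → ∏ rs (λ r → A + r * (y * B)) ≡ₘ ∏ rs (λ r → A + r * B)
      ∏-twist {A} {B} {y} rB hy = ∈ϖ^-resp {M} (begin
          - pow (- B) N * (pow y N - 1#)
            ≈⟨ expand (pow A N) (pow (- B) N) (pow y N) ⟩
          (pow A N - pow y N * pow (- B) N) - (pow A N - pow (- B) N)
            ≈⟨ +-cong (+-congˡ (-‿cong (trans (pow-cong N (-‿distribʳ-* y B)) (pow-distrib-* y (- B) N)))) refl ⟨
          (pow A N - pow (- (y * B)) N) - (pow A N - pow (- B) N)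
            ≈⟨ +-cong (form (y * B)) (-‿cong (form B)) ⟩
          ∏ rs (λ r → A + r * (y * B)) - ∏ rs (λ r → A + r * B) ∎)
        (∈ϖ^-* {M} (P- (P-pow N (P- rB))) hy)
        where
        expand : ∀ a b y → - b * (y - 1#) ≈ (a - y * b) - (a - b)
        expand = solve 3 (λ a b y → (:- b) :* (y :- con (+ 1)) := (a :- y :* b) :- (a :- b)) refl
        sign : ∀ A r B → A - r * (- B) ≈ A + r * B
        sign = solve 3 (λ A r B → A :- r :* (:- B) := A :+ r :* B) refl
        form : ∀ B → pow A N - pow (- B) N ≈ ∏ rs (λ r → A + r * B)
        form B = trans (splits A (- B)) (∏-cong rs (λ r → sign A r B))

      -- As ∏ (A + r B) = A^N - (-B)^N over the N-th roots of unity r, the product of all twists of a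
      -- linear form depends on its coefficients only through their N-th powers.
      ∏∏-twist : ∀ s (X y : Fin s → Carrier) → (∀ i → R (X i)) → (∀ i → R (y i)) → (∀ i → (pow (y i) N - 1#) ∈ϖ^ M) →
        ∀ {A} → R A → ∏∏ rs s (λ ξ → A + linear-form s (λ i → y i * X i) ξ) ≡ₘ ∏∏ rs s (λ ξ → A + linear-form s X ξ)
      ∏∏-twist zero    X y rX ry hy rA = ≈⇒≡ₘ refl
      -- `A` collects the terms of the coordinates already fixed. The tail is untwisted by induction
      -- (`e₁`); then exchanging the products (`e₂`) puts the head coordinate innermost, where
      -- `∏-twist` applies (`e₃`).
      ∏∏-twist (suc s) X y rX ry hy {A} rA =
        ≡ₘ-trans {w₀} {w₁} {w₅} (≈⇒≡ₘ e₀) (≡ₘ-trans {w₁} {w₂} {w₅} e₁ (≡ₘ-trans {w₂} {w₃} {w₅} (≈⇒≡ₘ e₂)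
          (≡ₘ-trans {w₃} {w₄} {w₅} e₃ (≈⇒≡ₘ e₄))))
        where
        X′ yX′ : Fin s → Carrier
        X′ i = X (suc i)
        yX′ i = y (suc i) * X (suc i)
        B yB : Carrier
        B = X zero
        yB = y zero * B
        ℓ ℓy : (Fin s → Carrier) → Carrier
        ℓ = linear-form s X′
        ℓy = linear-form s yX′
        w₀ w₁ w₂ w₃ w₄ w₅ : Carrier
        w₀ = ∏ rs (λ r → ∏∏ rs s (λ ξ → A + (r * yB + ℓy ξ)))
        w₁ = ∏ rs (λ r → ∏∏ rs s (λ ξ → (A + r * yB) + ℓy ξ))
        w₂ = ∏ rs (λ r → ∏∏ rs s (λ ξ → (A + r * yB) + ℓ ξ))
        w₃ = ∏∏ rs s (λ ξ → ∏ rs (λ r → (A + ℓ ξ) + r * yB))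
        w₄ = ∏∏ rs s (λ ξ → ∏ rs (λ r → (A + ℓ ξ) + r * B))
        w₅ = ∏ rs (λ r → ∏∏ rs s (λ ξ → A + (r * B + ℓ ξ)))
        rX′ : ∀ i → R (X′ i)
        rX′ i = rX (suc i)
        ryX′ : ∀ i → R (yX′ i)
        ryX′ i = P* (ry (suc i)) (rX (suc i))
        ryB : R yB
        ryB = P* (ry zero) (rX zero)
        e₀ : w₀ ≈ w₁
        e₀ = ∏-cong rs (λ r → ∏∏-cong rs s (λ ξ → sym (+-assoc A (r * yB) (ℓy ξ))))
        e₁ : w₁ ≡ₘ w₂
        e₁ = ∏-≡ₘ {rs} {λ r → ∏∏ rs s (λ ξ → (A + r * yB) + ℓy ξ)} {λ r → ∏∏ rs s (λ ξ → (A + r * yB) + ℓ ξ)} rs∈R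
          (λ r rr → R-∏∏ s rs∈R (λ ξ rξ → P+ (P+ rA (P* rr ryB)) (R-linear-form s ryX′ rξ)))
          (λ r rr → R-∏∏ s rs∈R (λ ξ rξ → P+ (P+ rA (P* rr ryB)) (R-linear-form s rX′ rξ)))
          (λ r rr → ∏∏-twist s X′ (λ i → y (suc i)) rX′ (λ i → ry (suc i)) (λ i → hy (suc i)) {A + r * yB} (P+ rA (P* rr ryB)))
        e₂ : w₂ ≈ w₃
        e₂ = trans (∏-∏∏-swap rs rs s (λ r ξ → (A + r * yB) + ℓ ξ))
                   (∏∏-cong rs s (λ ξ → ∏-cong rs (λ r → commute A (r * yB) (ℓ ξ))))
          where
          commute : ∀ a b c → a + b + c ≈ a + c + b
          commute = solve 3 (λ a b c → a :+ b :+ c := a :+ c :+ b) refl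
        e₃ : w₃ ≡ₘ w₄
        e₃ = ∏∏-≡ₘ {rs} s {λ ξ → ∏ rs (λ r → (A + ℓ ξ) + r * yB)} {λ ξ → ∏ rs (λ r → (A + ℓ ξ) + r * B)} rs∈R
          (λ ξ rξ → R-∏ rs∈R (λ r rr → P+ (P+ rA (R-linear-form s rX′ rξ)) (P* rr ryB)))
          (λ ξ rξ → R-∏ rs∈R (λ r rr → P+ (P+ rA (R-linear-form s rX′ rξ)) (P* rr (rX zero))))
          (λ ξ rξ → ∏-twist {A + ℓ ξ} {B} {y zero} (rX zero) (hy zero))
        e₄ : w₄ ≈ w₅
        e₄ = trans (sym (∏-∏∏-swap rs rs s (λ r ξ → (A + ℓ ξ) + r * B)))
                   (∏-cong rs (λ r → ∏∏-cong rs s (λ ξ → regroup A (ℓ ξ) (r * B))))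
          where
          regroup : ∀ a b c → a + b + c ≈ a + (c + b)
          regroup = solve 3 (λ a b c → a :+ b :+ c := a :+ (c :+ b)) refl

  -- X^(n+1) - 1; the shift keeps the exponent positive.
  X^-1 : ℕ → List Carrier
  X^-1 n = - 1# ∷ L.replicate n 0#

  hmeval-X^-1 : ∀ n A B → hmeval (X^-1 n) A B ≈ pow A (suc n) - pow B (suc n)
  hmeval-X^-1 n A B = trans (+-cong (*-congˡ (*-congˡ (reflexive (≡.cong (pow B) (LP.length-replicate n))))) (*-congˡ (zeros n)))
                            (arrange (A * pow A n) (B * pow B n))
    where
    arrange : ∀ a b → - 1# * b + a ≈ a - b
    arrange = solve 2 (λ a b → (:- con (+ 1)) :* b :+ a := a :- b) refl
    zeros : ∀ n → hmeval (L.replicate n 0#) A B ≈ pow A n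
    zeros zero    = refl
    zeros (suc n) = trans (+-cong (zeroˡ _) (*-congˡ (zeros n))) (+-identityˡ _)

  meval-X^-1 : ∀ n x → meval (X^-1 n) x ≈ pow x (suc n) - 1#
  meval-X^-1 n x = trans (sym (hmeval-1 (X^-1 n) x)) (trans (hmeval-X^-1 n x 1#) (+-congˡ (-‿cong (pow-1# (suc n)))))

  Loc-X^-1 : ∀ n → All Loc (X^-1 n)
  Loc-X^-1 n = Loc.P- Loc.P1 ∷ AllP.replicate⁺ n Loc.P0

  -- The root 1 is split off by hand, because in K one cannot tell which root of X^N - 1 equals 1.
  abstract
    unit-roots : ∀ n → ∃ λ rs → All (λ r → meval (X^-1 n) r ≈ 0#) (1# ∷ rs) ×
                 (∀ A B → pow A (suc n) - pow B (suc n) ≈ ∏ (1# ∷ rs) (λ r → A - r * B))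
    unit-roots n =
      let (rs , s) = split-monic (quotient 1# (X^-1 n))
          (roots , splits) = Splits-∷ 1# (- 1#) (L.replicate n 0#) (trans (meval-X^-1 n 1#) (x≈y⇒x-y≈0 (pow-1# (suc n)))) s
      in rs , roots , λ A B → trans (sym (hmeval-X^-1 n A B)) (splits A B)

  -- Deciding equality of roots of unity

  geom : Carrier → ℕ → Carrier
  geom η zero    = 0#
  geom η (suc n) = 1# + η * geom η n

  geom-telescope : ∀ η n → (η - 1#) * geom η n ≈ pow η n - 1#
  geom-telescope η zero    = trans (zeroʳ _) (sym (-‿inverseʳ 1#))
  geom-telescope η (suc n) = trans (expand η (geom η n)) (trans (+-congʳ (*-congˡ (geom-telescope η n))) (collect η (pow η n)))
    where
    expand : ∀ η g → (η - 1#) * (1# + η * g) ≈ η * ((η - 1#) * g) + (η - 1#)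
    expand = solve 2 (λ η g → (η :- con (+ 1)) :* (con (+ 1) :+ η :* g) := η :* ((η :- con (+ 1)) :* g) :+ (η :- con (+ 1))) refl
    collect : ∀ η q → η * (q - 1#) + (η - 1#) ≈ η * q - 1#
    collect = solve 2 (λ η q → η :* (q :- con (+ 1)) :+ (η :- con (+ 1)) := η :* q :- con (+ 1)) refl

  -- Each of the n powers of η fixes x. Applied to the geometric sum itself it gives idempotency,
  -- applied to 1 the value of the sum at η = 1.
  geom-fixed : ∀ η x → η * x ≈ x → ∀ n → geom η n * x ≈ ν (+ n) * x
  geom-fixed η x e zero    = *-congʳ (sym ν-0)
  geom-fixed η x e (suc n) = begin
    (1# + η * geom η n) * x       ≈⟨ expand η (geom η n) x ⟩
    x + η * (geom η n * x)        ≈⟨ +-congˡ (*-congˡ (geom-fixed η x e n)) ⟩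
    x + η * (ν (+ n) * x)         ≈⟨ +-congˡ (trans (swap η (ν (+ n)) x) (*-congˡ e)) ⟩
    x + ν (+ n) * x               ≈⟨ collect x (ν (+ n)) ⟩
    (1# + ν (+ n)) * x            ≈⟨ *-congʳ (sym (ν-suc n)) ⟩
    ν (+ suc n) * x               ∎
    where
    expand : ∀ η g x → (1# + η * g) * x ≈ x + η * (g * x)
    expand = solve 3 (λ η g x → (con (+ 1) :+ η :* g) :* x := x :+ η :* (g :* x)) refl
    swap : ∀ a b c → a * (b * c) ≈ b * (a * c)
    swap = solve 3 (λ a b c → a :* (b :* c) := b :* (a :* c)) refl
    collect : ∀ x n → x + n * x ≈ (1# + n) * x
    collect = solve 2 (λ x n → x :+ n :* x := (con (+ 1) :+ n) :* x) refl

  -- From e (1 - e) ≈ 0 one cannot select a vanishing factor constructively, so this expresses a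
  -- genuine amount of decidability in K.
  DecidableIdempotents : Set
  DecidableIdempotents = ∀ e → e * e ≈ e → (e ≈ 0#) ⊎ (e ≈ 1#)

  -- For η^N = 1 the average of the powers of η is an idempotent, which is 1 if and only if η = 1.
  decide-≈1 : DecidableIdempotents → ∀ n η → pow η (suc n) ≈ 1# → Dec (η ≈ 1#)
  decide-≈1 dec n η hη = conclude (dec e idempotent)
    where
    N = ν (+ suc n)
    i = inv N (ν≉0 (λ ()))
    Ni : N * i ≈ 1#
    Ni = inv-r N _
    g = geom η (suc n)
    e = i * g
    killed : (η - 1#) * g ≈ 0#
    killed = trans (geom-telescope η (suc n)) (x≈y⇒x-y≈0 hη)
    fixed : η * g ≈ g
    fixed = x-y≈0⇒x≈y (trans (factor η g) killed)
      where
      factor : ∀ η g → η * g - g ≈ (η - 1#) * g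
      factor = solve 2 (λ η g → η :* g :- g := (η :- con (+ 1)) :* g) refl
    idempotent : e * e ≈ e
    idempotent = trans (swap i g) (trans (*-congˡ (*-congˡ (geom-fixed η g fixed (suc n)))) (trans (swap′ i N g) (trans (*-congʳ Ni) (*-identityˡ e))))
      where
      swap : ∀ i g → i * g * (i * g) ≈ i * (i * (g * g))
      swap = solve 2 (λ i g → i :* g :* (i :* g) := i :* (i :* (g :* g))) refl
      swap′ : ∀ i N g → i * (i * (N * g)) ≈ N * i * (i * g)
      swap′ = solve 3 (λ i N g → i :* (i :* (N :* g)) := N :* i :* (i :* g)) refl
    conclude : (e ≈ 0#) ⊎ (e ≈ 1#) → Dec (η ≈ 1#)
    conclude (inj₁ e≈0) = no λ η≈1 → ν≉0 {+ suc n} (λ ()) (begin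
      N                 ≈⟨ *-identityʳ N ⟨
      N * 1#            ≈⟨ geom-fixed η 1# (trans (*-identityʳ η) η≈1) (suc n) ⟨
      g * 1#            ≈⟨ *-identityʳ g ⟩
      g                 ≈⟨ trans (*-congʳ Ni) (*-identityˡ g) ⟨
      N * i * g         ≈⟨ *-assoc N i g ⟩
      N * e             ≈⟨ trans (*-congˡ e≈0) (zeroʳ N) ⟩
      0#                ∎)
    conclude (inj₂ e≈1) = yes (x-y≈0⇒x≈y (begin
      η - 1#              ≈⟨ trans (*-congˡ e≈1) (*-identityʳ _) ⟨
      (η - 1#) * (i * g)  ≈⟨ swap (η - 1#) i g ⟩
      i * ((η - 1#) * g)  ≈⟨ trans (*-congˡ killed) (zeroʳ i) ⟩
      0#                  ∎))
      where
      swap : ∀ a b c → a * (b * c) ≈ b * (a * c)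
      swap = solve 3 (λ a b c → a :* (b :* c) := b :* (a :* c)) refl

  -- δ^n is the inverse of δ, which reduces the question to whether θ/δ is 1.
  decide-unit-roots : DecidableIdempotents → ∀ n θ δ → pow θ (suc n) ≈ 1# → pow δ (suc n) ≈ 1# → Dec (θ ≈ δ)
  decide-unit-roots dec n θ δ hθ hδ = conclude (decide-≈1 dec n (θ * pow δ n) η^N)
    where
    pow-comm : pow (pow δ n) (suc n) ≈ 1#
    pow-comm = begin
      pow (pow δ n) (suc n)    ≈⟨ pow-* δ (suc n) n ⟨
      pow δ (suc n ℕ.* n)      ≈⟨ reflexive (≡.cong (pow δ) (ℕP.*-comm (suc n) n)) ⟩
      pow δ (n ℕ.* suc n)      ≈⟨ pow-* δ n (suc n) ⟩
      pow (pow δ (suc n)) n    ≈⟨ pow-cong n hδ ⟩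
      pow 1# n                 ≈⟨ pow-1# n ⟩
      1#                       ∎
    η^N : pow (θ * pow δ n) (suc n) ≈ 1#
    η^N = trans (pow-distrib-* θ (pow δ n) (suc n)) (trans (*-cong hθ pow-comm) (*-identityˡ 1#))
    swap : ∀ a b c → a * (b * c) ≈ b * (a * c)
    swap = solve 3 (λ a b c → a :* (b :* c) := b :* (a :* c)) refl
    conclude : Dec (θ * pow δ n ≈ 1#) → Dec (θ ≈ δ)
    conclude (yes e) = yes (begin
      θ                        ≈⟨ trans (*-congˡ hδ) (*-identityʳ θ) ⟨
      θ * (δ * pow δ n)        ≈⟨ swap θ δ (pow δ n) ⟩
      δ * (θ * pow δ n)        ≈⟨ trans (*-congˡ e) (*-identityʳ δ) ⟩
      δ                        ∎)
    conclude (no ne) = no λ e → ne (trans (*-congʳ e) hδ)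

  -- Idempotents and congruences

  -- Transfers an inverse found inside an order to the field inverse on which `zpow` is built.
  inv-unique : ∀ {x y} nz → x * y ≈ 1# → inv x nz ≈ y
  inv-unique {x} {y} nz e = begin
    inv x nz               ≈⟨ trans (*-congˡ e) (*-identityʳ _) ⟨
    inv x nz * (x * y)     ≈⟨ swap (inv x nz) x y ⟩
    (x * inv x nz) * y     ≈⟨ trans (*-congʳ (inv-r x nz)) (*-identityˡ y) ⟩
    y                      ∎
    where
    swap : ∀ i x y → i * (x * y) ≈ x * i * y
    swap = solve 3 (λ i x y → i :* (x :* y) := x :* i :* y) refl

  -- The orthogonal idempotents e and 1 - e let a polynomial act componentwise; the cross terms
  -- carry the factor e² - e.
  meval-idempotent : ∀ {e} → e * e ≈ e → ∀ cs x y →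
    meval cs (e * x + (1# - e) * y) ≈ e * meval cs x + (1# - e) * meval cs y
  meval-idempotent {e} h []       x y = base e
    where
    base : ∀ e → 1# ≈ e * 1# + (1# - e) * 1#
    base = solve 1 (λ e → con (+ 1) := e :* con (+ 1) :+ (con (+ 1) :- e) :* con (+ 1)) refl
  meval-idempotent {e} h (c ∷ cs) x y =
    trans (+-congˡ (*-congˡ (meval-idempotent h cs x y)))
    (trans (expand e c x y (meval cs x) (meval cs y))
    (trans (+-congˡ (trans (*-congʳ (x≈y⇒x-y≈0 h)) (zeroˡ _))) (+-identityʳ _)))
    where
    expand : ∀ e c x y m n → c + (e * x + (1# - e) * y) * (e * m + (1# - e) * n) ≈
      e * (c + x * m) + (1# - e) * (c + y * n) + (e * e - e) * (x * m - x * n - y * m + y * n)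
    expand = solve 6 (λ e c x y m n → c :+ (e :* x :+ (con (+ 1) :- e) :* y) :* (e :* m :+ (con (+ 1) :- e) :* n) :=
      e :* (c :+ x :* m) :+ (con (+ 1) :- e) :* (c :+ y :* n) :+ (e :* e :- e) :* (x :* m :- x :* n :- y :* m :+ y :* n)) refl

  -- An idempotent e yields the root e l₀ + (1 - e) l₁; e is read off from its place in the list of roots.
  decidable-idempotents : ∀ {s} cs (l : Fin (suc (suc s)) → Carrier) → (∀ i → meval cs (l i) ≈ 0#) →
    (∀ i j → l i ≈ l j → i ≡ j) → (∀ x → meval cs x ≈ 0# → ∃ λ i → x ≈ l i) → DecidableIdempotents
  decidable-idempotents cs l roots distinct all e h = locate (all x x-root)
    where
    l₀ = l zero
    l₁ = l (suc zero)
    x = e * l₀ + (1# - e) * l₁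
    x-root : meval cs x ≈ 0#
    x-root = trans (meval-idempotent h cs l₀ l₁) (trans (+-cong (trans (*-congˡ (roots zero)) (zeroʳ e))
               (trans (*-congˡ (roots (suc zero))) (zeroʳ _))) (+-identityʳ 0#))
    separated : ∀ i j → i ≢ j → ¬ l i - l j ≈ 0#
    separated i j ne z = ne (distinct i j (x-y≈0⇒x≈y z))
    locate : (∃ λ i → x ≈ l i) → (e ≈ 0#) ⊎ (e ≈ 1#)
    locate (zero , q) = inj₂ (sym (x-y≈0⇒x≈y (cancel-≉0 (separated (suc zero) zero (λ ()))
      (trans (identity e l₀ l₁) (x≈y⇒x-y≈0 q)))))
      where
      identity : ∀ e a b → (b - a) * (1# - e) ≈ (e * a + (1# - e) * b) - a
      identity = solve 3 (λ e a b → (b :- a) :* (con (+ 1) :- e) := (e :* a :+ (con (+ 1) :- e) :* b) :- a) refl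
    -- Multiplying x ≈ l_j by e removes l₁ and leaves e l₀ ≈ e l_j with j ≠ 0; this treats l₁ and
    -- all later roots alike.
    locate (suc i , q) = inj₁ (cancel-≉0 (separated zero (suc i) (λ ())) (begin
      (l₀ - l (suc i)) * e                                  ≈⟨ identity e l₀ l₁ (l (suc i)) ⟩
      e * (x - l (suc i)) + (e * e - e) * (l₁ - l₀)         ≈⟨ +-cong (trans (*-congˡ (x≈y⇒x-y≈0 q)) (zeroʳ e)) (trans (*-congʳ (x≈y⇒x-y≈0 h)) (zeroˡ _)) ⟩
      0# + 0#                                               ≈⟨ +-identityʳ 0# ⟩
      0#                                                    ∎))
      where
      identity : ∀ e a b c → (a - c) * e ≈ e * ((e * a + (1# - e) * b) - c) + (e * e - e) * (b - a)
      identity = solve 4 (λ e a b c → (a :- c) :* e := e :* ((e :* a :+ (con (+ 1) :- e) :* b) :- c) :+ (e :* e :- e) :* (b :- a)) refl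

  Loc-ι : ∀ {q} → ¬ (p ℕD.∣ ℚ.ℚ.denominatorℕ q) → Loc (ι q)
  Loc-ι {q} h = let (c , z , _ , e) = Frac-ι q in c , z , (λ d → h (ℤD.∣⇒∣ᵤ d)) , e

  Loc-ι-unit : ∀ {q} → ¬ (p ℕD.∣ ℚ.ℚ.denominatorℕ q) → ¬ (p ℕD.∣ ℤ.∣ ℚ.ℚ.numerator q ∣) → ∃ λ y → Loc y × ι q * y ≈ 1#
  Loc-ι-unit {q} h h′ = let (c , z , _ , e) = Frac-ι q in Loc-unit {c} {z} (λ d → h′ (ℤD.∣⇒∣ᵤ d)) e (λ d → h (ℤD.∣⇒∣ᵤ d))

  -- Twist orders, denominators and valuations in an order

  module _ (O : Order) where
    open Order O

    abstract
      common-order : ∀ s (x : Fin s → Carrier) → (∀ i → R (x i)) → (∀ i → ∃ λ N → (pow (x i) (suc N) - 1#) ∈ϖ^ 1) →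
                     ∃ λ N → ∀ i → (pow (x i) (suc N) - 1#) ∈ϖ^ 1
      common-order zero    x rx h = 0 , λ ()
      common-order (suc s) x rx h =
        let (N , hN) = common-order s (λ i → x (suc i)) (λ i → rx (suc i)) (λ i → h (suc i))
            (N₀ , hN₀) = h zero
        -- The successor of this number computes to `suc N₀ ℕ.* suc N`, a common multiple of both
        -- exponents.
        in N ℕ.+ N₀ ℕ.* suc N , λ
          { zero → ∈ϖ^-resp {1} (+-congʳ (trans (sym (pow-* (x zero) (suc N) (suc N₀))) (reflexive (≡.cong (pow (x zero)) (ℕP.*-comm (suc N) (suc N₀))))))
              (pow-≡1 O {1} (suc N) (P-pow (suc N₀) (rx zero)) hN₀)
          ; (suc i) → ∈ϖ^-resp {1} (+-congʳ (sym (pow-* (x (suc i)) (suc N₀) (suc N))))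
              (pow-≡1 O {1} (suc N₀) (P-pow (suc N) (rx (suc i))) (hN i)) }

    -- (x^j)^N is a power of (x^N)^(p^M), which is congruent to 1 even modulo p^(M+1).
    pow-twist-order : ∀ {x} N → R x → (pow x N - 1#) ∈ϖ^ 1 → ∀ {j} M → (p ℕ.^ M) ℕD.∣ j → (pow (pow x j) N - 1#) ∈ϖ^ M
    pow-twist-order {x} N rx h {j} M (ℕD.divides t ≡.refl) = ∈ϖ^-resp {M} (+-congʳ (begin
        pow (pow (pow x N) (p ℕ.^ M)) t       ≈⟨ pow-* (pow x N) t (p ℕ.^ M) ⟨
        pow (pow x N) j                       ≈⟨ pow-* x j N ⟨
        pow x (j ℕ.* N)                       ≈⟨ reflexive (≡.cong (pow x) (ℕP.*-comm j N)) ⟩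
        pow x (N ℕ.* j)                       ≈⟨ pow-* x N j ⟩
        pow (pow x j) N                       ∎))
      (pow-≡1 O {M} t (P-pow (p ℕ.^ M) (P-pow N rx)) (∈ϖ^-pred O {M} (pow-p^-≡1 O (P-pow N rx) h M)))

    inverse-twist-order : ∀ {x y} N → R y → x * y ≈ 1# → (pow x N - 1#) ∈ϖ^ 1 → (pow y N - 1#) ∈ϖ^ 1
    inverse-twist-order {x} {y} N ry e h = ∈ϖ^-resp {1} (begin
        - pow y N * (pow x N - 1#)        ≈⟨ expand (pow y N) (pow x N) ⟩
        pow y N - pow x N * pow y N       ≈⟨ +-congˡ (-‿cong (trans (sym (pow-distrib-* x y N)) (trans (pow-cong N e) (pow-1# N)))) ⟩
        pow y N - 1#                      ∎)
      (∈ϖ^-* {1} (P- (P-pow N ry)) h)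
      where
      expand : ∀ a b → - a * (b - 1#) ≈ a - b * a
      expand = solve 2 (λ a b → (:- a) :* (b :- con (+ 1)) := a :- b :* a) refl

    zpow-twist-order : ∀ {x} nz N → R x → R (inv x nz) → (pow x N - 1#) ∈ϖ^ 1 →
      ∀ d M → (p ℕ.^ M) ℕD.∣ ℤ.∣ d ∣ → (pow (zpow x nz d) N - 1#) ∈ϖ^ M
    zpow-twist-order nz N rx ri h (+ j)    M = pow-twist-order N rx h M
    zpow-twist-order nz N rx ri h -[1+ j ] M = pow-twist-order N ri (inverse-twist-order N ri (inv-r _ nz) h) M

    R-zpow : ∀ {x} nz → R x → R (inv x nz) → ∀ d → R (zpow x nz d)
    R-zpow nz rx ri (+ j)    = P-pow j rx
    R-zpow nz rx ri -[1+ j ] = P-pow (suc j) ri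

    R-rescaleˡ : ∀ {c x} d → R (ν c * x) → R (ν (d ℤ.* c) * x)
    R-rescaleˡ {c} d r = resp (trans (sym (*-assoc _ _ _)) (*-congʳ (sym (ν-* d c)))) (P* (P-ν d) r)

    R-rescaleʳ : ∀ {c x} d → R (ν c * x) → R (ν (c ℤ.* d) * x)
    R-rescaleʳ {c} {x} d r = ≡.subst (λ e → R (ν e * x)) (ℤP.*-comm d c) (R-rescaleˡ {c} d r)

    common-denominator-list : ∀ {cs} → All T cs → ∃ λ c → c ≢ + 0 × All (λ x → R (ν c * x)) cs
    common-denominator-list [] = + 1 , (λ ()) , []
    common-denominator-list ((c , nz , r) ∷ ts) =
      let (d , nz′ , rs) = common-denominator-list ts in
      c ℤ.* d , ℤ-*-≢0 nz nz′ , R-rescaleʳ {c} d r ∷ All.map (R-rescaleˡ {d} c) rs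

    abstract
      common-denominator : ∀ s (f : Fin s → List Carrier) → (∀ i → All T (f i)) →
        ∃ λ c → c ≢ + 0 × (∀ i → All (λ x → R (ν c * x)) (f i))
      common-denominator zero    f h = + 1 , (λ ()) , λ ()
      common-denominator (suc s) f h =
        let (c , nz , hc) = common-denominator-list (h zero)
            (d , nz′ , hd) = common-denominator s (λ i → f (suc i)) (λ i → h (suc i))
        in c ℤ.* d , ℤ-*-≢0 nz nz′ , λ
          { zero → All.map (R-rescaleʳ {c} d) hc
          ; (suc i) → All.map (R-rescaleˡ {d} c) (hd i) }

    R-scaled-eval : ∀ {k cs x} → All (λ c → R (k * c)) cs → R x → R (k * eval cs x)
    R-scaled-eval {k} [] rx = resp (sym (zeroʳ k)) P0
    R-scaled-eval {k} {c ∷ cs} {x} (r ∷ rs) rx = resp (expand k c x (eval cs x)) (P+ r (P* rx (R-scaled-eval rs rx)))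
      where
      expand : ∀ k c x e → k * c + x * (k * e) ≈ k * (c + x * e)
      expand = solve 4 (λ k c x e → k :* c :+ x :* (k :* e) := k :* (c :+ x :* e)) refl

    scaled-eval-≡ : ∀ {M k cs x y} → All (λ c → R (k * c)) cs → R x → R y → (x - y) ∈ϖ^ M →
                    (k * eval cs x - k * eval cs y) ∈ϖ^ M
    scaled-eval-≡ {M} {k} [] rx ry h = ∈ϖ^-resp {M} (sym (-‿inverseʳ _)) (∈ϖ^-0 {M})
    scaled-eval-≡ {M} {k} {c ∷ cs} {x} {y} (r ∷ rs) rx ry h = ∈ϖ^-resp {M} (expand k c x y (eval cs x) (eval cs y))
      (∈ϖ^-+ {M} (∈ϖ^-* {M} rx (scaled-eval-≡ {M} rs rx ry h)) (∈ϖ^-* {M} (R-scaled-eval rs ry) h))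
      where
      expand : ∀ k c x y a b → x * (k * a - k * b) + (k * b) * (x - y) ≈ k * (c + x * a) - k * (c + y * b)
      expand = solve 6 (λ k c x y a b → x :* (k :* a :- k :* b) :+ (k :* b) :* (x :- y) := k :* (c :+ x :* a) :- k :* (c :+ y :* b)) refl

    ∈ϖ^-sum : ∀ {M} n {f : Fin n → Carrier} → (∀ i → f i ∈ϖ^ M) → sum n f ∈ϖ^ M
    ∈ϖ^-sum {M} zero    h = ∈ϖ^-0 {M}
    ∈ϖ^-sum {M} (suc n) h = ∈ϖ^-+ {M} (h zero) (∈ϖ^-sum {M} n (λ i → h (suc i)))

    νℤ≥⇒∈ϖ^ : ∀ {z M} → νℤ≥ p z M → ν z ∈ϖ^ M
    νℤ≥⇒∈ϖ^ {z} {M} h with ℤD.∣ᵤ⇒∣ {+ (p ℕ.^ M)} {z} h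
    ... | ℤD.divides q ≡.refl = ν q , P-ν q , trans (ν-* q _) (trans (*-comm _ _) (*-congʳ (sym (pow-ϖ M))))

    νℚ≥⇒∈ϖ^ : ∀ {q M} → νℚ≥ p q M → ι q ∈ϖ^ M
    νℚ≥⇒∈ϖ^ {q} {M} (h , h′) =
      let (c , z , _ , e) = Frac-ι q
          (y , ly , cy) = Loc-unit {+ 1} {c} {ν c} (λ d → h′ (ℤD.∣⇒∣ᵤ d)) (trans (*-congʳ ν-1) (*-identityˡ _)) p∤1
      in ∈ϖ^-resp {M} (trans (*-congˡ (sym e)) (trans (swap y (ν c) (ι q)) (trans (*-congʳ cy) (*-identityˡ _))))
           (∈ϖ^-* {M} (Loc⊂R ly) (νℤ≥⇒∈ϖ^ {z} {M} h))
      where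
      swap : ∀ y c q → y * (c * q) ≈ c * y * q
      swap = solve 3 (λ y c q → y :* (c :* q) := c :* y :* q) refl

  -- The twisted zero

  characteristic : ∀ m → (Fin m → ℚ) → List Carrier
  characteristic m coef = L.tabulate (λ i → - ι (coef i))

  meval-characteristic : ∀ m coef x → meval (characteristic m coef) x ≈ pow x m - sum m (λ i → ι (coef i) * pow x (toℕ i))
  meval-characteristic m coef x = trans (meval-tabulate m (λ i → - ι (coef i)) x)
    (+-congˡ (trans (sum-cong m (λ i → sym (-‿distribˡ-* _ _))) (sum-neg m (λ i → ι (coef i) * pow x (toℕ i)))))

  CharRoot⇒meval≈0 : ∀ m coef {x} → CharRoot m coef x → meval (characteristic m coef) x ≈ 0#
  CharRoot⇒meval≈0 m coef {x} h = trans (meval-characteristic m coef x) (x≈y⇒x-y≈0 h)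

  meval≈0⇒CharRoot : ∀ m coef {x} → meval (characteristic m coef) x ≈ 0# → CharRoot m coef x
  meval≈0⇒CharRoot m coef {x} h = x-y≈0⇒x≈y (trans (sym (meval-characteristic m coef x)) h)

  -- `decidable` is conditional: with a single characteristic root there is no pair of roots to test
  -- idempotents on, and the order is still required there.
  record Setup (s : ℕ) (l : Fin s → Carrier) (l≉0 : ∀ i → ¬ l i ≈ 0#) : Set₁ where
    field
      O         : Order
      n         : ℕ
      roots     : List Carrier
    open Order O using (R; _∈ϖ^_; Decidable≈0)
    N : ℕ
    N = suc n
    rs : List Carrier
    rs = 1# ∷ roots
    field
      rs∈R      : All R rs
      rs-unity  : All (λ r → pow r N ≈ 1#) rs
      rs-splits : ∀ A B → pow A N - pow B N ≈ ∏ rs (λ r → A - r * B)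
      l∈R       : ∀ i → R (l i)
      inv-l∈R   : ∀ i → R (inv (l i) (l≉0 i))
      l-order   : ∀ i → (pow (l i) N - 1#) ∈ϖ^ 1
      decidable : DecidableIdempotents → Decidable≈0

  -- The exponent N is found in the order generated by the characteristic roots. Only then can the
  -- N-th roots of unity be adjoined, and the congruences l_i^N ≡ 1 persist in the larger order.
  adjoin-unit-roots : (O : Order) → Order.Decidable≈0 O → ∀ {s l} l≉0 →
    (∀ i → Order.R O (l i)) → (∀ i → Order.R O (inv (l i) (l≉0 i))) → Setup s l l≉0
  adjoin-unit-roots O O-decidable {s} {l} l≉0 l∈R inv-l∈R =
    from-order (common-order O s l l∈R (λ i → unit-order-mod-ϖ O (l∈R i) (inv-l∈R i) (inv-r _ (l≉0 i))))
    where
    module O = Order O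
    module _ (n : ℕ) (l-order : ∀ i → O._∈ϖ^_ (pow (l i) (suc n) - 1#) 1) (roots : List Carrier)
             (are-roots : All (λ r → meval (X^-1 n) r ≈ 0#) (1# ∷ roots))
             (splits : ∀ A B → pow A (suc n) - pow B (suc n) ≈ ∏ (1# ∷ roots) (λ r → A - r * B)) where
      unity : ∀ {r} → meval (X^-1 n) r ≈ 0# → pow r (suc n) ≈ 1#
      unity {r} h = x-y≈0⇒x≈y (trans (sym (meval-X^-1 n r)) h)
      from-extension : (∃ λ O′ → (∀ {x} → O.R x → Order.R O′ x) × All (Order.R O′) (1# ∷ roots) ×
        (All (λ θ → ∀ δ → meval (X^-1 n) δ ≈ 0# → Dec (θ ≈ δ)) (1# ∷ roots) → O.Decidable≈0 → Order.Decidable≈0 O′)) → Setup s l l≉0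
      from-extension (O′ , incl , rs∈R , dec) = record
        { O = O′ ; n = n ; roots = roots ; rs∈R = rs∈R ; rs-unity = All.map unity are-roots ; rs-splits = splits
        ; l∈R = λ i → incl (l∈R i) ; inv-l∈R = λ i → incl (inv-l∈R i)
        ; l-order = λ i → incl-ϖ (l-order i)
        ; decidable = λ idem → dec (All.map (λ {r} h δ h′ → decide-unit-roots idem n r δ (unity h) (unity h′)) are-roots)
                                   (λ {x} → O-decidable {x}) }
        where
        incl-ϖ : ∀ {x} → O._∈ϖ^_ x 1 → Order._∈ϖ^_ O′ x 1
        incl-ϖ (z , rz , e) = z , incl rz , e
    from-roots : ∀ n → (∀ i → O._∈ϖ^_ (pow (l i) (suc n) - 1#) 1) →
      (∃ λ rs → All (λ r → meval (X^-1 n) r ≈ 0#) (1# ∷ rs) ×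
        (∀ A B → pow A (suc n) - pow B (suc n) ≈ ∏ (1# ∷ rs) (λ r → A - r * B))) → Setup s l l≉0
    from-roots n l-order (roots , are-roots , splits) =
      from-extension n l-order roots are-roots splits (adjoin-roots O (Loc-X^-1 n) are-roots)
    from-order : (∃ λ n → ∀ i → O._∈ϖ^_ (pow (l i) (suc n) - 1#) 1) → Setup s l l≉0
    from-order (n , l-order) = from-roots n l-order (unit-roots n)

  setup : ∀ m coef → Regular p (suc m) coef → ∀ s (l : Fin s → Carrier) l≉0 → (∀ i j → l i ≈ l j → i ≡ j) →
    (∀ i → CharRoot (suc m) coef (l i)) → (∀ x → CharRoot (suc m) coef x → ∃ λ i → x ≈ l i) → Setup s l l≉0
  setup m coef regular s l l≉0 distinct l-root all-roots = from-extension (adjoin-roots Loc-order Loc-χ (AllP.tabulate⁺ χ-root))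
    where
    χ : List Carrier
    χ = characteristic (suc m) coef
    χ-root : ∀ i → meval χ (l i) ≈ 0#
    χ-root i = CharRoot⇒meval≈0 (suc m) coef (l-root i)
    Loc-χ : All Loc χ
    Loc-χ = AllP.tabulate⁺ {f = λ i → - ι (coef i)} (λ i → Loc.P- (Loc-ι {coef i} (proj₁ regular i)))
    decide : ∀ i δ → meval χ δ ≈ 0# → Dec (l i ≈ δ)
    decide i δ h = compare (all-roots δ (meval≈0⇒CharRoot (suc m) coef h))
      where
      compare : (∃ λ j → δ ≈ l j) → Dec (l i ≈ δ)
      compare (j , e) with i F.≟ j
      ... | yes i≡j = yes (sym (trans e (reflexive (≡.cong l (≡.sym i≡j)))))
      ... | no ne   = no λ e′ → ne (distinct i j (trans e′ e))
    sign : ∀ a b → - a * - b ≈ a * b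
    sign = solve 2 (λ a b → (:- a) :* (:- b) := a :* b) refl
    from-extension : (∃ λ O → (∀ {x} → Loc x → Order.R O x) × All (Order.R O) (L.tabulate l) ×
      (All (λ θ → ∀ δ → meval χ δ ≈ 0# → Dec (θ ≈ δ)) (L.tabulate l) → Order.Decidable≈0 Loc-order → Order.Decidable≈0 O)) → Setup s l l≉0
    from-extension (O , incl , ls∈R , dec) =
      adjoin-unit-roots O (dec (AllP.tabulate⁺ decide) (λ {x} → Loc-decidable {x})) l≉0 l∈R (λ i → inverse i (unit i))
      where
      module O = Order O
      l∈R : ∀ i → O.R (l i)
      l∈R = AllP.tabulate⁻ ls∈R
      unit : ∀ i → ∃ λ y → O.R y × l i * y ≈ 1#
      unit i =
        let (y , ly , e) = Loc-ι-unit {coef zero} (proj₁ regular zero) (proj₂ regular zero ≡.refl)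
        -- The constant coefficient of χ is the negative of `ι (coef zero)`, hence the inverse
        -- `- y`.
        in root-unit O {c′ = - y} (All.map O.Loc⊂R Loc-χ) (O.Loc⊂R (Loc.P- ly)) (trans (sign (ι (coef zero)) y) e) (l∈R i) (χ-root i)
      inverse : ∀ i → (∃ λ y → O.R y × l i * y ≈ 1#) → O.R (inv (l i) (l≉0 i))
      inverse i (y , ry , e) = O.resp (sym (inv-unique (l≉0 i) e)) ry

  module Core
    (U : ℤ → ℚ) (s : ℕ) (lam : Fin s → Carrier) (lam≉0 : ∀ i → ¬ lam i ≈ 0#)
    (distinct : ∀ i j → lam i ≈ lam j → i ≡ j)
    (f : Fin s → List Carrier)
    (expand : ∀ n → ι (U n) ≈ sum s (λ i → eval (f i) (ι (ℤtoℚ n)) * zpow (lam i) (lam≉0 i) n))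
    (a : ℤ) (nseq : ℕ → ℤ)
    (U→0 : TendsToInfty (νℚ≥ p) (λ k → U (nseq k)))
    (n→a : TendsToInfty (νℤ≥ p) (λ k → nseq k ℤ.- a))
    (S : Setup s lam lam≉0)
    where

    open Setup S using (O; N; rs; rs∈R; rs-unity; rs-splits) renaming (l∈R to lam∈R; inv-l∈R to inv-lam∈R; l-order to lam-order)
    open Order O

    expandν : ∀ n → ι (U n) ≈ sum s (λ i → eval (f i) (ν n) * zpow (lam i) (lam≉0 i) n)
    expandν n = trans (expand n) (sum-cong s (λ i → *-congʳ (eval-cong (f i) (reflexive (≡.sym (ν≡ι n))))))

    -- T is needed in place of R: the differences l_i - l_j are invertible there but need not be
    -- units of R, and interpolation divides by integers.
    f∈T : ∀ i → All T (f i)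
    f∈T i = coefficients-from-values T-subring Frac⊂T 0 (f i)
      (components∈P T-subring s lam (λ i → R⊂T (lam∈R i))
        (λ i → inv (lam i) (lam≉0 i) , R⊂T (inv-lam∈R i) , inv-r _ _)
        (λ i j ne → T-inverse (R⊂T (P-sub (lam∈R i) (lam∈R j))) (λ z → ne (distinct i j (x-y≈0⇒x≈y z))))
        (λ i n → eval (f i) (ν (+ n))) (λ i → length (f i)) (λ i → PolySeq-eval (f i))
        (λ n → T.resp (expandν (+ n)) (Frac⊂T (Frac-ι (U (+ n))))) i)

    denominator = common-denominator O s f f∈T

    k : Carrier
    k = ν (proj₁ denominator)

    k≉0 : ¬ k ≈ 0#
    k≉0 = ν≉0 (proj₁ (proj₂ denominator))

    kf∈R : ∀ i → All (λ x → R (k * x)) (f i)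
    kf∈R = proj₂ (proj₂ denominator)

    Z : ∀ n → Fin s → Carrier
    Z n i = zpow (lam i) (lam≉0 i) n

    Z∈R : ∀ n i → R (Z n i)
    Z∈R n i = R-zpow O (lam≉0 i) (lam∈R i) (inv-lam∈R i) n

    X : Fin s → Carrier
    X i = k * eval (f i) (ν a) * Z a i

    X∈R : ∀ i → R (X i)
    X∈R i = P* (R-scaled-eval O (kf∈R i) (P-ν a)) (Z∈R a i)

    -- With y_i = l_i^(n-a), the sum equals k U(n) + Σ k (f_i(a) - f_i(n)) l_i^a y_i. The first term
    -- is small by the valuation of U(n), the others because n is close to a.
    twisted-sum-small : ∀ n M → νℚ≥ p (U n) M → νℤ≥ p (n ℤ.- a) M → sum s (λ i → Z (n ℤ.- a) i * X i) ∈ϖ^ M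
    twisted-sum-small n M hU hn = ∈ϖ^-resp {M} (begin
        sum s (λ i → d i * (Z a i * y i)) + k * ι (U n)
          ≈⟨ +-congˡ (trans (*-congˡ (expandν n)) (sym (sum-*ˡ s k (λ i → eval (f i) (ν n) * Z n i)))) ⟩
        sum s (λ i → d i * (Z a i * y i)) + sum s (λ i → k * (eval (f i) (ν n) * Z n i))
          ≈⟨ sum-+ s (λ i → d i * (Z a i * y i)) (λ i → k * (eval (f i) (ν n) * Z n i)) ⟨
        sum s (λ i → d i * (Z a i * y i) + k * (eval (f i) (ν n) * Z n i))
          ≈⟨ sum-cong s (λ i → trans (+-congˡ (*-congˡ (*-congˡ (Z-split i)))) (collect k (eval (f i) (ν a)) (eval (f i) (ν n)) (Z a i) (y i))) ⟩
        sum s (λ i → y i * X i) ∎)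
      (∈ϖ^-+ {M}
        (∈ϖ^-sum O {M} s (λ i → ∈ϖ^-resp {M} (*-comm _ _) (∈ϖ^-* {M} (P* (Z∈R a i) (Z∈R (n ℤ.- a) i))
          (scaled-eval-≡ O {M} (kf∈R i) (P-ν a) (P-ν n) a-n))))
        (∈ϖ^-* {M} (P-ν _) (νℚ≥⇒∈ϖ^ O {U n} {M} hU)))
      where
      y : Fin s → Carrier
      y = Z (n ℤ.- a)
      d : Fin s → Carrier
      d i = k * eval (f i) (ν a) - k * eval (f i) (ν n)
      Z-split : ∀ i → Z n i ≈ Z a i * y i
      Z-split i = trans (reflexive (≡.cong (zpow (lam i) (lam≉0 i)) a+[n-a])) (zpow-+ (lam i) (lam≉0 i) a (n ℤ.- a))
        where
        a+[n-a] : n ≡ a ℤ.+ (n ℤ.- a)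
        a+[n-a] = ≡.sym (≡.trans (ℤP.+-comm a (n ℤ.- a)) (≡.trans (ℤP.+-assoc n (ℤ.- a) a)
                    (≡.trans (≡.cong (λ t → n ℤ.+ t) (ℤP.+-inverseˡ a)) (ℤP.+-identityʳ n))))
      collect : ∀ k A B z y → (k * A - k * B) * (z * y) + k * (B * (z * y)) ≈ y * (k * A * z)
      collect = solve 5 (λ k A B z y → (k :* A :- k :* B) :* (z :* y) :+ k :* (B :* (z :* y)) := y :* (k :* A :* z)) refl
      a-n : (ν a - ν n) ∈ϖ^ M
      a-n = ∈ϖ^-resp {M} (trans (-‿cong (trans (ν-+ n (ℤ.- a)) (+-congˡ (ν-neg a)))) (flip (ν n) (ν a)))
              (∈ϖ^-neg {M} (νℤ≥⇒∈ϖ^ O {n ℤ.- a} {M} hn))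
        where
        flip : ∀ n a → - (n - a) ≈ a - n
        flip = solve 2 (λ n a → :- (n :- a) := a :- n) refl

    -- The summand `0#` is the initial value of the accumulator `A` in `∏∏-twist`.
    φ : (Fin s → Carrier) → Carrier
    φ ξ = 0# + linear-form s X ξ

    W : Carrier
    W = ∏∏ rs s φ

    φ∈R : ∀ ξ → (∀ i → R (ξ i)) → R (φ ξ)
    φ∈R ξ rξ = P+ P0 (R-linear-form O 0 s X∈R rξ)

    W∈ϖ^ : ∀ M → W ∈ϖ^ M
    W∈ϖ^ M = ∈ϖ^-resp {M} (difference W W′) (∈ϖ^-+ {M} W′∈ϖ^ (∈ϖ^-neg {M} W′≡W))
      where
      j : ℕ
      j = proj₁ (U→0 M) ℕ.⊔ proj₁ (n→a M)
      n d : ℤ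
      n = nseq j
      d = n ℤ.- a
      hU : νℚ≥ p (U n) M
      hU = proj₂ (U→0 M) j (ℕP.m≤m⊔n _ _)
      hn : νℤ≥ p d M
      hn = proj₂ (n→a M) j (ℕP.m≤n⊔m _ _)
      φ′ : (Fin s → Carrier) → Carrier
      φ′ ξ = 0# + linear-form s (λ i → Z d i * X i) ξ
      W′ : Carrier
      W′ = ∏∏ rs s φ′
      W′∈ϖ^ : W′ ∈ϖ^ M
      W′∈ϖ^ = ∏∏-∈ϖ^ O M s {φ′} (All.tail rs∈R)
        (λ ξ rξ → P+ P0 (R-linear-form O M s (λ i → P* (Z∈R d i) (X∈R i)) rξ))
        (∈ϖ^-resp {M} (sym (trans (+-identityˡ _) (linear-form-ones s (λ i → Z d i * X i)))) (twisted-sum-small n M hU hn))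
      W′≡W : (W′ - W) ∈ϖ^ M
      W′≡W = ∏∏-twist O M {rs} {N} rs∈R rs-splits s X (Z d) X∈R (Z∈R d)
        (λ i → zpow-twist-order O (lam≉0 i) N (lam∈R i) (inv-lam∈R i) (lam-order i) d M hn) P0
      difference : ∀ W W′ → W′ + - (W′ - W) ≈ W
      difference = solve 2 (λ W W′ → W′ :+ :- (W′ :- W) := W) refl

    IsUnitRoot : Carrier → Set
    IsUnitRoot r = R r × pow r N ≈ 1#

    TwistedZero′ : Set
    TwistedZero′ = ∃ λ (ξ : Fin s → Carrier) → (∀ i → RootOfUnity (ξ i)) ×
      sum s (λ i → ξ i * eval (f i) (ι (ℤtoℚ a)) * zpow (lam i) (lam≉0 i) a) ≈ 0#

    twisted-zero : (∀ ξ → (∀ i → IsUnitRoot (ξ i)) → (φ ξ ≈ 0#) ⊎ (¬ φ ξ ≈ 0#)) → TwistedZero′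
    twisted-zero dec = conclude (decide-∏∏ (All.zip (rs∈R , rs-unity)) s φ dec)
      where
      unscale : ∀ ξ → φ ξ ≈ k * sum s (λ i → ξ i * eval (f i) (ι (ℤtoℚ a)) * Z a i)
      unscale ξ = trans (+-identityˡ _) (trans (sum-cong s (λ i → trans
          (*-congˡ (*-congʳ (*-congˡ (eval-cong (f i) (reflexive (ν≡ι a)))))) (rearrange (ξ i) k (eval (f i) (ι (ℤtoℚ a))) (Z a i))))
        (sum-*ˡ s k (λ i → ξ i * eval (f i) (ι (ℤtoℚ a)) * Z a i)))
        where
        rearrange : ∀ x k e z → x * (k * e * z) ≈ k * (x * e * z)
        rearrange = solve 4 (λ x k e z → x :* (k :* e :* z) := k :* (x :* e :* z)) refl
      conclude : (∃ λ ξ → (∀ i → IsUnitRoot (ξ i)) × φ ξ ≈ 0#) ⊎ (¬ W ≈ 0#) → TwistedZero′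
      conclude (inj₁ (ξ , h , z)) = ξ , (λ i → N , ℕ.s≤s ℕ.z≤n , proj₂ (h i)) , cancel-≉0 k≉0 (trans (sym (unscale ξ)) z)
      conclude (inj₂ nz) = ⊥-elim (T-separated (R-∏∏ O 0 s rs∈R φ∈R) nz W∈ϖ^)

    twisted-zero-if-decidable-idempotents : DecidableIdempotents → TwistedZero′
    twisted-zero-if-decidable-idempotents dec = twisted-zero λ ξ h → Setup.decidable S dec (φ∈R ξ (λ i → proj₁ (h i)))

open import Data.Integer using (_-_)

theorem1p4 : (U : ℤ → ℚ) (m : ℕ) (coef : Fin m → ℚ) → IsLRS U m coef →
    (a : ℤ) (p : ℕ) → Prime p → Regular p m coef →
    (∃ λ (nseq : ℕ → ℤ) →
    TendsToInfty (νℚ≥ p) (λ k → U (nseq k)) ×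
    TendsToInfty (νℤ≥ p) (λ k → nseq k - a)) →
    (K : AlgClosedFieldOverℚ 0ℓ 0ℓ) →
    (B : ACF.BinetExpansion K U m coef) →
    ACF.BinetExpansion.TwistedZero B a
theorem1p4 U m coef _ a p p-prime regular (nseq , U→0 , n→a) K
  record { s = zero } = (λ ()) , (λ ()) , AtPrime.refl K p p-prime
-- For m = 0 the characteristic equation reads 1 ≈ 0, so there cannot be a root.
theorem1p4 U zero coef _ a p p-prime regular (nseq , U→0 , n→a) K
  record { s = suc s ; roots = roots } = ⊥-elim (AtPrime.1≉0 K p p-prime (roots zero))
theorem1p4 U (suc m) coef _ a p p-prime regular (nseq , U→0 , n→a) K
  record { s = suc zero ; lam = lam ; lam≉0 = lam≉0 ; distinct = distinct ; roots = roots ; allRoots = allRoots ; f = f ; expand = expand } =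
  twisted-zero (λ ξ h → decide-φ ξ (h zero) (U a ℚP.≟ 0ℚ))
  where
  open AtPrime K p p-prime using (module Core; setup; _≈_; _*_; ι; 0#; trans; sym; *-congˡ; *-congʳ; +-identityˡ; +-identityʳ; zeroʳ; *-≉0; ≉0-resp; unit≉0; ι≈0⇒≡0; ι-≡; ι-0; *-assoc; Carrier)
  open Core U 1 lam lam≉0 distinct f expand a nseq U→0 n→a (setup m coef regular 1 lam lam≉0 distinct roots allRoots)
  X₀ : Carrier
  X₀ = X zero
  ιU : X₀ ≈ k * ι (U a)
  ιU = trans (*-assoc _ _ _) (*-congˡ (sym (trans (expandν a) (+-identityʳ _))))
  decide-φ : ∀ ξ → IsUnitRoot (ξ zero) → Dec (U a ≡ 0ℚ) → (φ ξ ≈ 0#) ⊎ (¬ φ ξ ≈ 0#)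
  decide-φ ξ h (yes z) = inj₁ (trans (+-identityˡ _) (trans (+-identityʳ _) (trans (*-congˡ (trans ιU (trans (*-congˡ (trans (ι-≡ z) ι-0)) (zeroʳ _)))) (zeroʳ _))))
  decide-φ ξ h (no nz) = inj₂ (≉0-resp (sym (trans (+-identityˡ _) (+-identityʳ _)))
    (*-≉0 (unit≉0 (proj₂ h)) (≉0-resp (sym ιU) (*-≉0 k≉0 (λ z → nz (ι≈0⇒≡0 (U a) z))))))
theorem1p4 U (suc m) coef _ a p p-prime regular (nseq , U→0 , n→a) K
  record { s = suc (suc s) ; lam = lam ; lam≉0 = lam≉0 ; distinct = distinct ; roots = roots ; allRoots = allRoots ; f = f ; expand = expand } =
  twisted-zero-if-decidable-idempotents
    (decidable-idempotents (characteristic (suc m) coef) lam (λ i → CharRoot⇒meval≈0 (suc m) coef (roots i)) distinct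
      (λ x h → allRoots x (meval≈0⇒CharRoot (suc m) coef h)))
  where
  open AtPrime K p p-prime using (module Core; setup; characteristic; decidable-idempotents; CharRoot⇒meval≈0; meval≈0⇒CharRoot)
  open Core U (suc (suc s)) lam lam≉0 distinct f expand a nseq U→0 n→a (setup m coef regular (suc (suc s)) lam lam≉0 distinct roots allRoots)
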